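{- Let $\delta \geq 2$ be an integer such that $\delta-1$ is a prime power. For integers $n$ and $g$, let $r(n,\delta,g)$ denote the maximum radius of a connected graph on $n$ vertices with minimum degree $\delta$ and girth at least $g$. Then: (i) there exist integers $n_i \to \infty$ such that $r(n_i,\delta,6) \geq \frac{3n_i}{2(\delta^2-\delta+1)}-3$; (ii) there exist integers $n_j \to \infty$ such that $r(n_j,\delta,8) \geq \frac{2n_j}{\delta^3-2\delta^2+2\delta}-4$; (iii) there exist integers $n_k \to \infty$ such that $r(n_k,\delta,12) \geq \frac{3n_k}{((\delta-1)^3+1)(\delta^2-\delta+1)}-6$.
   Context: Graphs are finite and simple. The girth of a graph is the length of its shortest cycle (infinite if acyclic). The radius of a connected graph $G$ is $\min_v \max_w d(v,w)$, with $d$ the graph distance. -}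

module Defs where

open import Data.Nat using (ℕ; zero; suc; _+_; _*_; _∸_; _^_; _≤_)
open import Data.Nat.Primality using (Prime)
open import Data.Bool using (Bool; true; false; if_then_else_)
open import Data.Fin using (Fin)
open import Data.List using (List; []; _∷_; _++_; [_]; length; map; allFin)
open import Data.Nat.ListAction using (sum)
open import Data.List.Relation.Unary.Linked using (Linked)
open import Data.List.Relation.Unary.Unique.Propositional using (Unique)
open import Data.Product using (Σ; ∃; ∃-syntax; _×_)
open import Relation.Binary.PropositionalEquality using (_≡_)

IsPrimePower : ℕ → Set
IsPrimePower q = ∃[ p ] ∃[ k ] (Prime p × 1 ≤ k × q ≡ p ^ k)

record Graph (n : ℕ) : Set where
  field
    adj   : Fin n → Fin n → Bool
    sym   : ∀ u v → adj u v ≡ adj v u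
    irrefl : ∀ u → adj u u ≡ false

module _ {n : ℕ} (G : Graph n) where
  open Graph G

  Adj : Fin n → Fin n → Set
  Adj u v = adj u v ≡ true

  degree : Fin n → ℕ
  degree u = sum (map (λ v → if adj u v then 1 else 0) (allFin n))

  MinDegree : ℕ → Set
  MinDegree δ = (∀ u → δ ≤ degree u) × (∃[ u ] degree u ≡ δ)

  data Walk : Fin n → Fin n → ℕ → Set where
    nil  : ∀ {u} → Walk u u 0
    cons : ∀ {u w v k} → Adj u w → Walk w v k → Walk u v (suc k)

  Connected : Set
  Connected = ∀ u v → ∃[ k ] Walk u v k

  IsDist : Fin n → Fin n → ℕ → Set
  IsDist u v d = Walk u v d × (∀ k → Walk u v k → d ≤ k)

  IsEcc : Fin n → ℕ → Set
  IsEcc v e = (∀ w → ∃[ d ] (IsDist v w d × d ≤ e)) × (∃[ w ] IsDist v w e)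

  IsRadius : ℕ → Set
  IsRadius r = (∃[ v ] IsEcc v r) × (∀ v e → IsEcc v e → r ≤ e)

  IsCycle : List (Fin n) → Set
  IsCycle [] = Data.Empty.⊥ where import Data.Empty
  IsCycle (v ∷ vs) = Unique (v ∷ vs) × 3 ≤ length (v ∷ vs) × Linked Adj (v ∷ vs ++ [ v ])

  GirthAtLeast : ℕ → Set
  GirthAtLeast g = ∀ c → IsCycle c → g ≤ length c

Admissible : (n δ g : ℕ) → Graph n → Set
Admissible n δ g G = Connected G × MinDegree G δ × GirthAtLeast G g

-- "r(n,δ,g) satisfies B", for an upward-closed bound B on the radius:
-- some admissible graph on n vertices has radius r with B r
-- (equivalent to the maximum radius satisfying B)
MaxRadiusSatisfies : (n δ g : ℕ) → (ℕ → Set) → Set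
MaxRadiusSatisfies n δ g B = ∃[ G ] (Admissible n δ g G × ∃[ r ] (IsRadius G r × B r))

InfinitelyMany : (ℕ → Set) → Set
InfinitelyMany P = ∀ N → ∃[ n ] (N ≤ n × P n)

{-# OPTIONS --safe #-}
-- Let q = δ - 1.  The incidence graph of a generalised m-gon of order q is (q + 1)-regular, has
-- girth 2m and 2 (1 + q + ... + q^(m-1)) vertices; the plane PG(2, q), the symplectic quadrangle and the
-- split Cayley hexagon are the cases m = 3, 4, 6.  Its cyclic K-fold cover, unwrapped along one edge,
-- keeps degree and girth, is connected, and maps to a cycle of length 2mK, so every vertex of it has
-- eccentricity at least mK when K is even.
--
-- Seen from an edge, a generalised m-gon consists of two q-ary trees of depth m - 1, rooted at the
-- ends of the edge, whose leaves are joined by polynomial equations.  To bound the girth, the points are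
-- represented by vectors such that collinear points are orthogonal while x, z on different lines through
-- y are not; for the hexagon the product is that of the split octonions, where moreover x z is a nonzero
-- multiple of y, and alternativity excludes pentagons.
--
-- The field of order q = p^k is found in a residue ring of F_p[X] / (X^(q-1) - 1): a prime ideal that avoids
-- ∏ (X^(p^j) - X), 0 < j < k, leaves X with k distinct conjugates, and the roots of T^q - T in the
-- residue domain are exactly the q polynomials of degree < k in X.
module Submission where

open import Defs
open import Algebra.Bundles using (CommutativeRing)
open import Data.Bool using (Bool; true; false; not; if_then_else_)
open import Data.Empty using (⊥; ⊥-elim)
open import Data.Fin as Fin using (Fin; zero; suc; toℕ; fromℕ; inject₁)
import Data.Fin.Properties as Finₚ
open import Data.Nat as ℕ using (ℕ; zero; suc; _≤_; _<_; z≤n; s≤s; NonZero)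
import Data.Nat.Properties as ℕₚ
open import Data.Product using (∃; ∃-syntax; _×_; _,_; proj₁; proj₂)
open import Data.Sum as Sum using (_⊎_; inj₁; inj₂)
open import Function using (_∘_)
open import Level using (0ℓ)
open import Relation.Nullary using (¬_; Dec; yes; no; does; contradiction)

-- About the polygons only a lower bound on the girth has to be proved, since the number of vertices
-- and the degree are read off the two trees. A cycle of the cover projects to a closed walk that
-- may repeat vertices but never backtracks, so closed walks without backtracking, rather than
-- cycles, are excluded below the girth. An even number of sheets gives every vertex an antipode on
-- the cycle of length 2mK. With K = 2h and S = 1 + q + ... + q^(m-1) the cover has n = 4Sh vertices
-- and radius at least 2mh = mn / (2S). For m = 3, 4, 6 this is the leading term of (i), (ii),
-- (iii), because S equals δ^2 - δ + 1, δ^3 - 2δ^2 + 2δ and ((δ-1)^3 + 1)(δ^2 - δ + 1) respectively.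
-- The equations between the leaves involve only ring operations, so the geometry reduces to
-- polynomial identities with integer coefficients, valid in every characteristic, and the absence
-- of zero divisors. The field is sought in a ring with an explicit modulus because a prime ideal of
-- a finite ring with decidable equality can be found by search, whereas an irreducible polynomial
-- of degree k would first have to be shown to exist.

-- Polynomial identities with integer coefficients in a commutative ring

module IntegerSolver (R : CommutativeRing 0ℓ 0ℓ) where

  open import Data.Integer as ℤ using (ℤ; +_; -[1+_]; _⊖_)
  import Data.Integer.Properties as ℤₚ
  open import Data.Maybe using (Maybe; just; nothing)
  open import Relation.Binary.PropositionalEquality as ≡ using (_≡_)

  open CommutativeRing R
  open import Algebra.Properties.Ring ring using (-‿distribˡ-*; -‿distribʳ-*; -0#≈0#; -‿involutive)
  open import Algebra.Properties.AbelianGroup +-abelianGroup using (⁻¹-∙-comm)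
  open import Algebra.Properties.Semiring.Mult.TCOptimised semiring using (×1-homo-*; 1+×; ×-homo-+) renaming (_×_ to _×′_)
  open import Relation.Binary.Reasoning.Setoid setoid
  open import Algebra.Solver.Ring.AlmostCommutativeRing using (fromCommutativeRing; _-Raw-AlmostCommutative⟶_)

  -- Coefficients are integers rather than ring elements: in an abstract ring the solver could not
  -- see that 1 - 1 vanishes.
  ⟪_⟫ : ℤ → Carrier
  ⟪ + n ⟫      = n ×′ 1#
  ⟪ -[1+ n ] ⟫ = - (suc n ×′ 1#)

  ⊖-homo : ∀ m n → ⟪ m ⊖ n ⟫ ≈ m ×′ 1# - n ×′ 1#
  ⊖-homo m zero = begin
    ⟪ m ⊖ 0 ⟫  ≡⟨ ≡.cong ⟪_⟫ (ℤₚ.⊖-≥ {m} ℕ.z≤n) ⟩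
    m ×′ 1#  ≈⟨ +-identityʳ _ ⟨
    m ×′ 1# + 0#  ≈⟨ +-congˡ -0#≈0# ⟨
    m ×′ 1# - 0#  ∎
  ⊖-homo zero (suc n) = sym (+-identityˡ _)
  ⊖-homo (suc m) (suc n) = begin
    ⟪ suc m ⊖ suc n ⟫  ≡⟨ ≡.cong ⟪_⟫ (ℤₚ.[1+m]⊖[1+n]≡m⊖n m n) ⟩
    ⟪ m ⊖ n ⟫  ≈⟨ ⊖-homo m n ⟩
    m ×′ 1# - n ×′ 1#  ≈⟨ +-congˡ (+-identityˡ _) ⟨
    m ×′ 1# + (0# - n ×′ 1#)  ≈⟨ +-congˡ (+-congʳ (-‿inverseʳ 1#)) ⟨
    m ×′ 1# + ((1# - 1#) - n ×′ 1#)  ≈⟨ +-congˡ (+-assoc _ _ _) ⟩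
    m ×′ 1# + (1# + (- 1# - n ×′ 1#))  ≈⟨ +-assoc _ _ _ ⟨
    (m ×′ 1# + 1#) + (- 1# - n ×′ 1#)  ≈⟨ +-cong (+-comm _ _) (⁻¹-∙-comm _ _) ⟩
    (1# + m ×′ 1#) - (1# + n ×′ 1#)  ≈⟨ +-cong (1+× m 1#) (-‿cong (1+× n 1#)) ⟨
    suc m ×′ 1# - suc n ×′ 1#  ∎

  neg-homo : ∀ i → ⟪ ℤ.- i ⟫ ≈ - ⟪ i ⟫
  neg-homo (+ zero)     = sym -0#≈0#
  neg-homo (+ suc n)    = refl
  neg-homo (-[1+ n ])   = sym (-‿involutive _)

  +-homo : ∀ i j → ⟪ i ℤ.+ j ⟫ ≈ ⟪ i ⟫ + ⟪ j ⟫
  +-homo (+ m) (+ n)         = ×-homo-+ 1# m n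
  +-homo (+ m) -[1+ n ]      = ⊖-homo m (suc n)
  +-homo -[1+ m ] (+ n)      = trans (⊖-homo n (suc m)) (+-comm _ _)
  +-homo -[1+ m ] -[1+ n ]   = begin
    - (suc (suc (m ℕ.+ n)) ×′ 1#)  ≡⟨ ≡.cong (λ k → - (suc k ×′ 1#)) (≡.sym (ℕₚ.+-suc m n)) ⟩
    - ((suc m ℕ.+ suc n) ×′ 1#)  ≈⟨ -‿cong (×-homo-+ 1# (suc m) (suc n)) ⟩
    - (suc m ×′ 1# + suc n ×′ 1#)  ≈⟨ ⁻¹-∙-comm _ _ ⟨
    - (suc m ×′ 1#) - (suc n ×′ 1#)  ∎
    where import Data.Nat.Properties as ℕₚ

  *-homo : ∀ i j → ⟪ i ℤ.* j ⟫ ≈ ⟪ i ⟫ * ⟪ j ⟫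
  *-homo (+ m) (+ n) = trans (reflexive (≡.cong ⟪_⟫ (≡.sym (ℤₚ.pos-* m n)))) (×1-homo-* m n)
  *-homo (+ m) -[1+ n ] = begin
    ⟪ + m ℤ.* -[1+ n ] ⟫  ≡⟨ ≡.cong ⟪_⟫ (≡.sym (ℤₚ.neg-distribʳ-* (+ m) (+ suc n))) ⟩
    ⟪ ℤ.- (+ m ℤ.* + suc n) ⟫  ≈⟨ neg-homo (+ m ℤ.* + suc n) ⟩
    - ⟪ + m ℤ.* + suc n ⟫  ≈⟨ -‿cong (*-homo (+ m) (+ suc n)) ⟩
    - (m ×′ 1# * (suc n ×′ 1#))  ≈⟨ -‿distribʳ-* _ _ ⟩
    m ×′ 1# * - (suc n ×′ 1#)  ∎
  *-homo -[1+ m ] (+ n) = begin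
    ⟪ -[1+ m ] ℤ.* + n ⟫  ≡⟨ ≡.cong ⟪_⟫ (≡.sym (ℤₚ.neg-distribˡ-* (+ suc m) (+ n))) ⟩
    ⟪ ℤ.- (+ suc m ℤ.* + n) ⟫  ≈⟨ neg-homo (+ suc m ℤ.* + n) ⟩
    - ⟪ + suc m ℤ.* + n ⟫  ≈⟨ -‿cong (*-homo (+ suc m) (+ n)) ⟩
    - (suc m ×′ 1# * (n ×′ 1#))  ≈⟨ -‿distribˡ-* _ _ ⟩
    - (suc m ×′ 1#) * (n ×′ 1#)  ∎
  *-homo -[1+ m ] -[1+ n ] = begin
    (suc m ℕ.* suc n) ×′ 1#  ≈⟨ ×1-homo-* (suc m) (suc n) ⟩
    suc m ×′ 1# * (suc n ×′ 1#)  ≈⟨ -‿involutive _ ⟨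
    - - (suc m ×′ 1# * (suc n ×′ 1#))  ≈⟨ -‿cong (-‿distribʳ-* _ _) ⟩
    - (suc m ×′ 1# * - (suc n ×′ 1#))  ≈⟨ -‿distribˡ-* _ _ ⟩
    - (suc m ×′ 1#) * - (suc n ×′ 1#)  ∎

  morphism : ℤ.+-*-rawRing -Raw-AlmostCommutative⟶ fromCommutativeRing R
  morphism = record
    { ⟦_⟧ = ⟪_⟫ ; +-homo = +-homo ; *-homo = *-homo ; -‿homo = neg-homo ; 0-homo = refl ; 1-homo = refl }

  _≟ᶜ_ : ∀ i j → Maybe (⟪ i ⟫ ≈ ⟪ j ⟫)
  i ≟ᶜ j with i ℤ.≟ j
  ... | yes i≡j = just (reflexive (≡.cong ⟪_⟫ i≡j))
  ... | no _    = nothing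

  open import Algebra.Solver.Ring ℤ.+-*-rawRing (fromCommutativeRing R) morphism _≟ᶜ_ public

-- Finite graphs: radius, degree, edge labels, walks without backtracking

module Graphs where

  open import Data.Nat.ListAction using (sum)
  open import Data.List using (List; []; _∷_; _++_; [_]; length; map; allFin; filterᵇ; filter)
  import Data.List.Properties as Listₚ
  open import Data.List.Membership.Propositional using (_∈_)
  open import Data.List.Membership.Propositional.Properties using (∈-filter⁺; ∈-filter⁻; ∈-map⁺; ∈-map⁻; ∈-allFin)
  open import Data.List.Relation.Unary.All as All using (All; []; _∷_)
  open import Data.List.Relation.Unary.AllPairs using ([]; _∷_)
  open import Data.List.Relation.Unary.Linked using (Linked; []; [-]; _∷_)
  open import Data.List.Relation.Unary.Unique.Propositional using (Unique)
  import Data.List.Relation.Unary.Unique.Propositional.Properties as Uniqueₚ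
  open import Data.List.Relation.Binary.BagAndSetEquality using (∼bag⇒↭)
  open import Data.List.Membership.Propositional.Properties.WithK using (unique∧set⇒bag)
  open import Data.List.Relation.Binary.Permutation.Propositional.Properties using (↭-length)
  open import Function using (mk⇔; Injective; _↔_; Inverse)
  open import Relation.Nullary.Decidable using (map′; _×-dec_; dec-true; does-⇔)
  open import Relation.Unary using (Decidable)
  open import Relation.Binary.PropositionalEquality hiding ([_])

  least : {P : ℕ → Set} → Decidable P → ∀ k → P k → ∃[ m ] (P m × (∀ j → P j → m ≤ j))
  least P? zero pk = zero , pk , λ _ _ → z≤n
  least P? (suc k) pk with P? zero
  ... | yes p0 = zero , p0 , λ _ _ → z≤n
  ... | no ¬p0 with least (P? ∘ suc) k pk
  ...   | m , pm , min = suc m , pm , λ { zero p → contradiction p ¬p0 ; (suc j) p → s≤s (min j p) }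

  maximum : ∀ {n} (f : Fin (suc n) → ℕ) → ∃[ i ] (∀ j → f j ≤ f i)
  maximum {zero} f = zero , λ { zero → ℕₚ.≤-refl }
  maximum {suc n} f with maximum (f ∘ suc)
  ... | i , max with ℕₚ.≤-total (f zero) (f (suc i))
  ...   | inj₁ f0≤fi = suc i , λ { zero → f0≤fi ; (suc j) → max j }
  ...   | inj₂ fi≤f0 = zero , λ { zero → ℕₚ.≤-refl ; (suc j) → ℕₚ.≤-trans (max j) fi≤f0 }

  minimum : ∀ {n} (f : Fin (suc n) → ℕ) → ∃[ i ] (∀ j → f i ≤ f j)
  minimum {zero} f = zero , λ { zero → ℕₚ.≤-refl }
  minimum {suc n} f with minimum (f ∘ suc)
  ... | i , min with ℕₚ.≤-total (f zero) (f (suc i))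
  ...   | inj₁ f0≤fi = zero , λ { zero → ℕₚ.≤-refl ; (suc j) → ℕₚ.≤-trans f0≤fi (min j) }
  ...   | inj₂ fi≤f0 = suc i , λ { zero → fi≤f0 ; (suc j) → min j }

  module Radius {n : ℕ} (G : Graph n) where
    open Graph G using (adj)

    walk? : ∀ k u v → Dec (Walk G u v k)
    walk? zero u v = map′ (λ { refl → nil }) (λ { nil → refl }) (u Fin.≟ v)
    walk? (suc k) u v = map′ (λ { (w , a , p) → cons a p }) (λ { (cons a p) → _ , a , p })
      (Finₚ.any? λ w → (adj u w Data.Bool.≟ true) ×-dec walk? k w v)

    dist-unique : ∀ {u v d e} → IsDist G u v d → IsDist G u v e → d ≡ e
    dist-unique (p , p-min) (p′ , p′-min) = ℕₚ.≤-antisym (p-min _ p′) (p′-min _ p)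

    dist : Connected G → ∀ u v → ∃ (IsDist G u v)
    dist conn u v = let k , p = conn u v in least (λ k → walk? k u v) k p

  radius-exists : ∀ {n} (G : Graph (suc n)) → Connected G → ∃ (IsRadius G)
  radius-exists {n} G conn = ecc centre , (centre , isEcc centre) , least-ecc
    where
    open Radius G
    d : Fin (suc n) → Fin (suc n) → ℕ
    d u v = proj₁ (dist conn u v)
    furthest : ∀ u → ∃[ w ] (∀ v → d u v ≤ d u w)
    furthest u = maximum (d u)
    ecc : Fin (suc n) → ℕ
    ecc u = d u (proj₁ (furthest u))
    isEcc : ∀ u → IsEcc G u (ecc u)
    isEcc u = (λ w → d u w , proj₂ (dist conn u w) , proj₂ (furthest u) w)
            , (proj₁ (furthest u) , proj₂ (dist conn u _))
    centre : Fin (suc n)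
    centre = proj₁ (minimum ecc)
    least-ecc : ∀ v e → IsEcc G v e → ecc centre ≤ e
    least-ecc v e (bound , _) with bound (proj₁ (furthest v))
    ... | d′ , isD , d′≤e = ℕₚ.≤-trans (proj₂ (minimum ecc) v)
            (subst (_≤ e) (dist-unique isD (proj₂ (dist conn v _))) d′≤e)

  radius-≥ : ∀ {n} (G : Graph n) {b r} → (∀ v → ∃[ w ] (∀ k → Walk G v w k → b ≤ k)) → IsRadius G r → b ≤ r
  radius-≥ G far ((v , bound , _) , _) =
    let w , far-w = far v
        d , (p , _) , d≤r = bound w
    in ℕₚ.≤-trans (far-w d p) d≤r

  count-≡ : ∀ {n} (P : Fin n → Bool) xs →
    sum (map (λ v → if P v then 1 else 0) xs) ≡ length (filterᵇ P xs)
  count-≡ P [] = refl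
  count-≡ P (x ∷ xs) with P x
  ... | true  = cong suc (count-≡ P xs)
  ... | false = count-≡ P xs

  -- The filtered enumeration of `Fin n` and the image of `f` are duplicate-free lists with the same
  -- members, hence permutations of each other.
  count-image : ∀ {n δ} (P : Fin n → Bool) (f : Fin δ → Fin n) → Injective _≡_ _≡_ f →
    (∀ s → P (f s) ≡ true) → (∀ v → P v ≡ true → ∃[ s ] f s ≡ v) →
    sum (map (λ v → if P v then 1 else 0) (allFin n)) ≡ δ
  count-image {n} {δ} P f f-inj P∘f image = begin
    sum (map (λ v → if P v then 1 else 0) (allFin n)) ≡⟨ count-≡ P (allFin n) ⟩
    length (filterᵇ P (allFin n))  ≡⟨ ↭-length (∼bag⇒↭ same) ⟩
    length (map f (allFin δ))  ≡⟨ Listₚ.length-map f (allFin δ) ⟩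
    length (allFin δ)  ≡⟨ Listₚ.length-tabulate {n = δ} (λ i → i) ⟩
    δ  ∎
    where
    open ≡-Reasoning
    P? : Decidable (λ v → P v ≡ true)
    P? v = P v Data.Bool.≟ true
    filter-≡ : ∀ xs → filterᵇ P xs ≡ filter P? xs
    filter-≡ [] = refl
    filter-≡ (x ∷ xs) with P x
    ... | true  = cong (x ∷_) (filter-≡ xs)
    ... | false = filter-≡ xs
    same : _
    same = unique∧set⇒bag
      (subst Unique (sym (filter-≡ (allFin n))) (Uniqueₚ.filter⁺ P? (Uniqueₚ.allFin⁺ n)))
      (Uniqueₚ.map⁺ f-inj (Uniqueₚ.allFin⁺ δ))
      λ {x} → mk⇔
        (λ x∈ → let s , fs≡x = image x (proj₂ (∈-filter⁻ P? {xs = allFin n} (subst (x ∈_) (filter-≡ (allFin n)) x∈)))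
                in subst (_∈ map f (allFin δ)) fs≡x (∈-map⁺ f (∈-allFin s)))
        (λ x∈ → let s , _ , x≡fs = ∈-map⁻ f x∈
                in subst (_∈ filterᵇ P (allFin n)) (sym x≡fs)
                     (subst (f s ∈_) (sym (filter-≡ (allFin n))) (∈-filter⁺ P? (∈-allFin (f s)) (P∘f s))))

  -- A walk u, v, w that does not backtrack at v.
  record Turn {C : Set} {δ : ℕ} (nb : C → Fin δ → C) (u v w : C) : Set where
    constructor turning
    field
      s s′ : Fin δ
      s≢s′ : s ≢ s′
      to-u : nb v s ≡ u
      to-w : nb v s′ ≡ w

  -- Every vertex numbers its edges by `Fin δ`, which turns regularity into injectivity of `nb v`;
  -- `rev v s` is the number of the same edge at its other end and makes adjacency symmetric.
  module Labelled {C : Set} {n δ : ℕ} (C↔Fin : C ↔ Fin n)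
    (nb : C → Fin δ → C) (rev : C → Fin δ → Fin δ) (back : ∀ v s → nb (nb v s) (rev v s) ≡ v)
    (nb-injective : ∀ v {s s′} → nb v s ≡ nb v s′ → s ≡ s′) (nb-irrefl : ∀ v s → nb v s ≢ v) where

    open Inverse C↔Fin using (to; from; strictlyInverseˡ; strictlyInverseʳ)

    Neighbour : C → C → Set
    Neighbour u v = ∃[ s ] nb u s ≡ v

    neighbour-sym : ∀ {u v} → Neighbour u v → Neighbour v u
    neighbour-sym {u} (s , refl) = rev u s , back u s

    neighbour? : ∀ a b → Dec (Neighbour (from a) (from b))
    neighbour? a b = Finₚ.any? λ s → map′ (λ eq → trans (sym (strictlyInverseʳ _)) (cong from eq))
      (λ eq → trans (cong to eq) (strictlyInverseˡ b)) (to (nb (from a) s) Fin.≟ b)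

    graph : Graph n
    graph = record
      { adj    = λ a b → does (neighbour? a b)
      ; sym    = λ a b → does-⇔ (mk⇔ neighbour-sym neighbour-sym) (neighbour? a b) (neighbour? b a)
      ; irrefl = irrefl
      }
      where
      irrefl : ∀ a → does (neighbour? a a) ≡ false
      irrefl a with neighbour? a a
      ... | yes (s , eq) = ⊥-elim (nb-irrefl (from a) s eq)
      ... | no _         = refl

    adj⇒neighbour : ∀ {a b} → Adj graph a b → Neighbour (from a) (from b)
    adj⇒neighbour {a} {b} eq with yes nbr ← neighbour? a b = nbr

    neighbour⇒adj : ∀ {u v} → Neighbour u v → Adj graph (to u) (to v)
    neighbour⇒adj {u} {v} nbr = dec-true (neighbour? (to u) (to v))
      (subst₂ Neighbour (sym (strictlyInverseʳ u)) (sym (strictlyInverseʳ v)) nbr)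

    regular : ∀ a → degree graph a ≡ δ
    regular a = count-image _ (to ∘ nb (from a))
      (λ eq → nb-injective (from a) (trans (sym (strictlyInverseʳ _)) (trans (cong from eq) (strictlyInverseʳ _))))
      (λ s → subst (λ x → Adj graph x (to (nb (from a) s))) (strictlyInverseˡ a) (neighbour⇒adj (s , refl)))
      (λ b adj → let s , eq = adj⇒neighbour {a} {b} adj in s , trans (cong to eq) (strictlyInverseˡ b))

    data Path : C → C → Set where
      stop : ∀ {u} → Path u u
      step : ∀ {u w} s → Path (nb u s) w → Path u w

    _◇_ : ∀ {u v w} → Path u v → Path v w → Path u w
    stop     ◇ p′ = p′
    step s p ◇ p′ = step s (p ◇ p′)

    edge : ∀ {u v} → Neighbour u v → Path u v
    edge (s , refl) = step s stop

    path-sym : ∀ {u v} → Path u v → Path v u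
    path-sym stop       = stop
    path-sym (step s p) = path-sym p ◇ edge (rev _ s , back _ s)

    path⇒walk : ∀ {u v} → Path u v → ∃[ k ] Walk graph (to u) (to v) k
    path⇒walk stop       = 0 , nil
    path⇒walk (step s p) = let k , walk = path⇒walk p in suc k , cons (neighbour⇒adj (s , refl)) walk

    connected : (∀ u v → Path u v) → Connected graph
    connected path a b = subst₂ (λ x y → ∃[ k ] Walk graph x y k) (strictlyInverseˡ a) (strictlyInverseˡ b)
      (path⇒walk (path (from a) (from b)))

    from-injective : ∀ {a b} → from a ≡ from b → a ≡ b
    from-injective {a} {b} eq = trans (sym (strictlyInverseˡ a)) (trans (cong to eq) (strictlyInverseˡ b))

    turn : ∀ {a b c} → Adj graph a b → Adj graph b c → a ≢ c → Turn nb (from a) (from b) (from c)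
    turn {a} {b} {c} ab bc a≢c with neighbour-sym (adj⇒neighbour {a} {b} ab) | adj⇒neighbour {b} {c} bc
    ... | s , eq | s′ , eq′ = turning s s′ (λ { refl → a≢c (from-injective (trans (sym eq) eq′)) }) eq eq′

  module _ {A : Set} (T : A → A → A → Set) where

    Turning : List A → Set
    Turning (u ∷ l@(v ∷ w ∷ _)) = T u v w × Turning l
    Turning _                   = Data.Unit.⊤ where import Data.Unit

  turning-map : {A B : Set} {T : A → A → A → Set} {T′ : B → B → B → Set} (f : A → B) →
    (∀ {u v w} → T u v w → T′ (f u) (f v) (f w)) → ∀ l → Turning T l → Turning T′ (map f l)
  turning-map f pres []              _        = _
  turning-map f pres (_ ∷ [])        _        = _
  turning-map f pres (_ ∷ _ ∷ [])    _        = _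
  turning-map f pres (u ∷ l@(v ∷ w ∷ _)) (t , ts) = pres t , turning-map f pres l ts

  -- Here `x` and `y` are the first two vertices of the cycle. Carrying their difference from the
  -- remaining vertices through the recursion yields the turns at the last vertex and at `x`, where
  -- the cycle closes.
  chain-turning : {A : Set} {E : A → A → Set} {T : A → A → A → Set} →
    (∀ {u v w} → E u v → E v w → u ≢ w → T u v w) → ∀ {x y} → E x y → ∀ u v l →
    Unique (u ∷ v ∷ l) → All (_≢ x) (u ∷ v ∷ l) → All (_≢ y) (v ∷ l) → Linked E (u ∷ v ∷ l ++ [ x ]) →
    Turning T (u ∷ v ∷ l ++ x ∷ y ∷ [])
  chain-turning mk xy u v [] _ (u≢x ∷ _) (v≢y ∷ []) (uv ∷ vx ∷ [-]) = mk uv vx u≢x , mk vx xy v≢y , _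
  chain-turning mk xy u v (w ∷ l) ((_ ∷ u≢w ∷ _) ∷ uniq) (_ ∷ ≢x) (_ ∷ ≢y) (uv ∷ vw ∷ link) =
    mk uv vw u≢w , chain-turning mk xy v w l uniq ≢x ≢y (vw ∷ link)

  -- Repeating the first two vertices at the end makes a cyclic condition linear: each vertex of the
  -- cycle is the middle of exactly one triple.
  cycle-turning : {A : Set} {E : A → A → Set} {T : A → A → A → Set} →
    (∀ {u v w} → E u v → E v w → u ≢ w → T u v w) → ∀ u v w l →
    Unique (u ∷ v ∷ w ∷ l) → Linked E (u ∷ v ∷ w ∷ l ++ [ u ]) → Turning T (u ∷ v ∷ w ∷ l ++ u ∷ v ∷ [])
  cycle-turning mk u v w l ((u≢v ∷ u≢w ∷ u≢l) ∷ uniq@((v≢w ∷ v≢l) ∷ _)) (uv ∷ vw ∷ link) =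
    mk uv vw u≢w , chain-turning mk uv v w l uniq
      (All.map (_∘ sym) (u≢v ∷ u≢w ∷ u≢l)) (All.map (_∘ sym) (v≢w ∷ v≢l)) (vw ∷ link)

-- Two q-ary trees joined at their roots and at their leaves

module DoubleTrees where

  open import Data.Bool using (_xor_)
  open import Data.Bool.Properties using (not-involutive)
  open import Data.Vec using (Vec; []; _∷_; head)
  open import Data.Maybe using (Maybe; just; nothing; maybe′)
  open import Data.Sum using ([_,_]′)
  open import Function using (_↔_; mk↔ₛ′)
  open import Relation.Binary.PropositionalEquality

  -- A vertex of the complete q-ary tree of depth `d`, given as the path that leads to it from the
  -- root.
  data Tree (q : ℕ) : ℕ → Set where
    ε   : ∀ {d} → Tree q d
    _▹_ : ∀ {d} → Fin q → Tree q d → Tree q (suc d)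

  infixr 5 _▹_

  module _ {q : ℕ} where

    private variable d : ℕ

    depth : Tree q d → ℕ
    depth ε       = 0
    depth (_ ▹ t) = suc (depth t)

    leaf : Vec (Fin q) d → Tree q d
    leaf []      = ε
    leaf (a ∷ w) = a ▹ leaf w

    -- The right summand is returned, for every s, when the given vertex is a leaf.
    child : Tree q d → Fin q → Tree q d ⊎ Vec (Fin q) d
    child {zero}  ε       s = inj₂ []
    child {suc d} ε       s = inj₁ (s ▹ ε)
    child         (a ▹ t) s = Sum.map (a ▹_) (a ∷_) (child t s)

    parent : Tree q d → Maybe (Tree q d)
    parent ε       = nothing
    parent (a ▹ t) = just (maybe′ (a ▹_) ε (parent t))

    lastOr : Fin q → Tree q d → Fin q
    lastOr a ε       = a
    lastOr _ (b ▹ t) = lastOr b t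

    -- The label under which the parent sees this vertex. At a root it is `zero`, the label of the
    -- edge between the roots at both of its ends.
    label : Tree q d → Fin (suc q)
    label ε       = zero
    label (a ▹ t) = suc (lastOr a t)

    child-leaf : (w : Vec (Fin q) d) → ∀ s → child (leaf w) s ≡ inj₂ w
    child-leaf []      s = refl
    child-leaf (a ∷ w) s rewrite child-leaf w s = refl

    leaf-injective : {w w′ : Vec (Fin q) d} → leaf w ≡ leaf w′ → w ≡ w′
    leaf-injective {w = []}    {[]}     refl = refl
    leaf-injective {w = a ∷ w} {b ∷ w′} eq with leaf w in eqw | leaf w′ in eqw′
    leaf-injective {w = a ∷ w} {a ∷ w′} refl | t | t = cong (a ∷_) (leaf-injective (trans eqw (sym eqw′)))

    depth-leaf : (w : Vec (Fin q) d) → depth (leaf w) ≡ d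
    depth-leaf []      = refl
    depth-leaf (a ∷ w) = cong suc (depth-leaf w)

    child-parent : ∀ a (t : Tree q d) → child (maybe′ (a ▹_) ε (parent t)) (lastOr a t) ≡ inj₁ (a ▹ t)
    child-parent a ε       = refl
    child-parent a (b ▹ t) rewrite child-parent b t = refl

    depth-parent : ∀ a (t : Tree q d) → depth (maybe′ (a ▹_) ε (parent t)) ≡ depth t
    depth-parent a ε       = refl
    depth-parent a (b ▹ t) = cong suc (depth-parent b t)

    data Child (t : Tree q d) (s : Fin q) : Set where
      inner : ∀ {t′} → child t s ≡ inj₁ t′ → parent t′ ≡ just t → label t′ ≡ suc s → depth t′ ≡ suc (depth t) → Child t s
      outer : ∀ w → t ≡ leaf w → Child t s

    child-view : (t : Tree q d) → ∀ s → Child t s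
    child-view {zero}  ε s = outer [] refl
    child-view {suc d} ε s = inner refl refl refl refl
    child-view (a ▹ t) s with child-view t s
    ... | outer w refl = outer (a ∷ w) refl
    ... | inner {b ▹ t′} eq p l h = inner (cong (Sum.map (a ▹_) (a ∷_)) eq)
            (cong (λ m → just (maybe′ (a ▹_) ε m)) p) l (cong suc h)

  size : ℕ → ℕ → ℕ
  size q zero    = 1
  size q (suc d) = suc (q ℕ.* size q d)

  tree↔ : ∀ q d → Tree q d ↔ Fin (size q d)
  tree↔ q d = mk↔ₛ′ (to d) (from d) (to-from d) (from-to d)
    where
    to : ∀ d → Tree q d → Fin (size q d)
    to zero    ε       = zero
    to (suc d) ε       = zero
    to (suc d) (a ▹ t) = suc (Fin.combine a (to d t))
    from : ∀ d → Fin (size q d) → Tree q d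
    from zero    _       = ε
    from (suc d) zero    = ε
    from (suc d) (suc i) = proj₁ (Fin.remQuot {q} (size q d) i) ▹ from d (proj₂ (Fin.remQuot {q} (size q d) i))
    to-from : ∀ d i → to d (from d i) ≡ i
    to-from zero    zero    = refl
    to-from (suc d) zero    = refl
    to-from (suc d) (suc i) = cong suc (trans
      (cong (Fin.combine (proj₁ (Fin.remQuot {q} (size q d) i))) (to-from d _)) (Finₚ.combine-remQuot {q} (size q d) i))
    from-to : ∀ d t → from d (to d t) ≡ t
    from-to zero    ε       = refl
    from-to (suc d) ε       = refl
    from-to (suc d) (a ▹ t) = trans
      (cong (λ (b , i) → b ▹ from d i) (Finₚ.remQuot-combine {q} {size q d} a (to d t)))
      (cong (a ▹_) (from-to d t))

  -- The voltage of an edge, that is, the change of sheet along it in the cyclic cover.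
  data Shift : Set where
    up down stay : Shift

  opposite : Shift → Shift
  opposite up   = down
  opposite down = up
  opposite stay = stay

  parity : ℕ → Bool
  parity zero    = false
  parity (suc n) = not (parity n)

  -- A leaf has one neighbour below each child of the opposite root. That child is the head of the
  -- neighbour, so `head w` is also the label that leads back to `w`.
  record Cross (q d : ℕ) : Set where
    field
      cross      : Bool → Vec (Fin q) (suc d) → Fin q → Vec (Fin q) (suc d)
      cross-head : ∀ b w s → head (cross b w s) ≡ s
      cross-back : ∀ b w s → cross (not b) (cross b w s) (head w) ≡ w

  module DoubleTree {q d : ℕ} (X : Cross q d) where
    open Cross X

    V : Set
    V = Bool × Tree q (suc d)

    -- Label zero leads to the parent, or from a root to the other root; label suc s leads to child s,
    -- or from a leaf to a leaf of the other tree.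
    nb : V → Fin (suc q) → V
    nb (b , t) zero    = maybe′ (b ,_) (not b , ε) (parent t)
    nb (b , t) (suc s) = [ b ,_ , (λ w → not b , leaf (cross b w s)) ]′ (child t s)

    rev : V → Fin (suc q) → Fin (suc q)
    rev (b , t) zero    = label t
    rev (b , t) (suc s) = [ (λ _ → zero) , (λ w → suc (head w)) ]′ (child t s)

    volt : V → Fin (suc q) → Shift
    volt (b , _)     (suc s) = stay
    volt (b , ε)     zero    = if b then down else up
    volt (b , _ ▹ _) zero    = stay

    colour : V → Bool
    colour (b , t) = b xor parity (depth t)

    back : ∀ v s → nb (nb v s) (rev v s) ≡ v
    back (b , ε)     zero = cong (_, ε) (not-involutive b)
    back (b , a ▹ t) zero rewrite child-parent a t = refl
    back (b , t) (suc s) with child-view t s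
    ... | inner eq p l h rewrite eq | p = refl
    ... | outer w refl rewrite child-leaf w s | child-leaf (cross b w s) (head w) =
      cong₂ _,_ (not-involutive b) (cong leaf (cross-back b w s))

    b≢not-b : ∀ b → b ≢ not b
    b≢not-b true  ()
    b≢not-b false ()

    volt-rev : ∀ v s → volt (nb v s) (rev v s) ≡ opposite (volt v s)
    volt-rev (true  , ε)     zero = refl
    volt-rev (false , ε)     zero = refl
    volt-rev (b     , _ ▹ _) zero = refl
    volt-rev (b , t) (suc s) with child-view t s
    ... | inner {ε}     eq p l ()
    ... | inner {_ ▹ _} eq p l h rewrite eq = refl
    ... | outer w refl rewrite child-leaf w s = refl

    -- The two neighbours lie in different trees, or their depths differ by two.
    up≢down : ∀ b t s → nb (b , t) zero ≢ nb (b , t) (suc s)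
    up≢down b ε       s eq = b≢not-b b (sym (cong proj₁ eq))
    up≢down b (a ▹ t) s eq with child-view (a ▹ t) s
    ... | inner ceq p l h = ℕₚ.m≢1+n+m (depth t) {1} (trans (sym (depth-parent a t))
            (trans (cong (depth ∘ proj₂) (trans eq (cong [ b ,_ , _ ]′ ceq))) h))
    ... | outer (_ ∷ w) refl = b≢not-b b (cong proj₁ (trans eq (cong [ b ,_ , _ ]′ (child-leaf (a ∷ w) s))))

    -- A label can be read off the neighbour: it is the last letter of a child and the first letter
    -- of a leaf reached across.
    nb-injective : ∀ v {s s′} → nb v s ≡ nb v s′ → s ≡ s′
    nb-injective v       {zero} {zero}  _  = refl
    nb-injective (b , t) {zero} {suc s} eq = ⊥-elim (up≢down b t s eq)
    nb-injective v {suc s} {zero} eq = sym (nb-injective v (sym eq))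
    nb-injective (b , t) {suc s} {suc s′} eq with child-view t s
    ... | outer w refl rewrite child-leaf w s | child-leaf w s′ =
      cong suc (trans (sym (cross-head b w s)) (trans (cong head (leaf-injective (cong proj₂ eq))) (cross-head b w s′)))
    ... | inner ceq p l h with child-view t s′
    ...   | inner ceq′ p′ l′ h′ rewrite ceq | ceq′ = trans (sym l) (trans (cong (label ∘ proj₂) eq) l′)
    ...   | outer w refl = contradiction (trans (sym (child-leaf w s)) ceq) λ ()

    not-xor : ∀ a b → not a xor b ≡ not (a xor b)
    not-xor true  b = sym (not-involutive b)
    not-xor false b = refl

    xor-not : ∀ a b → a xor not b ≡ not (a xor b)
    xor-not true  b = refl
    xor-not false b = refl

    colour-nb : ∀ v s → colour (nb v s) ≡ not (colour v)
    colour-nb (b , ε) zero = not-xor b false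
    colour-nb (b , a ▹ t) zero = begin
      b xor parity (depth (maybe′ (a ▹_) ε (parent t))) ≡⟨ cong (λ n → b xor parity n) (depth-parent a t) ⟩
      b xor parity (depth t)  ≡⟨ not-involutive _ ⟨
      not (not (b xor parity (depth t)))  ≡⟨ cong not (xor-not b _) ⟨
      not (b xor not (parity (depth t)))  ∎
      where open ≡-Reasoning
    colour-nb (b , t) (suc s) with child-view t s
    ... | inner eq p l h rewrite eq | h = xor-not b _
    ... | outer w refl rewrite child-leaf w s | depth-leaf (cross b w s) | depth-leaf w = not-xor b _

-- Cyclic covers: connectedness, height modulo M, eccentricity, girth

module CyclicCovers where

  import Data.Nat.Divisibility as ℕ∣
  open import Data.Integer using (ℤ; +_; ∣_∣; _+_; _*_; _-_; -_)
  import Data.Integer.Properties as ℤₚ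
  open import Data.Integer.Divisibility.Signed using (_∣_; divides; ∣⇒∣ᵤ; ∣m∣n⇒∣m+n; ∣m⇒∣-m)
  open import Data.Integer.Tactic.RingSolver using (solve-∀)
  open import Data.Fin.Induction using (<-weakInduction)
  open import Data.Fin.Relation.Unary.Top using (view; view-fromℕ; view-inject₁; ‵fromℕ; ‵inject₁)
  open import Data.List using ([]; _∷_; _++_; length; map)
  import Data.List.Properties as Listₚ
  open import Data.Vec using (Vec; []; _∷_; replicate)
  open import Data.Maybe using (maybe′)
  open import Data.Product.Function.NonDependent.Propositional using (_×-↔_)
  open import Function using (_$_; _↔_; Inverse)
  open import Function.Properties.Inverse using (↔-refl; ↔-sym; ↔-trans)
  open import Relation.Binary.PropositionalEquality hiding ([_])
  open Graphs
  open DoubleTrees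

  next : ∀ {κ} → Fin (suc κ) → Fin (suc κ)
  next i with view i
  ... | ‵fromℕ     = zero
  ... | ‵inject₁ j = suc j

  prev : ∀ {κ} → Fin (suc κ) → Fin (suc κ)
  prev {κ} zero    = fromℕ κ
  prev     (suc j) = inject₁ j

  next-prev : ∀ {κ} (i : Fin (suc κ)) → next (prev i) ≡ i
  next-prev {κ} zero rewrite view-fromℕ κ = refl
  next-prev (suc j) rewrite view-inject₁ j = refl

  prev-next : ∀ {κ} (i : Fin (suc κ)) → prev (next i) ≡ i
  prev-next i with view i
  ... | ‵fromℕ     = refl
  ... | ‵inject₁ j = refl

  shift : ∀ {κ} → Shift → Fin (suc κ) → Fin (suc κ)
  shift up   = next
  shift down = prev
  shift stay = λ i → i

  shift-opposite : ∀ {κ} σ (i : Fin (suc κ)) → shift (opposite σ) (shift σ i) ≡ i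
  shift-opposite up   i = prev-next i
  shift-opposite down i = next-prev i
  shift-opposite stay i = refl

  -- Taken modulo `M`, the integers `a` and `b` are at distance at most `k` on the cycle of length
  -- `M`; the signed `gap` makes these distances add up along a walk.
  record Close (M k : ℕ) (a b : ℤ) : Set where
    constructor close
    field
      gap   : ℤ
      small : ∣ gap ∣ ≤ k
      gap≡  : + M ∣ b - a - gap

  close-refl : ∀ {M a} → Close M 0 a a
  close-refl {M} {a} = close (+ 0) z≤n (divides (+ 0) (lemma a))
    where
    lemma : ∀ a → a - a - + 0 ≡ + 0
    lemma = solve-∀

  close-sym : ∀ {M k a b} → Close M k a b → Close M k b a
  close-sym {M} {k} {a} {b} (close e e≤k M∣) =
    close (- e) (subst (_≤ k) (sym (ℤₚ.∣-i∣≡∣i∣ e)) e≤k) (subst (+ M ∣_) (lemma a b e) (∣m⇒∣-m M∣))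
    where
    lemma : ∀ a b e → - (b - a - e) ≡ a - b - - e
    lemma = solve-∀

  close-trans : ∀ {M k l a b c} → Close M k a b → Close M l b c → Close M (k ℕ.+ l) a c
  close-trans {M} {k} {l} {a} {b} {c} (close e e≤k M∣) (close f f≤l M∣′) =
    close (e + f) (ℕₚ.≤-trans (ℤₚ.∣i+j∣≤∣i∣+∣j∣ e f) (ℕₚ.+-mono-≤ e≤k f≤l))
      (subst (+ M ∣_) (lemma a b c e f) (∣m∣n⇒∣m+n M∣ M∣′))
    where
    lemma : ∀ a b c e f → b - a - e + (c - b - f) ≡ c - a - (e + f)
    lemma = solve-∀

  -- If the gap were smaller than `h` in absolute value, then `h` minus the gap would be a nonzero
  -- multiple of `2 h` of absolute value below `2 h`.
  close-antipodal : ∀ {h k a b} → Close (h ℕ.+ h) k a b → b - a ≡ + h → h ≤ k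
  close-antipodal {h} {k} {a} {b} (close e e≤k M∣) eq with ℕₚ.≤-<-connex h ∣ e ∣
  ... | inj₁ h≤e = ℕₚ.≤-trans h≤e e≤k
  ... | inj₂ e<h = ⊥-elim (ℕₚ.<⇒≱ small (ℕ∣.∣⇒≤ {{ℕ.≢-nonZero nonzero}} (∣⇒∣ᵤ (subst (λ x → + (h ℕ.+ h) ∣ x - e) eq M∣))))
    where
    small : ∣ + h - e ∣ < h ℕ.+ h
    small = ℕₚ.≤-<-trans (ℤₚ.∣i-j∣≤∣i∣+∣j∣ (+ h) e) (ℕₚ.+-monoʳ-< h e<h)
    nonzero : ∣ + h - e ∣ ≢ 0
    nonzero eq0 = ℕₚ.<⇒≢ e<h (cong ∣_∣ (sym (ℤₚ.i-j≡0⇒i≡j (+ h) e (ℤₚ.∣i∣≡0⇒i≡0 eq0))))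

  module CyclicCover {q d : ℕ} (X : Cross q d) (κ : ℕ) where
    open DoubleTree X public

    K : ℕ
    K = suc κ

    C : Set
    C = V × Fin K

    nbᶜ : C → Fin (suc q) → C
    nbᶜ (v , i) s = nb v s , shift (volt v s) i

    revᶜ : C → Fin (suc q) → Fin (suc q)
    revᶜ (v , _) = rev v

    backᶜ : ∀ x s → nbᶜ (nbᶜ x s) (revᶜ x s) ≡ x
    backᶜ (v , i) s = cong₂ _,_ (back v s)
      (trans (cong (λ σ → shift σ (shift (volt v s) i)) (volt-rev v s)) (shift-opposite (volt v s) i))

    nb-irrefl : ∀ v s → nb v s ≢ v
    nb-irrefl v s eq = b≢not-b (colour v) (trans (cong colour (sym eq)) (colour-nb v s))

    order : ℕ
    order = 2 ℕ.* size q (suc d) ℕ.* K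

    abstract
      C↔Fin : C ↔ Fin order
      C↔Fin = ↔-trans (↔-trans (↔-sym Finₚ.2↔Bool ×-↔ tree↔ q (suc d)) (↔-sym Finₚ.*↔×) ×-↔ ↔-refl) (↔-sym Finₚ.*↔×)

    open Labelled C↔Fin nbᶜ revᶜ backᶜ (λ (v , _) eq → nb-injective v (cong proj₁ eq))
      (λ (v , _) s eq → nb-irrefl v s (cong proj₁ eq)) public

    climb : ∀ n b t → depth t ≡ n → ∀ i → Path ((b , t) , i) ((b , ε) , i)
    climb zero    b ε       _  i = stop
    climb (suc n) b (a ▹ t) eq i = step zero (climb n b _ (trans (depth-parent a t) (ℕₚ.suc-injective eq)) i)

    -- The edge between the roots shifts the sheet, so within a sheet the roots are joined through a
    -- pair of adjacent leaves.
    descend : Fin q → ∀ i → Path ((true , ε) , i) ((false , ε) , i)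
    descend s i = path-sym (climb _ true (leaf w) refl i) ◇
      (edge (suc s , cong (λ c → Sum.[ true ,_ , (λ w′ → false , leaf (Cross.cross X true w′ s)) ]′ c , i) (child-leaf w s))
       ◇ climb _ false (leaf (Cross.cross X true w s)) refl i)
      where
      w : Vec (Fin q) (suc d)
      w = replicate (suc d) s

    around : Fin q → ∀ i → Path ((true , ε) , i) ((true , ε) , zero)
    around s = <-weakInduction (λ i → Path ((true , ε) , i) ((true , ε) , zero)) stop
      -- From the first root the root edge leads to the second root one sheet below, and the leaves
      -- of that sheet lead back to the first root.
      (λ i p → step zero (path-sym (descend s (inject₁ i)) ◇ p))

    toBase : Fin q → ∀ x → Path x ((true , ε) , zero)
    toBase s ((true  , t) , i) = climb _ true t refl i ◇ around s i
    toBase s ((false , t) , i) = climb _ false t refl i ◇ (path-sym (descend s i) ◇ around s i)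

    graph-connected : Fin q → Connected graph
    graph-connected s = connected λ u v → toBase s u ◇ path-sym (toBase s v)

    -- The length of an ordinary m-gon in the incidence graph of a generalised m-gon, m = d + 2.
    perimeter : ℕ
    perimeter = 2 ℕ.* suc (suc d)

    -- The position along an m-gon through both roots: distance from the first root, with the second
    -- root at perimeter - 1.  Together with the sheet it maps the cover onto a cycle of length M.
    level : V → ℤ
    level (true  , t) = + depth t
    level (false , t) = + perimeter - + 1 - + depth t

    height : C → ℤ
    height (v , i) = + perimeter * + toℕ i + level v

    M : ℕ
    M = perimeter ℕ.* K

    -- The first root of sheet `i` has height `perimeter * i`, the second root of the sheet before
    -- it `perimeter * (i - 1) + perimeter - 1`, which is one less. On sheet 0 the value reached is
    -- `M - 1`, congruent to -1.
    height-root : ∀ i → Close M 1 (height ((true , ε) , i)) (height ((false , ε) , prev i))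
    height-root zero = close (- (+ 1)) ℕₚ.≤-refl $ divides (+ 1)
      (trans (lemma (+ perimeter) (+ toℕ (fromℕ κ))) (trans (cong (λ n → + perimeter * (+ 1 + + n)) (Finₚ.toℕ-fromℕ κ))
        (trans (sym (ℤₚ.pos-* perimeter K)) (sym (ℤₚ.*-identityˡ (+ M))))))
      where
      lemma : ∀ p n → p * n + (p - + 1 - + 0) - (p * + 0 + + 0) - - (+ 1) ≡ p * (+ 1 + n)
      lemma = solve-∀
    height-root (suc i) = close (- (+ 1)) ℕₚ.≤-refl $ divides (+ 0)
      (trans (cong (λ n → + perimeter * + n + (+ perimeter - + 1 - + 0) - (+ perimeter * (+ 1 + + toℕ i) + + 0) - - (+ 1))
        (Finₚ.toℕ-inject₁ i)) (lemma (+ perimeter) (+ toℕ i)))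
      where
      lemma : ∀ p n → p * n + (p - + 1 - + 0) - (p * (+ 1 + n) + + 0) - - (+ 1) ≡ + 0
      lemma = solve-∀

    height-up : ∀ x → Close M 1 (height x) (height (nbᶜ x zero))
    height-up ((true  , ε) , i) = height-root i
    height-up ((false , ε) , i) = close-sym
      (subst (λ j → Close M 1 (height ((true , ε) , next i)) (height ((false , ε) , j))) (prev-next i) (height-root (next i)))
    height-up ((true , a ▹ t) , i) = close (- (+ 1)) ℕₚ.≤-refl $ divides (+ 0)
      (trans (cong (λ n → + perimeter * + toℕ i + + n - (+ perimeter * + toℕ i + (+ 1 + + depth t)) - - (+ 1))
        (depth-parent a t))
        (lemma (+ perimeter * + toℕ i) (+ depth t)))
      where
      lemma : ∀ p n → p + n - (p + (+ 1 + n)) - - (+ 1) ≡ + 0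
      lemma = solve-∀
    height-up ((false , a ▹ t) , i) = close (+ 1) ℕₚ.≤-refl $ divides (+ 0)
      (trans (cong (λ n → + perimeter * + toℕ i + (+ perimeter - + 1 - + n) - (+ perimeter * + toℕ i + (+ perimeter - + 1 - (+ 1 + + depth t))) - + 1)
        (depth-parent a t))
        (lemma (+ perimeter * + toℕ i) (+ perimeter) (+ depth t)))
      where
      lemma : ∀ p r n → p + (r - + 1 - n) - (p + (r - + 1 - (+ 1 + n))) - + 1 ≡ + 0
      lemma = solve-∀

    -- The levels of the leaves are `d + 1` in the first tree and `2 (d + 2) - 1 - (d + 1) = d + 2`
    -- in the second.
    height-leaf : ∀ b w w′ i → Close M 1 (height ((b , leaf w) , i)) (height ((not b , leaf w′) , i))
    height-leaf true w w′ i = close (+ 1) ℕₚ.≤-refl $ divides (+ 0) (trans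
        (cong₂ (λ n n′ → + perimeter * + toℕ i + (+ perimeter - + 1 - + n) - (+ perimeter * + toℕ i + + n′) - + 1) (depth-leaf w′) (depth-leaf w))
        (trans (cong (λ r → + perimeter * + toℕ i + (r - + 1 - + suc d) - (+ perimeter * + toℕ i + + suc d) - + 1) (ℤₚ.pos-* 2 (suc (suc d))))
          (lemma (+ perimeter * + toℕ i) (+ suc d))))
      where
      lemma : ∀ p n → p + (+ 2 * (+ 1 + n) - + 1 - n) - (p + n) - + 1 ≡ + 0
      lemma = solve-∀
    height-leaf false w w′ i = close-sym (height-leaf true w′ w i)

    height-step : ∀ x s → Close M 1 (height x) (height (nbᶜ x s))
    height-step x zero = height-up x
    height-step ((b , t) , i) (suc s) with child-view t s
    ... | outer w refl rewrite child-leaf w s = height-leaf b w (Cross.cross X b w s) i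
    ... | inner {ε} eq p l ()
    -- A step to a child is a step to the parent read backwards.
    ... | inner {a ▹ t′} eq p l h rewrite eq = close-sym
      (subst (λ m → Close M 1 (height ((b , a ▹ t′) , i)) (height (maybe′ (b ,_) (not b , ε) m , i))) p
        (height-up ((b , a ▹ t′) , i)))

    open Inverse C↔Fin using (from)

    height-walk : ∀ {a b k} → Walk graph a b k → Close M k (height (from a)) (height (from b))
    height-walk nil = close-refl {M}
    height-walk {a} {b} (cons {w = w} adj walk) with adj⇒neighbour {a} {w} adj
    ... | s , eq = close-trans {M} (subst (λ x → Close M 1 (height (from a)) (height x)) eq (height-step (from a) s)) (height-walk walk)

    -- Forgetting the sheet keeps the labels at each vertex, so turns project to turns even where
    -- distinct vertices of the cycle have the same image.
    cover-girth : ∀ {g} → (∀ u v w l → Turning (Turn nb) (u ∷ v ∷ w ∷ l ++ u ∷ v ∷ []) → g ≤ 3 ℕ.+ length l) →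
      GirthAtLeast graph g
    cover-girth girth (u ∷ []) (_ , s≤s () , _)
    cover-girth girth (u ∷ v ∷ []) (_ , s≤s (s≤s ()) , _)
    cover-girth {g} girth (u ∷ v ∷ w ∷ l) (uniq , _ , link) =
      subst (λ n → g ≤ 3 ℕ.+ n) (Listₚ.length-map π l)
        (girth (π u) (π v) (π w) (map π l) (subst (λ m → Turning (Turn nb) (π u ∷ π v ∷ π w ∷ m)) (Listₚ.map-++ π l _)
          (turning-map π (λ (turning s s′ s≢s′ eq eq′) → turning s s′ s≢s′ (cong proj₁ eq) (cong proj₁ eq′)) (u ∷ v ∷ w ∷ l ++ u ∷ v ∷ [])
            (cycle-turning (λ {a} {b} {c} → turn {a} {b} {c}) u v w l uniq link))))
      where
      π : Fin order → V
      π = proj₁ ∘ from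

  module Antipodal {q d : ℕ} (X : Cross q d) (κ′ : ℕ) where
    half : ℕ
    half = suc κ′

    -- With this argument `K` reduces to `half + half`.
    open CyclicCover X (κ′ ℕ.+ half) public
    open Inverse C↔Fin using (to; from; strictlyInverseʳ)

    M≡ : M ≡ perimeter ℕ.* half ℕ.+ perimeter ℕ.* half
    M≡ = ℕₚ.*-distribˡ-+ perimeter half half

    antipode : (i : Fin K) → ∃[ j ] (toℕ j ≡ toℕ i ℕ.+ half ⊎ toℕ i ≡ toℕ j ℕ.+ half)
    antipode i with ℕₚ.≤-<-connex half (toℕ i)
    ... | inj₁ half≤i = Fin.fromℕ< (ℕₚ.≤-<-trans (ℕₚ.m∸n≤m (toℕ i) half) (Finₚ.toℕ<n i)) ,
      inj₂ (sym (trans (cong (ℕ._+ half) (Finₚ.toℕ-fromℕ< _)) (ℕₚ.m∸n+n≡m half≤i)))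
    ... | inj₂ i<half = Fin.fromℕ< (ℕₚ.+-monoˡ-< half i<half) , inj₁ (Finₚ.toℕ-fromℕ< _)

    -- The witness is the copy of the same base vertex half of the sheets away: the heights differ
    -- by half of `M`, and each step of a walk changes the height by at most one modulo `M`.
    far : ∀ a → ∃[ b ] (∀ k → Walk graph a b k → perimeter ℕ.* half ≤ k)
    far a with from a in eq
    ... | v , i with antipode i
    ...   | j , opp = to (v , j) , λ k walk → bound opp
              (subst₂ (Close M k) (cong height eq) (cong height (strictlyInverseʳ (v , j))) (height-walk walk))
      where
      lemma : ∀ p x y l → p * (x + y) + l - (p * x + l) ≡ p * y
      lemma = solve-∀
      diff : ∀ {m n} → n ≡ m ℕ.+ half → + perimeter * + n + level v - (+ perimeter * + m + level v) ≡ + (perimeter ℕ.* half)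
      diff {m} refl = trans (lemma (+ perimeter) (+ m) (+ half) (level v)) (sym (ℤₚ.pos-* perimeter half))
      bound : ∀ {k} → toℕ j ≡ toℕ i ℕ.+ half ⊎ toℕ i ≡ toℕ j ℕ.+ half → Close M k (height (v , i)) (height (v , j)) → perimeter ℕ.* half ≤ k
      bound {k} (inj₁ j≡) near = close-antipodal (subst (λ N → Close N k (height (v , i)) (height (v , j))) M≡ near) (diff j≡)
      bound {k} (inj₂ i≡) near = close-antipodal (subst (λ N → Close N k (height (v , j)) (height (v , i))) M≡ (close-sym near)) (diff i≡)

    antipodal-radius : ∀ {g} → Fin q → GirthAtLeast graph g →
      MaxRadiusSatisfies order (suc q) g (λ r → perimeter ℕ.* half ≤ r)
    antipodal-radius s girth = graph , (graph-connected s , (minDegree , girth)) , r , isRadius , radius-≥ graph far isRadius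
      where
      minDegree : MinDegree graph (suc q)
      minDegree = (λ a → ℕₚ.≤-reflexive (sym (regular a))) , zero , regular zero
      radius : ∃ (IsRadius graph)
      radius = radius-exists graph (graph-connected s)
      r : ℕ
      r = proj₁ radius
      isRadius : IsRadius graph r
      isRadius = proj₂ radius

-- Points as vectors and bilinear products along turns

module Representations where

  open import Algebra.Structures using (IsCommutativeRing)
  open import Data.Integer using (+_)
  open import Data.Vec using (Vec; []; _∷_; head; map; zipWith; replicate; allFin)
  open import Data.Vec.N-ary using (N-ary; _$ⁿ_)
  open import Relation.Binary.PropositionalEquality
  open DoubleTrees
  open Graphs

  -- Equivalently, a field structure on Fin q.
  record FiniteDomain (q : ℕ) : Set where
    infixl 6 _+_
    infixl 7 _*_
    infix  8 -_
    field
      _+_ _*_           : Fin q → Fin q → Fin q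
      -_                : Fin q → Fin q
      0# 1#             : Fin q
      isCommutativeRing : IsCommutativeRing _≡_ _+_ _*_ -_ 0# 1#
      1≢0               : 1# ≢ 0#
      integral          : ∀ x y → x * y ≡ 0# → x ≡ 0# ⊎ y ≡ 0#

    commutativeRing : CommutativeRing 0ℓ 0ℓ
    commutativeRing = record { isCommutativeRing = isCommutativeRing }

  -- Formulas over an arbitrary carrier, to be read both in a ring and as syntax for the ring solver.
  module Arithmetic {A : Set} (plus times : A → A → A) (minus : A → A) where
    infixl 6 _+_ _-_ _⊞_
    infixl 7 _*_
    infix  8 -_
    infixr 7 _·_

    _+_ _-_ _*_ : A → A → A
    x + y = plus x y
    x - y = plus x (minus y)
    x * y = times x y

    -_ : A → A
    - x = minus x

    _⊞_ : ∀ {n} → Vec A n → Vec A n → Vec A n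
    _⊞_ = zipWith plus

    _·_ : ∀ {n} → A → Vec A n → Vec A n
    s · x = map (times s) x

  module LinearAlgebra {q : ℕ} (D : FiniteDomain q) where
    open FiniteDomain D public
    open CommutativeRing commutativeRing public
      using (+-identityʳ; +-identityˡ; zeroʳ; zeroˡ; *-identityˡ; *-comm; *-assoc; -‿inverseʳ; ring; _-_)
    open IntegerSolver commutativeRing public
      using (Polynomial; var; con; _:+_; _:*_; :-_; ⟦_⟧; ⟦_⟧↓; prove)
    open import Algebra.Properties.Ring ring public using (-0#≈0#; -‿involutive)

    :0 :1 : ∀ {n} → Polynomial n
    :0 = con (+ 0)
    :1 = con (+ 1)

    F : Set
    F = Fin q

    infixl 6 _⊞_
    infixr 7 _·_

    _⊞_ : ∀ {n} → Vec F n → Vec F n → Vec F n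
    _⊞_ = zipWith _+_

    _·_ : ∀ {n} → F → Vec F n → Vec F n
    s · x = map (s *_) x

    𝟎 : ∀ {n} → Vec F n
    𝟎 {n} = replicate n 0#

    -- One polynomial identity per coordinate. The premise compares normal forms, so that callers
    -- can discharge it by `refl`.
    solveVec : ∀ {n k} (f : N-ary n (Polynomial n) (Vec (Polynomial n) k × Vec (Polynomial n) k)) (ρ : Vec F n) →
      let xs , ys = f $ⁿ map var (allFin n) in
      map (λ e → ⟦ e ⟧↓ ρ) xs ≡ map (λ e → ⟦ e ⟧↓ ρ) ys → map (λ e → ⟦ e ⟧ ρ) xs ≡ map (λ e → ⟦ e ⟧ ρ) ys
    solveVec {n} f ρ = go (proj₁ (f $ⁿ map var (allFin n))) (proj₂ (f $ⁿ map var (allFin n)))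
      where
      go : ∀ {k} (xs ys : Vec (Polynomial n) k) →
        map (λ e → ⟦ e ⟧↓ ρ) xs ≡ map (λ e → ⟦ e ⟧↓ ρ) ys → map (λ e → ⟦ e ⟧ ρ) xs ≡ map (λ e → ⟦ e ⟧ ρ) ys
      go []       []       _  = refl
      go (x ∷ xs) (y ∷ ys) eq = cong₂ _∷_ (prove ρ x y (cong head eq)) (go xs ys (cong Data.Vec.tail eq))

    x-y≡0⇒x≡y : ∀ {x y} → x - y ≡ 0# → x ≡ y
    x-y≡0⇒x≡y {x} {y} eq = begin
      x  ≡⟨ cong head (solveVec (λ x y → (x ∷ []) , ((x :+ (:- y)) :+ y ∷ [])) (x ∷ y ∷ []) refl) ⟩
      x - y + y  ≡⟨ cong (_+ y) eq ⟩
      0# + y  ≡⟨ +-identityˡ y ⟩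
      y  ∎
      where open ≡-Reasoning

    -x≢0 : ∀ {x} → x ≢ 0# → - x ≢ 0#
    -x≢0 {x} x≢0 eq = x≢0 (trans (sym (-‿involutive x)) (trans (cong -_ eq) -0#≈0#))

    x*y≢0 : ∀ {x y} → x ≢ 0# → y ≢ 0# → x * y ≢ 0#
    x*y≢0 {x} {y} x≢0 y≢0 eq with integral x y eq
    ... | inj₁ x≡0 = x≢0 x≡0
    ... | inj₂ y≡0 = y≢0 y≡0

    ⊞-identityʳ : ∀ {n} (x : Vec F n) → x ⊞ 𝟎 ≡ x
    ⊞-identityʳ []      = refl
    ⊞-identityʳ (a ∷ x) = cong₂ _∷_ (+-identityʳ a) (⊞-identityʳ x)

    ⊞-identityˡ : ∀ {n} (x : Vec F n) → 𝟎 ⊞ x ≡ x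
    ⊞-identityˡ []      = refl
    ⊞-identityˡ (a ∷ x) = cong₂ _∷_ (+-identityˡ a) (⊞-identityˡ x)

    ·-zeroʳ : ∀ {n} s → s · 𝟎 {n} ≡ 𝟎
    ·-zeroʳ {zero}  s = refl
    ·-zeroʳ {suc n} s = cong₂ _∷_ (zeroʳ s) (·-zeroʳ s)

    ·-zeroˡ : ∀ {n} (x : Vec F n) → 0# · x ≡ 𝟎
    ·-zeroˡ []      = refl
    ·-zeroˡ (a ∷ x) = cong₂ _∷_ (zeroˡ a) (·-zeroˡ x)

    ·-identity : ∀ {n} (x : Vec F n) → 1# · x ≡ x
    ·-identity []      = refl
    ·-identity (a ∷ x) = cong₂ _∷_ (*-identityˡ a) (·-identity x)

    ·-assoc : ∀ {n} s t (x : Vec F n) → s · t · x ≡ (s * t) · x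
    ·-assoc s t []      = refl
    ·-assoc s t (a ∷ x) = cong₂ _∷_ (sym (*-assoc s t a)) (·-assoc s t x)

    translate : ∀ {n} u u′ (v p : Vec F n) → v ⊞ u · p ≡ (u - u′) · p ⊞ 1# · (v ⊞ u′ · p)
    translate u u′ []      []      = refl
    translate u u′ (a ∷ v) (b ∷ p) = cong₂ _∷_
      (cong head (solveVec (λ u u′ a b → (a :+ u :* b ∷ []) , ((u :+ (:- u′)) :* b :+ :1 :* (a :+ u′ :* b) ∷ []))
          (u ∷ u′ ∷ a ∷ b ∷ []) refl))
      (translate u u′ v p)

    record Bilinear {n w : ℕ} (β : Vec F n → Vec F n → Vec F w) : Set where
      field
        linearˡ : ∀ s x t y z → β (s · x ⊞ t · y) z ≡ s · β x z ⊞ t · β y z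
        linearʳ : ∀ s x t y z → β z (s · x ⊞ t · y) ≡ s · β z x ⊞ t · β z y

      vanishˡ : ∀ {s x t y z} → β x z ≡ 𝟎 → β y z ≡ 𝟎 → β (s · x ⊞ t · y) z ≡ 𝟎
      vanishˡ {s} {x} {t} {y} {z} xz yz = trans (linearˡ s x t y z)
        (trans (cong₂ _⊞_ (trans (cong (s ·_) xz) (·-zeroʳ s)) (trans (cong (t ·_) yz) (·-zeroʳ t))) (⊞-identityʳ 𝟎))

      vanishʳ : ∀ {s x t y z} → β z x ≡ 𝟎 → β z y ≡ 𝟎 → β z (s · x ⊞ t · y) ≡ 𝟎
      vanishʳ {s} {x} {t} {y} {z} zx zy = trans (linearʳ s x t y z)
        (trans (cong₂ _⊞_ (trans (cong (s ·_) zx) (·-zeroʳ s)) (trans (cong (t ·_) zy) (·-zeroʳ t))) (⊞-identityʳ 𝟎))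

      -- The terms with `z` drop out. When `z` is the common point of two lines, the product of a
      -- point on one line and a point on the other is thus determined by the lines up to a scalar.
      scale : ∀ {s t x y z r r′} → β z z ≡ 𝟎 → β r z ≡ 𝟎 → β z r′ ≡ 𝟎 →
        β (s · r ⊞ x · z) (t · r′ ⊞ y · z) ≡ (s * t) · β r r′
      scale {s} {t} {x} {y} {z} {r} {r′} zz rz zr = begin
        β (s · r ⊞ x · z) (t · r′ ⊞ y · z)  ≡⟨ linearˡ s r x z (t · r′ ⊞ y · z) ⟩
        s · β r (t · r′ ⊞ y · z) ⊞ x · β z (t · r′ ⊞ y · z)  ≡⟨ cong₂ (λ a b → s · a ⊞ x · b) (linearʳ t r′ y z r) (vanishʳ zr zz) ⟩
        s · (t · β r r′ ⊞ y · β r z) ⊞ x · 𝟎  ≡⟨ cong₂ (λ a b → s · (t · β r r′ ⊞ y · a) ⊞ b) rz (·-zeroʳ x) ⟩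
        s · (t · β r r′ ⊞ y · 𝟎) ⊞ 𝟎  ≡⟨ ⊞-identityʳ _ ⟩
        s · (t · β r r′ ⊞ y · 𝟎)  ≡⟨ cong (λ a → s · (t · β r r′ ⊞ a)) (·-zeroʳ y) ⟩
        s · (t · β r r′ ⊞ 𝟎)  ≡⟨ cong (s ·_) (⊞-identityʳ _) ⟩
        s · t · β r r′  ≡⟨ ·-assoc s t (β r r′) ⟩
        (s * t) · β r r′  ∎
        where open ≡-Reasoning

      homoˡ : ∀ s x z → β (s · x) z ≡ s · β x z
      homoˡ s x z = trans (cong (λ a → β a z) (sym (trans (cong (s · x ⊞_) (·-zeroˡ x)) (⊞-identityʳ _))))
        (trans (linearˡ s x 0# x z) (trans (cong (s · β x z ⊞_) (·-zeroˡ _)) (⊞-identityʳ _)))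

      homoʳ : ∀ s x z → β z (s · x) ≡ s · β z x
      homoʳ s x z = trans (cong (β z) (sym (trans (cong (s · x ⊞_) (·-zeroˡ x)) (⊞-identityʳ _))))
        (trans (linearʳ s x 0# x z) (trans (cong (s · β z x ⊞_) (·-zeroˡ _)) (⊞-identityʳ _)))

      zeroʳ-β : ∀ z → β z 𝟎 ≡ 𝟎
      zeroʳ-β z = trans (cong (β z) (sym (·-zeroˡ 𝟎))) (trans (homoʳ 0# 𝟎 z) (·-zeroˡ _))

  module Representation {q d : ℕ} (D : FiniteDomain q) (X : Cross q d) where
    open LinearAlgebra D
    open DoubleTree X public

    -- The root of the first tree is a line and that of the second one is a point.
    Point Line : V → Set
    Point v = colour v ≡ false
    Line  v = colour v ≡ true

    line : ∀ {p} → Point p → ∀ s → Line (nb p s)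
    line {p} pt s = trans (colour-nb p s) (cong not pt)

    point : ∀ {ℓ} → Line ℓ → ∀ s → Point (nb ℓ s)
    point {ℓ} ln s = trans (colour-nb ℓ s) (cong not ln)

    Turnᵛ : V → V → V → Set
    Turnᵛ = Turn nb

    turn-sym : ∀ {u v w} → Turnᵛ u v w → Turnᵛ w v u
    turn-sym (turning s s′ s≢s′ eq eq′) = turning s′ s (s≢s′ ∘ sym) eq′ eq

    turn-colour : ∀ {u v w} → Turnᵛ u v w → colour u ≡ not (colour v) × colour w ≡ not (colour v)
    turn-colour {v = v} (turning s s′ _ refl refl) = colour-nb v s , colour-nb v s′

    same-colour : ∀ {u v w} → Turnᵛ u v w → colour u ≡ colour w
    same-colour T = let u≡ , w≡ = turn-colour T in trans u≡ (sym w≡)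

    same-point : ∀ {u v w} → Point u → Turnᵛ u v w → Point w
    same-point pt T = trans (sym (same-colour T)) pt

    odd : ∀ {u v w} → colour u ≡ colour v → Turnᵛ u v w → ⊥
    odd {v = v} eq T = b≢not-b (colour v) (trans (sym eq) (proj₁ (turn-colour T)))

    -- One of two consecutive vertices is a point, so a closed walk may be read from a point
    -- onwards.
    alternate : ∀ {u v w} → Turnᵛ u v w → ¬ Point u → ¬ Point v → ⊥
    alternate {v = v} T ¬u ¬v with colour v | proj₁ (turn-colour T)
    ... | true  | eq = ¬u eq
    ... | false | _  = ¬v refl

    -- Some point of the line nb p s other than p.
    across : V → Fin (suc q) → V
    across p s with rev p s
    ... | zero  = nb (nb p s) (suc 0#)
    ... | suc _ = nb (nb p s) zero

    across-on-line : ∀ p s → ∃[ t ] across p s ≡ nb (nb p s) t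
    across-on-line p s with rev p s
    ... | zero  = suc 0# , refl
    ... | suc _ = zero , refl

    across-point : ∀ {p} → Point p → ∀ s → Point (across p s)
    across-point {p} pt s = let t , eq = across-on-line p s in
      subst Point (sym eq) (point {nb p s} (line pt s) t)

    -- By `linear` the points of a line form a projective line: `nb ℓ zero` is the point at infinity
    -- and `nb ℓ (suc t)` the affine point with parameter `t`.
    module Spans {n : ℕ} (vec : V → Vec F n)
      (linear : ∀ ℓ → Line ℓ → ∀ t → vec (nb ℓ (suc t)) ≡ vec (nb ℓ (suc 0#)) ⊞ t · vec (nb ℓ zero)) where

      -- The vectors of `p` and `across p s` span the line; the coefficient of the latter is nonzero
      -- because the point in question is not `p`.
      span : ∀ p → Point p → ∀ s t → t ≢ rev p s →
        ∃[ μ ] ∃[ τ ] (μ ≢ 0# × vec (nb (nb p s) t) ≡ μ · vec (across p s) ⊞ τ · vec p)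
      span p pt s t t≢ with rev p s | back p s
      span p pt s zero    t≢ | zero   | eq = contradiction refl t≢
      span p pt s (suc u) t≢ | zero   | eq = 1# , u , 1≢0 , (begin
        vec (nb ℓ (suc u))  ≡⟨ linear ℓ (line pt s) u ⟩
        vec (nb ℓ (suc 0#)) ⊞ u · vec (nb ℓ zero)  ≡⟨ cong₂ (λ a b → a ⊞ u · b) (sym (·-identity _)) (cong vec eq) ⟩
        1# · vec (nb ℓ (suc 0#)) ⊞ u · vec p  ∎)
        where
        open ≡-Reasoning
        ℓ = nb p s
      span p pt s zero    t≢ | suc u′ | eq = 1# , 0# , 1≢0 ,
        sym (trans (cong₂ _⊞_ (·-identity _) (·-zeroˡ (vec p))) (⊞-identityʳ _))
      -- Here `p` is the affine point with parameter `u′` and `across p s` is the point at infinity,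
      -- whose coefficient is the difference of the parameters.
      span p pt s (suc u) t≢ | suc u′ | eq = u - u′ , 1# , (λ eq₀ → t≢ (cong suc (x-y≡0⇒x≡y eq₀))) , (begin
        vec (nb ℓ (suc u))  ≡⟨ linear ℓ (line pt s) u ⟩
        vec (nb ℓ (suc 0#)) ⊞ u · vec (nb ℓ zero)  ≡⟨ translate u u′ _ _ ⟩
        (u - u′) · vec (nb ℓ zero) ⊞ 1# · (vec (nb ℓ (suc 0#)) ⊞ u′ · vec (nb ℓ zero))
          ≡⟨ cong (λ a → (u - u′) · vec (nb ℓ zero) ⊞ 1# · a) (trans (sym (linear ℓ (line pt s) u′)) (cong vec eq)) ⟩
        (u - u′) · vec (nb ℓ zero) ⊞ 1# · vec p  ∎)
        where
        open ≡-Reasoning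
        ℓ = nb p s

      -- By `span` and `scale` a product of points on two lines through `p′` reduces to that of the
      -- standard points of these lines. Hence only the products of `across p′ s` with
      -- `across p′ s′` have to be computed.
      local : ∀ {w} {β : Vec F n → Vec F n → Vec F w} → Bilinear β →
        ∀ {p ℓ p′ ℓ′ p″} → Point p′ → Turnᵛ p ℓ p′ → Turnᵛ ℓ p′ ℓ′ → Turnᵛ p′ ℓ′ p″ →
        (∀ s → β (vec p′) (vec p′) ≡ 𝟎 × β (vec (across p′ s)) (vec p′) ≡ 𝟎 × β (vec p′) (vec (across p′ s)) ≡ 𝟎) →
        ∃[ s ] ∃[ s′ ] ∃[ μ ] (s ≢ s′ × μ ≢ 0# × β (vec p) (vec p″) ≡ μ · β (vec (across p′ s)) (vec (across p′ s′)))
      local {β = β} bil {p′ = p′} pt (turning t₁ t₂ t₁≢t₂ refl at₂) (turning s s′ s≢s′ refl refl) (turning u₁ u₂ u₁≢u₂ at₁ refl) null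
        -- On the line `nb p′ s` the labels `t₂` and `rev p′ s` both lead to `p′`, so they agree,
        -- and `t₁` differs from them. The same argument serves on the other line.
        with span p′ pt s t₁ (λ eq → t₁≢t₂ (trans eq (nb-injective (nb p′ s) (trans (back p′ s) (sym at₂)))))
           | span p′ pt s′ u₂ (λ eq → u₁≢u₂ (sym (trans eq (nb-injective (nb p′ s′) (trans (back p′ s′) (sym at₁))))))
      ... | μ , τ , μ≢0 , eq | μ′ , τ′ , μ′≢0 , eq′ =
        s , s′ , μ * μ′ , s≢s′ , x*y≢0 μ≢0 μ′≢0 ,
        trans (cong₂ β eq eq′) (Bilinear.scale bil (proj₁ (null s)) (proj₁ (proj₂ (null s))) (proj₂ (proj₂ (null s′))))

      module Collinear {w : ℕ} {β : Vec F n → Vec F n → Vec F w} (bil : Bilinear β)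
        (null : ∀ p → Point p → β (vec p) (vec p) ≡ 𝟎)
        (null₂ : ∀ ℓ → Line ℓ → β (vec (nb ℓ (suc 0#))) (vec (nb ℓ zero)) ≡ 𝟎 × β (vec (nb ℓ zero)) (vec (nb ℓ (suc 0#))) ≡ 𝟎) where
        open Bilinear bil

        normal : ∀ ℓ → Line ℓ → ∀ t → ∃[ μ ] ∃[ τ ] vec (nb ℓ t) ≡ μ · vec (nb ℓ (suc 0#)) ⊞ τ · vec (nb ℓ zero)
        normal ℓ ln zero    = 0# , 1# , sym (trans (cong₂ _⊞_ (·-zeroˡ _) (·-identity _)) (⊞-identityˡ _))
        normal ℓ ln (suc t) = 1# , t , trans (linear ℓ ln t) (cong (_⊞ t · vec (nb ℓ zero)) (sym (·-identity _)))

        -- By bilinearity the four products of the two spanning points of the line suffice.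
        collinear : ∀ ℓ → Line ℓ → ∀ t t′ → β (vec (nb ℓ t)) (vec (nb ℓ t′)) ≡ 𝟎
        collinear ℓ ln t t′ with normal ℓ ln t | normal ℓ ln t′
        ... | μ , τ , eq | μ′ , τ′ , eq′ = trans (cong₂ β eq eq′)
          (vanishˡ (vanishʳ (null _ (point {ℓ} ln (suc 0#))) (proj₁ (null₂ ℓ ln)))
                   (vanishʳ (proj₂ (null₂ ℓ ln)) (null _ (point {ℓ} ln zero))))

        collinear-turn : ∀ {p ℓ p′} → Point p → Turnᵛ p ℓ p′ → β (vec p) (vec p′) ≡ 𝟎 × β (vec p′) (vec p) ≡ 𝟎
        collinear-turn {ℓ = ℓ} pt turn@(turning t t′ _ refl refl) = collinear ℓ ln t t′ , collinear ℓ ln t′ t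
          where
          ln : Line ℓ
          ln with colour ℓ | trans (sym (proj₁ (turn-colour turn))) pt
          ... | true | _ = refl

        local′ : ∀ {p ℓ p′ ℓ′ p″} → Point p′ → Turnᵛ p ℓ p′ → Turnᵛ ℓ p′ ℓ′ → Turnᵛ p′ ℓ′ p″ →
          ∃[ s ] ∃[ s′ ] ∃[ μ ] (s ≢ s′ × μ ≢ 0# × β (vec p) (vec p″) ≡ μ · β (vec (across p′ s)) (vec (across p′ s′)))
        local′ {p′ = p′} pt T₁ T₂ T₃ = local bil pt T₁ T₂ T₃ λ s →
          let t , eq = across-on-line p′ s
              bk = back p′ s
          in null p′ pt ,
             subst₂ (λ a b → β (vec a) (vec b) ≡ 𝟎) (sym eq) bk (collinear (nb p′ s) (line pt s) t (rev p′ s)) ,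
             subst₂ (λ a b → β (vec a) (vec b) ≡ 𝟎) bk (sym eq) (collinear (nb p′ s) (line pt s) (rev p′ s) t)

-- The projective plane and the symplectic quadrangle

module PlaneAndQuadrangle where

  open import Data.List using ([]; _∷_; length; _++_)
  open import Data.Integer using (+_)
  open import Data.Vec using (Vec; []; _∷_; head; map)
  open import Relation.Binary.PropositionalEquality
  open DoubleTrees
  open Graphs
  open Representations

  module QuadrangleGirth {q d n : ℕ} (D : FiniteDomain q) (X : Cross q d) where
    open LinearAlgebra D
    open Representation D X

    module _ (vec : V → Vec F n) (β : Vec F n → Vec F n → Vec F 1) (bilinear : Bilinear β)
      (linear : ∀ ℓ → Line ℓ → ∀ t → vec (nb ℓ (suc t)) ≡ vec (nb ℓ (suc 0#)) ⊞ t · vec (nb ℓ zero))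
      (null : ∀ p → Point p → β (vec p) (vec p) ≡ 𝟎)
      (null₂ : ∀ ℓ → Line ℓ → β (vec (nb ℓ (suc 0#))) (vec (nb ℓ zero)) ≡ 𝟎 × β (vec (nb ℓ zero)) (vec (nb ℓ (suc 0#))) ≡ 𝟎)
      (across-product : ∀ p → Point p → ∀ s s′ → s ≢ s′ → ∃[ μ ] (μ ≢ 0# × β (vec (across p s)) (vec (across p s′)) ≡ μ ∷ []))
      where

      open Spans vec linear
      open Collinear bilinear null null₂

      middle : ∀ {p ℓ p′ ℓ′ p″} → Point p → Turnᵛ p ℓ p′ → Turnᵛ ℓ p′ ℓ′ → Turnᵛ p′ ℓ′ p″ → β (vec p) (vec p″) ≢ 𝟎
      middle {p′ = p′} pt T₁ T₂ T₃ eq₀ =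
        let s , s′ , μ , s≢s′ , μ≢0 , eq = local′ (same-point pt T₁) T₁ T₂ T₃
            μ′ , μ′≢0 , eq′ = across-product p′ (same-point pt T₁) s s′ s≢s′
        in x*y≢0 μ≢0 μ′≢0 (cong head (trans (sym (trans eq (cong (μ ·_) eq′))) eq₀))

      no-digon : ∀ {p₁ ℓ₁ p₂ ℓ₂} → Turnᵛ p₁ ℓ₁ p₂ → Turnᵛ ℓ₁ p₂ ℓ₂ → Turnᵛ p₂ ℓ₂ p₁ → ¬ Point p₁
      no-digon {p₁} T₁ T₂ T₃ pt = middle pt T₁ T₂ T₃ (null p₁ pt)

      no-triangle : ∀ {p₁ ℓ₁ p₂ ℓ₂ p₃ ℓ₃} → Turnᵛ p₁ ℓ₁ p₂ → Turnᵛ ℓ₁ p₂ ℓ₂ → Turnᵛ p₂ ℓ₂ p₃ → Turnᵛ p₃ ℓ₃ p₁ → ¬ Point p₁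
      no-triangle T₁ T₂ T₃ T₅ pt = middle pt T₁ T₂ T₃ (proj₁ (collinear-turn pt (turn-sym T₅)))

      -- Closed walks of odd length contradict the colouring. Those of length 4 and 6 are digons and
      -- triangles, read from the first or the second vertex, whichever is a point.
      quadrangle-girth : ∀ u v w l → Turning Turnᵛ (u ∷ v ∷ w ∷ l ++ u ∷ v ∷ []) → 8 ≤ 3 ℕ.+ length l
      quadrangle-girth u v w [] (T₁ , T₂ , T₃ , _) =
        ⊥-elim (odd (sym (same-colour T₁)) T₃)
      quadrangle-girth u v w (x₁ ∷ []) (T₁ , T₂ , T₃ , T₄ , _) =
        ⊥-elim (alternate T₁ (no-digon T₁ T₂ T₃) (no-digon T₂ T₃ T₄))
      quadrangle-girth u v w (x₁ ∷ x₂ ∷ []) (T₁ , T₂ , T₃ , T₄ , T₅ , _) =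
        ⊥-elim (odd (sym (trans (same-colour T₁) (same-colour T₃))) T₅)
      quadrangle-girth u v w (x₁ ∷ x₂ ∷ x₃ ∷ []) (T₁ , T₂ , T₃ , T₄ , T₅ , T₆ , _) =
        ⊥-elim (alternate T₁ (no-triangle T₁ T₂ T₃ T₅) (no-triangle T₂ T₃ T₄ T₆))
      quadrangle-girth u v w (x₁ ∷ x₂ ∷ x₃ ∷ x₄ ∷ []) (T₁ , T₂ , T₃ , T₄ , T₅ , T₆ , T₇ , _) =
        ⊥-elim (odd (sym (trans (same-colour T₁) (trans (same-colour T₃) (same-colour T₅)))) T₇)
      quadrangle-girth u v w (x₁ ∷ x₂ ∷ x₃ ∷ x₄ ∷ x₅ ∷ l) _ = ℕₚ.m≤m+n 8 (length l)

  -- In a projective plane any two points are collinear, so orthogonality of pairs cannot detect a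
  -- turn; the determinant of three points, with the middle one held fixed, is the bilinear form
  -- instead.
  module PlaneGirth {q d n : ℕ} (D : FiniteDomain q) (X : Cross q d) where
    open LinearAlgebra D
    open Representation D X

    module _ (vec : V → Vec F n) (det : Vec F n → Vec F n → Vec F n → Vec F 1) (bilinear : ∀ y → Bilinear (λ x z → det x y z))
      (linear : ∀ ℓ → Line ℓ → ∀ t → vec (nb ℓ (suc t)) ≡ vec (nb ℓ (suc 0#)) ⊞ t · vec (nb ℓ zero))
      (det-xyx : ∀ x y → det x y x ≡ 𝟎) (det-xyy : ∀ x y → det x y y ≡ 𝟎) (det-xxy : ∀ x y → det x x y ≡ 𝟎)
      (across-product : ∀ p → Point p → ∀ s s′ → s ≢ s′ → ∃[ μ ] (μ ≢ 0# × det (vec (across p s)) (vec p) (vec (across p s′)) ≡ μ ∷ []))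
      where

      open Spans vec linear

      no-digon : ∀ {p₁ ℓ₁ p₂ ℓ₂} → Turnᵛ p₁ ℓ₁ p₂ → Turnᵛ ℓ₁ p₂ ℓ₂ → Turnᵛ p₂ ℓ₂ p₁ → ¬ Point p₁
      no-digon {p₁} {p₂ = p₂} T₁ T₂ T₃ pt =
        let s , s′ , μ , s≢s′ , μ≢0 , eq = local (bilinear (vec p₂)) (same-point pt T₁) T₁ T₂ T₃
              (λ s → det-xyx (vec p₂) (vec p₂) , det-xyy (vec (across p₂ s)) (vec p₂) , det-xxy (vec p₂) (vec (across p₂ s)))
            μ′ , μ′≢0 , eq′ = across-product p₂ (same-point pt T₁) s s′ s≢s′
        in x*y≢0 μ≢0 μ′≢0 (cong head (trans (sym (trans eq (cong (μ ·_) eq′))) (det-xyx (vec p₁) (vec p₂))))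

      plane-girth : ∀ u v w l → Turning Turnᵛ (u ∷ v ∷ w ∷ l ++ u ∷ v ∷ []) → 6 ≤ 3 ℕ.+ length l
      plane-girth u v w [] (T₁ , T₂ , T₃ , _) =
        ⊥-elim (odd (sym (same-colour T₁)) T₃)
      plane-girth u v w (x₁ ∷ []) (T₁ , T₂ , T₃ , T₄ , _) =
        ⊥-elim (alternate T₁ (no-digon T₁ T₂ T₃) (no-digon T₂ T₃ T₄))
      plane-girth u v w (x₁ ∷ x₂ ∷ []) (T₁ , T₂ , T₃ , T₄ , T₅ , _) =
        ⊥-elim (odd (sym (trans (same-colour T₁) (same-colour T₃))) T₅)
      plane-girth u v w (x₁ ∷ x₂ ∷ x₃ ∷ l) _ = ℕₚ.m≤m+n 6 (length l)

  module QuadrangleFormulas {A : Set} (plus times : A → A → A) (minus : A → A) (0# 1# : A) where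
    open Arithmetic plus times minus public

    -- The symplectic form of the quadrangle W(q): its lines are the totally isotropic lines.
    β : Vec A 4 → Vec A 4 → Vec A 1
    β (x₀ ∷ x₁ ∷ x₂ ∷ x₃ ∷ []) (y₀ ∷ y₁ ∷ y₂ ∷ y₃ ∷ []) = (x₀ * y₁ - x₁ * y₀ + x₂ * y₃ - x₃ * y₂) ∷ []

    p₀ : Vec A 4
    p₀ = 1# ∷ 0# ∷ 0# ∷ 0# ∷ []

    p₁ : A → Vec A 4
    p₁ a = a ∷ 0# ∷ 1# ∷ 0# ∷ []

    p₂ : A → A → Vec A 4
    p₂ k b = b ∷ 0# ∷ k ∷ 1# ∷ []

    p₃ : A → A → A → Vec A 4
    p₃ a l a′ = (a * a′ - l) ∷ (- 1#) ∷ a′ ∷ a ∷ []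

    p₂ᵛ p₃ᵛ : Vec A 3 → Vec A 4
    p₂ᵛ (k ∷ b ∷ _ ∷ []) = p₂ k b
    p₃ᵛ (a ∷ l ∷ a′ ∷ []) = p₃ a l a′

    -- Incidence of the point `(a , l , a′)` with the line `[k , b , k′]`: the equation
    -- `b = a k - a′` is the orthogonality of `p₂ k b` and `p₃ a l a′`, and `k′` is determined by
    -- `p₃ a l a′ = (- k′ , - 1 , - b , 0) + a p₂ k b`.
    cross : Bool → Vec A 3 → A → Vec A 3
    cross true  (a ∷ l ∷ a′ ∷ []) k = k ∷ b ∷ (l + (a * b + a * b) - a * a * k) ∷ []
      where
      b : A
      b = a * k - a′
    cross false (k ∷ b ∷ k′ ∷ []) a = a ∷ (k′ - (a * b + a * b) + a * a * k) ∷ (a * k - b) ∷ []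

  module PlaneFormulas {A : Set} (plus times : A → A → A) (minus : A → A) (0# 1# : A) where
    open Arithmetic plus times minus public

    det : Vec A 3 → Vec A 3 → Vec A 3 → Vec A 1
    det (x₁ ∷ x₂ ∷ x₃ ∷ []) (y₁ ∷ y₂ ∷ y₃ ∷ []) (z₁ ∷ z₂ ∷ z₃ ∷ []) =
      (x₁ * (y₂ * z₃ - y₃ * z₂) + x₂ * (y₃ * z₁ - y₁ * z₃) + x₃ * (y₁ * z₂ - y₂ * z₁)) ∷ []

    p₀ : Vec A 3
    p₀ = 0# ∷ 0# ∷ 1# ∷ []

    p₁ : A → Vec A 3
    p₁ a = 0# ∷ 1# ∷ a ∷ []

    p₂ : A → A → Vec A 3
    p₂ k b = 1# ∷ k ∷ b ∷ []

    p₁ᵛ p₂ᵛ : Vec A 2 → Vec A 3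
    p₁ᵛ (a ∷ _ ∷ []) = p₁ a
    p₂ᵛ (k ∷ b ∷ []) = p₂ k b

    -- The affine incidence equation `b = l + k a`: the point `(k , b)` lies on the line with slope
    -- `a` and intercept `l`.
    cross : Bool → Vec A 2 → A → Vec A 2
    cross true  (a ∷ l ∷ []) k = k ∷ (l + k * a) ∷ []
    cross false (k ∷ b ∷ []) a = a ∷ (b - k * a) ∷ []

  module Quadrangle {q : ℕ} (D : FiniteDomain q) where
    open LinearAlgebra D
    private
      module Φ = QuadrangleFormulas _+_ _*_ -_ 0# 1#
      module S {n : ℕ} = QuadrangleFormulas {Polynomial n} _:+_ _:*_ :-_ :0 :1

    quadrangle-cross : Cross q 2
    quadrangle-cross = record
      { cross      = Φ.cross
      ; cross-head = λ { true (_ ∷ _ ∷ _ ∷ []) s → refl ; false (_ ∷ _ ∷ _ ∷ []) s → refl }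
      ; cross-back = λ { true (x₁ ∷ x₂ ∷ x₃ ∷ []) k → solveVec
          (λ x₁ x₂ x₃ k → S.cross false (S.cross true (x₁ ∷ x₂ ∷ x₃ ∷ []) k) x₁ , (x₁ ∷ x₂ ∷ x₃ ∷ []))
          (x₁ ∷ x₂ ∷ x₃ ∷ k ∷ []) refl
        ; false (x₁ ∷ x₂ ∷ x₃ ∷ []) k → solveVec
          (λ x₁ x₂ x₃ k → S.cross true (S.cross false (x₁ ∷ x₂ ∷ x₃ ∷ []) k) x₁ , (x₁ ∷ x₂ ∷ x₃ ∷ []))
          (x₁ ∷ x₂ ∷ x₃ ∷ k ∷ []) refl }
      }

    open Representation D quadrangle-cross

    vec : V → Vec F 4
    vec (false , ε) = Φ.p₀
    vec (true , a ▹ ε) = Φ.p₁ a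
    vec (false , k ▹ b ▹ ε) = Φ.p₂ k b
    vec (true , a ▹ l ▹ a′ ▹ ε) = Φ.p₃ a l a′
    -- The remaining vertices are lines, which carry no vector.
    vec _ = 𝟎

    data PointView : V → Set where
      pt₀ : PointView (false , ε)
      pt₁ : ∀ a → PointView (true , a ▹ ε)
      pt₂ : ∀ k b → PointView (false , k ▹ b ▹ ε)
      pt₃ : ∀ a l a′ → PointView (true , a ▹ l ▹ a′ ▹ ε)

    data LineView : V → Set where
      ln₀ : LineView (true , ε)
      ln₁ : ∀ k → LineView (false , k ▹ ε)
      ln₂ : ∀ a l → LineView (true , a ▹ l ▹ ε)
      ln₃ : ∀ k b k′ → LineView (false , k ▹ b ▹ k′ ▹ ε)

    point-view : ∀ v → Point v → PointView v
    point-view (false , ε) _ = pt₀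
    point-view (true , _ ▹ ε) _ = pt₁ _
    point-view (false , _ ▹ _ ▹ ε) _ = pt₂ _ _
    point-view (true , _ ▹ _ ▹ _ ▹ ε) _ = pt₃ _ _ _
    point-view (false , _ ▹ _ ▹ _ ▹ ε) ()

    line-view : ∀ v → Line v → LineView v
    line-view (true , ε) _ = ln₀
    line-view (false , _ ▹ ε) _ = ln₁ _
    line-view (true , _ ▹ _ ▹ ε) _ = ln₂ _ _
    line-view (false , _ ▹ _ ▹ _ ▹ ε) _ = ln₃ _ _ _
    line-view (true , _ ▹ _ ▹ _ ▹ ε) ()

    linear : ∀ ℓ → Line ℓ → ∀ t → vec (nb ℓ (suc t)) ≡ vec (nb ℓ (suc 0#)) ⊞ t · vec (nb ℓ zero)
    linear ℓ ln t with line-view ℓ ln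
    ... | ln₀ = solveVec (λ t → S.p₁ t , S.p₁ :0 S.⊞ t S.· S.p₀) (t ∷ []) refl
    ... | ln₁ k = solveVec (λ k t → S.p₂ k t , S.p₂ k :0 S.⊞ t S.· S.p₀) (k ∷ t ∷ []) refl
    ... | ln₂ a l = solveVec (λ a l t → S.p₃ a l t , S.p₃ a l :0 S.⊞ t S.· S.p₁ a) (a ∷ l ∷ t ∷ []) refl
    ... | ln₃ k b k′ = solveVec (λ k b k′ t → S.p₃ᵛ (S.cross false (k ∷ b ∷ k′ ∷ []) t) , S.p₃ᵛ (S.cross false (k ∷ b ∷ k′ ∷ []) :0) S.⊞ t S.· S.p₂ k b)
        (k ∷ b ∷ k′ ∷ t ∷ []) refl

    null : ∀ p → Point p → Φ.β (vec p) (vec p) ≡ 𝟎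
    null p pt with point-view p pt
    ... | pt₀ = solveVec (S.β S.p₀ S.p₀ , :0 ∷ []) [] refl
    ... | pt₁ a = solveVec (λ a → S.β (S.p₁ a) (S.p₁ a) , :0 ∷ []) (a ∷ []) refl
    ... | pt₂ k b = solveVec (λ k b → S.β (S.p₂ k b) (S.p₂ k b) , :0 ∷ []) (k ∷ b ∷ []) refl
    ... | pt₃ a l a′ = solveVec (λ a l a′ → S.β (S.p₃ a l a′) (S.p₃ a l a′) , :0 ∷ []) (a ∷ l ∷ a′ ∷ []) refl

    null₂ : ∀ ℓ → Line ℓ → Φ.β (vec (nb ℓ (suc 0#))) (vec (nb ℓ zero)) ≡ 𝟎 × Φ.β (vec (nb ℓ zero)) (vec (nb ℓ (suc 0#))) ≡ 𝟎
    null₂ ℓ ln with line-view ℓ ln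
    ... | ln₀ =
        solveVec (S.β (S.p₁ :0) S.p₀ , :0 ∷ []) [] refl ,
        solveVec (S.β S.p₀ (S.p₁ :0) , :0 ∷ []) [] refl
    ... | ln₁ k =
        solveVec (λ k → S.β (S.p₂ k :0) S.p₀ , :0 ∷ []) (k ∷ []) refl ,
        solveVec (λ k → S.β S.p₀ (S.p₂ k :0) , :0 ∷ []) (k ∷ []) refl
    ... | ln₂ a l =
        solveVec (λ a l → S.β (S.p₃ a l :0) (S.p₁ a) , :0 ∷ []) (a ∷ l ∷ []) refl ,
        solveVec (λ a l → S.β (S.p₁ a) (S.p₃ a l :0) , :0 ∷ []) (a ∷ l ∷ []) refl
    ... | ln₃ k b k′ =
        solveVec (λ k b k′ → S.β (S.p₃ᵛ (S.cross false (k ∷ b ∷ k′ ∷ []) :0)) (S.p₂ k b) , :0 ∷ [])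
            (k ∷ b ∷ k′ ∷ []) refl ,
        solveVec (λ k b k′ → S.β (S.p₂ k b) (S.p₃ᵛ (S.cross false (k ∷ b ∷ k′ ∷ []) :0)) , :0 ∷ [])
            (k ∷ b ∷ k′ ∷ []) refl

    bilinear : Bilinear Φ.β
    bilinear = record
      { linearˡ = λ { s (a ∷ b ∷ c ∷ d ∷ []) t (e ∷ f ∷ g ∷ h ∷ []) (i ∷ j ∷ k ∷ l ∷ []) → solveVec
          (λ s t a b c d e f g h i j k l → let x = a ∷ b ∷ c ∷ d ∷ [] ; y = e ∷ f ∷ g ∷ h ∷ [] ; z = i ∷ j ∷ k ∷ l ∷ [] in
            S.β (s S.· x S.⊞ t S.· y) z , s S.· S.β x z S.⊞ t S.· S.β y z)
          (s ∷ t ∷ a ∷ b ∷ c ∷ d ∷ e ∷ f ∷ g ∷ h ∷ i ∷ j ∷ k ∷ l ∷ []) refl }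
      ; linearʳ = λ { s (a ∷ b ∷ c ∷ d ∷ []) t (e ∷ f ∷ g ∷ h ∷ []) (i ∷ j ∷ k ∷ l ∷ []) → solveVec
          (λ s t a b c d e f g h i j k l → let x = a ∷ b ∷ c ∷ d ∷ [] ; y = e ∷ f ∷ g ∷ h ∷ [] ; z = i ∷ j ∷ k ∷ l ∷ [] in
            S.β z (s S.· x S.⊞ t S.· y) , s S.· S.β z x S.⊞ t S.· S.β z y)
          (s ∷ t ∷ a ∷ b ∷ c ∷ d ∷ e ∷ f ∷ g ∷ h ∷ i ∷ j ∷ k ∷ l ∷ []) refl }
      }

    antisymmetric : ∀ x y → Φ.β x y ≡ map (-_) (Φ.β y x)
    antisymmetric (a ∷ b ∷ c ∷ d ∷ []) (e ∷ f ∷ g ∷ h ∷ []) = solveVec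
      (λ a b c d e f g h → let x = a ∷ b ∷ c ∷ d ∷ [] ; y = e ∷ f ∷ g ∷ h ∷ [] in S.β x y , map (:-_) (S.β y x))
      (a ∷ b ∷ c ∷ d ∷ e ∷ f ∷ g ∷ h ∷ []) refl

    -- The labels at `p` parametrise the lines through `p` by a projective line over the field: the
    -- product of two standard points is 1 or -1 if one label is `zero`, and otherwise the
    -- difference of the parameters.
    across-product : ∀ p → Point p → ∀ s s′ → s ≢ s′ →
      ∃[ μ ] (μ ≢ 0# × Φ.β (vec (across p s)) (vec (across p s′)) ≡ μ ∷ [])
    across-product p pt zero zero s≢s′ = contradiction refl s≢s′
    across-product p pt zero (suc m) s≢s′ with point-view p pt
    ... | pt₀ = 1# , 1≢0 , solveVec
        (λ m → S.β (S.p₁ :0) (S.p₂ m :0) , :1 ∷ []) (m ∷ []) refl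
    ... | pt₁ a = - 1# , -x≢0 1≢0 , solveVec
        (λ a m → S.β S.p₀ (S.p₃ a m :0) , :- :1 ∷ []) (a ∷ m ∷ []) refl
    ... | pt₂ k b = - 1# , -x≢0 1≢0 , solveVec
        (λ k b m → S.β S.p₀ (S.p₃ᵛ (S.cross false (k ∷ b ∷ m ∷ []) :0)) , :- :1 ∷ []) (k ∷ b ∷ m ∷ []) refl
    ... | pt₃ a l a′ = 1# , 1≢0 , solveVec
        (λ a l a′ m → S.β (S.p₁ a) (S.p₂ᵛ (S.cross true (a ∷ l ∷ a′ ∷ []) m)) , :1 ∷ [])
        (a ∷ l ∷ a′ ∷ m ∷ []) refl
    across-product p pt (suc m) zero s≢s′ =
      let μ , μ≢0 , eq = across-product p pt zero (suc m) (s≢s′ ∘ sym)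
      in - μ , -x≢0 μ≢0 , trans (antisymmetric (vec (across p (suc m))) (vec (across p zero))) (cong (map (-_)) eq)
    across-product p pt (suc m) (suc n) s≢s′ with point-view p pt
    ... | pt₀ = m - n , (λ eq → s≢s′ (cong suc (x-y≡0⇒x≡y eq))) , solveVec
        (λ m n → S.β (S.p₂ m :0) (S.p₂ n :0) , m :+ :- n ∷ []) (m ∷ n ∷ []) refl
    ... | pt₁ a = m - n , (λ eq → s≢s′ (cong suc (x-y≡0⇒x≡y eq))) , solveVec
        (λ a m n → S.β (S.p₃ a m :0) (S.p₃ a n :0) , m :+ :- n ∷ []) (a ∷ m ∷ n ∷ []) refl
    ... | pt₂ k b = m - n , (λ eq → s≢s′ (cong suc (x-y≡0⇒x≡y eq))) , solveVec
        (λ k b m n → S.β (S.p₃ᵛ (S.cross false (k ∷ b ∷ m ∷ []) :0)) (S.p₃ᵛ (S.cross false (k ∷ b ∷ n ∷ []) :0)) ,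
           m :+ :- n ∷ [])
        (k ∷ b ∷ m ∷ n ∷ []) refl
    ... | pt₃ a l a′ = m - n , (λ eq → s≢s′ (cong suc (x-y≡0⇒x≡y eq))) , solveVec
        (λ a l a′ m n → S.β (S.p₂ᵛ (S.cross true (a ∷ l ∷ a′ ∷ []) m)) (S.p₂ᵛ (S.cross true (a ∷ l ∷ a′ ∷ []) n)) ,
           m :+ :- n ∷ [])
        (a ∷ l ∷ a′ ∷ m ∷ n ∷ []) refl

    girth : ∀ u v w l → Turning Turnᵛ (u ∷ v ∷ w ∷ l ++ u ∷ v ∷ []) → 8 ≤ 3 ℕ.+ length l
    girth = QuadrangleGirth.quadrangle-girth D quadrangle-cross vec Φ.β bilinear linear null null₂ across-product

  module Plane {q : ℕ} (D : FiniteDomain q) where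
    open LinearAlgebra D
    private
      module Φ = PlaneFormulas _+_ _*_ -_ 0# 1#
      module S {n : ℕ} = PlaneFormulas {Polynomial n} _:+_ _:*_ :-_ :0 :1

    plane-cross : Cross q 1
    plane-cross = record
      { cross      = Φ.cross
      ; cross-head = λ { true (_ ∷ _ ∷ []) s → refl ; false (_ ∷ _ ∷ []) s → refl }
      ; cross-back = λ { true (x₁ ∷ x₂ ∷ []) k → solveVec
          (λ x₁ x₂ k → S.cross false (S.cross true (x₁ ∷ x₂ ∷ []) k) x₁ , (x₁ ∷ x₂ ∷ []))
          (x₁ ∷ x₂ ∷ k ∷ []) refl
        ; false (x₁ ∷ x₂ ∷ []) k → solveVec
          (λ x₁ x₂ k → S.cross true (S.cross false (x₁ ∷ x₂ ∷ []) k) x₁ , (x₁ ∷ x₂ ∷ []))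
          (x₁ ∷ x₂ ∷ k ∷ []) refl }
      }

    open Representation D plane-cross

    vec : V → Vec F 3
    vec (false , ε) = Φ.p₀
    vec (true , a ▹ ε) = Φ.p₁ a
    vec (false , k ▹ b ▹ ε) = Φ.p₂ k b
    vec _ = 𝟎

    data PointView : V → Set where
      pt₀ : PointView (false , ε)
      pt₁ : ∀ a → PointView (true , a ▹ ε)
      pt₂ : ∀ k b → PointView (false , k ▹ b ▹ ε)

    data LineView : V → Set where
      ln₀ : LineView (true , ε)
      ln₁ : ∀ k → LineView (false , k ▹ ε)
      ln₂ : ∀ a l → LineView (true , a ▹ l ▹ ε)

    point-view : ∀ v → Point v → PointView v
    point-view (false , ε) _ = pt₀
    point-view (true , _ ▹ ε) _ = pt₁ _
    point-view (false , _ ▹ _ ▹ ε) _ = pt₂ _ _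
    point-view (true , _ ▹ _ ▹ ε) ()

    line-view : ∀ v → Line v → LineView v
    line-view (true , ε) _ = ln₀
    line-view (false , _ ▹ ε) _ = ln₁ _
    line-view (true , _ ▹ _ ▹ ε) _ = ln₂ _ _
    line-view (false , _ ▹ _ ▹ ε) ()

    linear : ∀ ℓ → Line ℓ → ∀ t → vec (nb ℓ (suc t)) ≡ vec (nb ℓ (suc 0#)) ⊞ t · vec (nb ℓ zero)
    linear ℓ ln t with line-view ℓ ln
    ... | ln₀ = solveVec (λ t → S.p₁ t , S.p₁ :0 S.⊞ t S.· S.p₀) (t ∷ []) refl
    ... | ln₁ k = solveVec (λ k t → S.p₂ k t , S.p₂ k :0 S.⊞ t S.· S.p₀) (k ∷ t ∷ []) refl
    ... | ln₂ a l = solveVec (λ a l t → S.p₂ᵛ (S.cross true (a ∷ l ∷ []) t) , S.p₂ᵛ (S.cross true (a ∷ l ∷ []) :0) S.⊞ t S.· S.p₁ a)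
        (a ∷ l ∷ t ∷ []) refl

    bilinear : ∀ w → Bilinear (λ x z → Φ.det x w z)
    bilinear (m ∷ n ∷ o ∷ []) = record
      { linearˡ = λ { s (a ∷ b ∷ c ∷ []) t (e ∷ f ∷ g ∷ []) (i ∷ j ∷ k ∷ []) → solveVec
          (λ s t a b c e f g i j k m n o → let x = a ∷ b ∷ c ∷ [] ; y = e ∷ f ∷ g ∷ [] ; z = i ∷ j ∷ k ∷ [] ; w = m ∷ n ∷ o ∷ [] in
            S.det (s S.· x S.⊞ t S.· y) w z , s S.· S.det x w z S.⊞ t S.· S.det y w z)
          (s ∷ t ∷ a ∷ b ∷ c ∷ e ∷ f ∷ g ∷ i ∷ j ∷ k ∷ m ∷ n ∷ o ∷ []) refl }
      ; linearʳ = λ { s (a ∷ b ∷ c ∷ []) t (e ∷ f ∷ g ∷ []) (i ∷ j ∷ k ∷ []) → solveVec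
          (λ s t a b c e f g i j k m n o → let x = a ∷ b ∷ c ∷ [] ; y = e ∷ f ∷ g ∷ [] ; z = i ∷ j ∷ k ∷ [] ; w = m ∷ n ∷ o ∷ [] in
            S.det z w (s S.· x S.⊞ t S.· y) , s S.· S.det z w x S.⊞ t S.· S.det z w y)
          (s ∷ t ∷ a ∷ b ∷ c ∷ e ∷ f ∷ g ∷ i ∷ j ∷ k ∷ m ∷ n ∷ o ∷ []) refl }
      }

    det-xyx : ∀ x y → Φ.det x y x ≡ 𝟎
    det-xyx (a ∷ b ∷ c ∷ []) (e ∷ f ∷ g ∷ []) = solveVec
      (λ a b c e f g → S.det (a ∷ b ∷ c ∷ []) (e ∷ f ∷ g ∷ []) (a ∷ b ∷ c ∷ []) , :0 ∷ [])
      (a ∷ b ∷ c ∷ e ∷ f ∷ g ∷ []) refl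

    det-xyy : ∀ x y → Φ.det x y y ≡ 𝟎
    det-xyy (a ∷ b ∷ c ∷ []) (e ∷ f ∷ g ∷ []) = solveVec
      (λ a b c e f g → S.det (a ∷ b ∷ c ∷ []) (e ∷ f ∷ g ∷ []) (e ∷ f ∷ g ∷ []) , :0 ∷ [])
      (a ∷ b ∷ c ∷ e ∷ f ∷ g ∷ []) refl

    det-xxy : ∀ x y → Φ.det x x y ≡ 𝟎
    det-xxy (a ∷ b ∷ c ∷ []) (e ∷ f ∷ g ∷ []) = solveVec
      (λ a b c e f g → S.det (a ∷ b ∷ c ∷ []) (a ∷ b ∷ c ∷ []) (e ∷ f ∷ g ∷ []) , :0 ∷ [])
      (a ∷ b ∷ c ∷ e ∷ f ∷ g ∷ []) refl

    antisymmetric : ∀ x y z → Φ.det x y z ≡ map (-_) (Φ.det z y x)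
    antisymmetric (a ∷ b ∷ c ∷ []) (d ∷ e ∷ f ∷ []) (g ∷ h ∷ i ∷ []) = solveVec
      (λ a b c d e f g h i → let x = a ∷ b ∷ c ∷ [] ; y = d ∷ e ∷ f ∷ [] ; z = g ∷ h ∷ i ∷ [] in
        S.det x y z , map (:-_) (S.det z y x))
      (a ∷ b ∷ c ∷ d ∷ e ∷ f ∷ g ∷ h ∷ i ∷ []) refl

    -- The determinant degenerates only where the two lines through `p` coincide, which shows as the
    -- factor `m - n` up to sign.
    across-product : ∀ p → Point p → ∀ s s′ → s ≢ s′ →
      ∃[ μ ] (μ ≢ 0# × Φ.det (vec (across p s)) (vec p) (vec (across p s′)) ≡ μ ∷ [])
    across-product p pt zero zero s≢s′ = contradiction refl s≢s′
    across-product p pt zero (suc m) s≢s′ with point-view p pt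
    ... | pt₀ = 1# , 1≢0 , solveVec
        (λ m → S.det (S.p₁ :0) S.p₀ (S.p₂ m :0) , :1 ∷ []) (m ∷ []) refl
    ... | pt₁ a = - 1# , -x≢0 1≢0 , solveVec
        (λ a m → S.det S.p₀ (S.p₁ a) (S.p₂ᵛ (S.cross true (a ∷ m ∷ []) :0)) , :- :1 ∷ []) (a ∷ m ∷ []) refl
    ... | pt₂ k b = 1# , 1≢0 , solveVec
        (λ k b m → S.det S.p₀ (S.p₂ k b) (S.p₁ᵛ (S.cross false (k ∷ b ∷ []) m)) , :1 ∷ [])
        (k ∷ b ∷ m ∷ []) refl
    across-product p pt (suc m) zero s≢s′ =
      let μ , μ≢0 , eq = across-product p pt zero (suc m) (s≢s′ ∘ sym)
      in - μ , -x≢0 μ≢0 , trans (antisymmetric (vec (across p (suc m))) (vec p) (vec (across p zero))) (cong (map (-_)) eq)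
    across-product p pt (suc m) (suc n) s≢s′ with point-view p pt
    ... | pt₀ = m - n , (λ eq → s≢s′ (cong suc (x-y≡0⇒x≡y eq))) , solveVec
        (λ m n → S.det (S.p₂ m :0) S.p₀ (S.p₂ n :0) , m :+ :- n ∷ []) (m ∷ n ∷ []) refl
    ... | pt₁ a = n - m , (λ eq → s≢s′ (sym (cong suc (x-y≡0⇒x≡y eq)))) , solveVec
        (λ a m n → S.det (S.p₂ᵛ (S.cross true (a ∷ m ∷ []) :0)) (S.p₁ a) (S.p₂ᵛ (S.cross true (a ∷ n ∷ []) :0)) ,
           n :+ :- m ∷ [])
        (a ∷ m ∷ n ∷ []) refl
    ... | pt₂ k b = m - n , (λ eq → s≢s′ (cong suc (x-y≡0⇒x≡y eq))) , solveVec
        (λ k b m n → S.det (S.p₁ᵛ (S.cross false (k ∷ b ∷ []) m)) (S.p₂ k b) (S.p₁ᵛ (S.cross false (k ∷ b ∷ []) n)) ,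
           m :+ :- n ∷ [])
        (k ∷ b ∷ m ∷ n ∷ []) refl

    girth : ∀ u v w l → Turning Turnᵛ (u ∷ v ∷ w ∷ l ++ u ∷ v ∷ []) → 6 ≤ 3 ℕ.+ length l
    girth = PlaneGirth.plane-girth D plane-cross vec Φ.det bilinear linear det-xyx det-xyy det-xxy across-product

-- The split Cayley hexagon in the split octonions

module SplitCayleyHexagon where

  open import Data.List using ([]; _∷_; length; _++_)
  open import Data.Integer using (+_)
  open import Data.Fin using (#_)
  open import Data.Vec using (Vec; []; _∷_; head; replicate; lookup)
  open import Relation.Binary.PropositionalEquality
  open DoubleTrees
  open Graphs
  open Representations

  module HexagonGirth {q d n : ℕ} (D : FiniteDomain q) (X : Cross q d) where
    open LinearAlgebra D
    open Representation D X

    module _ (vec : V → Vec F n) (_⊙_ : Vec F n → Vec F n → Vec F n) (bilinear : Bilinear _⊙_)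
      (linear : ∀ ℓ → Line ℓ → ∀ t → vec (nb ℓ (suc t)) ≡ vec (nb ℓ (suc 0#)) ⊞ t · vec (nb ℓ zero))
      (null : ∀ p → Point p → vec p ⊙ vec p ≡ 𝟎)
      (null₂ : ∀ ℓ → Line ℓ → vec (nb ℓ (suc 0#)) ⊙ vec (nb ℓ zero) ≡ 𝟎 × vec (nb ℓ zero) ⊙ vec (nb ℓ (suc 0#)) ≡ 𝟎)
      (nonzero : ∀ p → Point p → ∀ {μ} → μ ≢ 0# → μ · vec p ≢ 𝟎)
      (across-product : ∀ p → Point p → ∀ s s′ → s ≢ s′ → ∃[ μ ] (μ ≢ 0# × vec (across p s) ⊙ vec (across p s′) ≡ μ · vec p))
      (swap : ∀ p p′ p″ {μ} → Point p → Point p′ → Point p″ → vec p ⊙ vec p″ ≡ μ · vec p′ → vec p″ ⊙ vec p ≡ (- μ) · vec p′)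
      (alternative : ∀ x y z → ((x ⊙ y) ⊙ z) ⊞ ((x ⊙ z) ⊙ y) ≡ x ⊙ ((y ⊙ z) ⊞ (z ⊙ y)))
      where

      open Spans vec linear
      open Collinear bilinear null null₂
      open Bilinear bilinear using (homoˡ; homoʳ; zeroʳ-β; linearʳ)

      middle : ∀ {p ℓ p′ ℓ′ p″} → Point p → Turnᵛ p ℓ p′ → Turnᵛ ℓ p′ ℓ′ → Turnᵛ p′ ℓ′ p″ →
        ∃[ μ ] (μ ≢ 0# × vec p ⊙ vec p″ ≡ μ · vec p′)
      middle {p′ = p′} pt T₁ T₂ T₃ with local′ (same-point pt T₁) T₁ T₂ T₃
      ... | s , s′ , μ , s≢s′ , μ≢0 , eq with across-product p′ (same-point pt T₁) s s′ s≢s′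
      ...   | μ′ , μ′≢0 , eq′ = μ * μ′ , x*y≢0 μ≢0 μ′≢0 , trans eq (trans (cong (μ ·_) eq′) (·-assoc μ μ′ _))

      no-digon : ∀ {p₁ ℓ₁ p₂ ℓ₂} → Turnᵛ p₁ ℓ₁ p₂ → Turnᵛ ℓ₁ p₂ ℓ₂ → Turnᵛ p₂ ℓ₂ p₁ → ¬ Point p₁
      no-digon {p₁} {p₂ = p₂} T₁ T₂ T₃ pt = let μ , μ≢0 , eq = middle pt T₁ T₂ T₃ in nonzero p₂ (same-point pt T₁) μ≢0 (trans (sym eq) (null p₁ pt))

      no-triangle : ∀ {p₁ ℓ₁ p₂ ℓ₂ p₃ ℓ₃} → Turnᵛ p₁ ℓ₁ p₂ → Turnᵛ ℓ₁ p₂ ℓ₂ → Turnᵛ p₂ ℓ₂ p₃ → Turnᵛ p₃ ℓ₃ p₁ → ¬ Point p₁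
      no-triangle {p₂ = p₂} T₁ T₂ T₃ T₅ pt = let μ , μ≢0 , eq = middle pt T₁ T₂ T₃ in nonzero p₂ (same-point pt T₁) μ≢0
              (trans (sym eq) (proj₁ (collinear-turn pt (turn-sym T₅))))

      -- Both `p₂` and `p₄` are collinear with `p₁` and `p₃`, so up to scalars both arise as the
      -- product of `p₁` and `p₃`, taken in the two orders. Being proportional they have product
      -- zero, whereas `middle` makes it a nonzero multiple of `p₃`.
      no-quadrangle : ∀ {p₁ ℓ₁ p₂ ℓ₂ p₃ ℓ₃ p₄ ℓ₄} → Turnᵛ p₁ ℓ₁ p₂ → Turnᵛ ℓ₁ p₂ ℓ₂ → Turnᵛ p₂ ℓ₂ p₃ → Turnᵛ ℓ₂ p₃ ℓ₃ →
        Turnᵛ p₃ ℓ₃ p₄ → Turnᵛ ℓ₃ p₄ ℓ₄ → Turnᵛ p₄ ℓ₄ p₁ → ¬ Point p₁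
      no-quadrangle {p₁} {p₂ = p₂} {p₃ = p₃} {p₄ = p₄} T₁ T₂ T₃ T₄ T₅ T₆ T₇ P₁ =
        let λ₂ , _ , eq₂ = middle P₁ T₁ T₂ T₃
            λ₃ , λ₃≢0 , eq₃ = middle P₂ T₃ T₄ T₅
            λ₄ , λ₄≢0 , eq₄ = middle P₃ T₅ T₆ T₇
        in nonzero p₃ P₃ (x*y≢0 λ₄≢0 λ₃≢0) (begin
        (λ₄ * λ₃) · vec p₃  ≡⟨ ·-assoc λ₄ λ₃ _ ⟨
        λ₄ · λ₃ · vec p₃  ≡⟨ cong (λ₄ ·_) eq₃ ⟨
        λ₄ · (vec p₂ ⊙ vec p₄)  ≡⟨ homoʳ λ₄ (vec p₄) (vec p₂) ⟨
        vec p₂ ⊙ (λ₄ · vec p₄)  ≡⟨ cong (vec p₂ ⊙_) (trans (sym eq₄) (swap _ _ _ P₁ P₂ P₃ eq₂)) ⟩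
        vec p₂ ⊙ ((- λ₂) · vec p₂)  ≡⟨ homoʳ _ (vec p₂) (vec p₂) ⟩
        (- λ₂) · (vec p₂ ⊙ vec p₂)  ≡⟨ cong ((- λ₂) ·_) (null p₂ P₂) ⟩
        (- λ₂) · 𝟎  ≡⟨ ·-zeroʳ _ ⟩
        𝟎  ∎)
        where
        open ≡-Reasoning
        P₂ : Point p₂
        P₂ = same-point P₁ T₁
        P₃ : Point p₃
        P₃ = same-point P₂ T₃

      -- By alternativity (x₁x₃)x₄ + (x₁x₄)x₃ = 0, which makes the distinct points x₃ and x₄ proportional.
      no-pentagon : ∀ {p₁ ℓ₁ p₂ ℓ₂ p₃ ℓ₃ p₄ ℓ₄ p₅ ℓ₅} → Turnᵛ p₁ ℓ₁ p₂ → Turnᵛ ℓ₁ p₂ ℓ₂ → Turnᵛ p₂ ℓ₂ p₃ → Turnᵛ ℓ₂ p₃ ℓ₃ →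
        Turnᵛ p₃ ℓ₃ p₄ → Turnᵛ ℓ₃ p₄ ℓ₄ → Turnᵛ p₄ ℓ₄ p₅ → Turnᵛ ℓ₄ p₅ ℓ₅ → Turnᵛ p₅ ℓ₅ p₁ → ¬ Point p₁
      no-pentagon {p₁} {p₂ = p₂} {p₃ = p₃} {p₄ = p₄} {p₅ = p₅} T₁ T₂ T₃ T₄ T₅ T₆ T₇ T₈ T₉ P₁ =
        nonzero p₃ P₃ (x*y≢0 (x*y≢0 (proj₁ (proj₂ M₅)) (proj₁ (proj₂ M₄))) (proj₁ (proj₂ M₃))) (begin
          (λ₅ * λ₄ * λ₃) · vec p₃  ≡⟨ ·-assoc (λ₅ * λ₄) λ₃ _ ⟨
          (λ₅ * λ₄) · λ₃ · vec p₃  ≡⟨ cong ((λ₅ * λ₄) ·_) eq₃ ⟨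
          (λ₅ * λ₄) · (vec p₂ ⊙ vec p₄)  ≡⟨ ⊞-identityˡ _ ⟨
          𝟎 ⊞ (λ₅ * λ₄) · (vec p₂ ⊙ vec p₄)  ≡⟨ cong (_⊞ (λ₅ * λ₄) · (vec p₂ ⊙ vec p₄)) (·-zeroʳ (λ₂ * λ₃)) ⟨
          (λ₂ * λ₃) · 𝟎 ⊞ (λ₅ * λ₄) · (vec p₂ ⊙ vec p₄)  ≡⟨ cong (λ x → (λ₂ * λ₃) · x ⊞ (λ₅ * λ₄) · (vec p₂ ⊙ vec p₄)) (proj₁ (collinear-turn P₂ T₃)) ⟨
          (λ₂ * λ₃) · (vec p₂ ⊙ vec p₃) ⊞ (λ₅ * λ₄) · (vec p₂ ⊙ vec p₄)  ≡⟨ linearʳ _ (vec p₃) _ (vec p₄) (vec p₂) ⟨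
          vec p₂ ⊙ ((λ₂ * λ₃) · vec p₃ ⊞ (λ₅ * λ₄) · vec p₄)  ≡⟨ cong (vec p₂ ⊙_) proportional ⟩
          vec p₂ ⊙ 𝟎  ≡⟨ zeroʳ-β (vec p₂) ⟩
          𝟎  ∎)
        where
        open ≡-Reasoning
        P₂ : Point p₂
        P₂ = same-point P₁ T₁
        P₃ : Point p₃
        P₃ = same-point P₂ T₃
        M₂ : ∃[ μ ] (μ ≢ 0# × vec p₁ ⊙ vec p₃ ≡ μ · vec p₂)
        M₂ = middle P₁ T₁ T₂ T₃
        M₃ : ∃[ μ ] (μ ≢ 0# × vec p₂ ⊙ vec p₄ ≡ μ · vec p₃)
        M₃ = middle P₂ T₃ T₄ T₅
        M₅ : ∃[ μ ] (μ ≢ 0# × vec p₁ ⊙ vec p₄ ≡ μ · vec p₅)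
        M₅ = middle P₁ (turn-sym T₉) (turn-sym T₈) (turn-sym T₇)
        M₄ : ∃[ μ ] (μ ≢ 0# × vec p₅ ⊙ vec p₃ ≡ μ · vec p₄)
        M₄ = middle (same-point P₁ (turn-sym T₉)) (turn-sym T₇) (turn-sym T₆) (turn-sym T₅)
        λ₂ λ₃ λ₄ λ₅ : F
        λ₂ = proj₁ M₂
        λ₃ = proj₁ M₃
        λ₄ = proj₁ M₄
        λ₅ = proj₁ M₅
        eq₃ : vec p₂ ⊙ vec p₄ ≡ λ₃ · vec p₃
        eq₃ = proj₂ (proj₂ M₃)
        product : ∀ {a b μ ν} {x y : Vec F n} → vec a ⊙ x ≡ ν · vec b → y ≡ μ · vec a → y ⊙ x ≡ (μ * ν) · vec b
        product {a} {b} {μ} {ν} {x} ax y≡ =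
          trans (cong (_⊙ x) y≡) (trans (homoˡ μ (vec a) x) (trans (cong (μ ·_) ax) (·-assoc μ ν (vec b))))
        proportional : (λ₂ * λ₃) · vec p₃ ⊞ (λ₅ * λ₄) · vec p₄ ≡ 𝟎
        proportional = begin
          (λ₂ * λ₃) · vec p₃ ⊞ (λ₅ * λ₄) · vec p₄
            ≡⟨ cong₂ _⊞_ (product {p₂} {p₃} eq₃ (proj₂ (proj₂ M₂))) (product {p₅} {p₄} (proj₂ (proj₂ M₄)) (proj₂ (proj₂ M₅))) ⟨
          ((vec p₁ ⊙ vec p₃) ⊙ vec p₄) ⊞ ((vec p₁ ⊙ vec p₄) ⊙ vec p₃)
            ≡⟨ alternative (vec p₁) (vec p₃) (vec p₄) ⟩
          vec p₁ ⊙ ((vec p₃ ⊙ vec p₄) ⊞ (vec p₄ ⊙ vec p₃))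
            ≡⟨ cong₂ (λ x y → vec p₁ ⊙ (x ⊞ y)) (proj₁ (collinear-turn P₃ T₅)) (proj₂ (collinear-turn P₃ T₅)) ⟩
          vec p₁ ⊙ (𝟎 ⊞ 𝟎)
            ≡⟨ cong (vec p₁ ⊙_) (⊞-identityʳ 𝟎) ⟩
          vec p₁ ⊙ 𝟎
            ≡⟨ zeroʳ-β (vec p₁) ⟩
          𝟎 ∎

      hexagon-girth : ∀ u v w l → Turning Turnᵛ (u ∷ v ∷ w ∷ l ++ u ∷ v ∷ []) → 12 ≤ 3 ℕ.+ length l
      hexagon-girth u v w [] (T₁ , T₂ , T₃ , _) =
        ⊥-elim (odd (sym (same-colour T₁)) T₃)
      hexagon-girth u v w (x₁ ∷ []) (T₁ , T₂ , T₃ , T₄ , _) =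
        ⊥-elim (alternate T₁ (no-digon T₁ T₂ T₃) (no-digon T₂ T₃ T₄))
      hexagon-girth u v w (x₁ ∷ x₂ ∷ []) (T₁ , T₂ , T₃ , T₄ , T₅ , _) =
        ⊥-elim (odd (sym (trans (same-colour T₁) (same-colour T₃))) T₅)
      hexagon-girth u v w (x₁ ∷ x₂ ∷ x₃ ∷ []) (T₁ , T₂ , T₃ , T₄ , T₅ , T₆ , _) =
        ⊥-elim (alternate T₁ (no-triangle T₁ T₂ T₃ T₅) (no-triangle T₂ T₃ T₄ T₆))
      hexagon-girth u v w (x₁ ∷ x₂ ∷ x₃ ∷ x₄ ∷ []) (T₁ , T₂ , T₃ , T₄ , T₅ , T₆ , T₇ , _) =
        ⊥-elim (odd (sym (trans (same-colour T₁) (trans (same-colour T₃) (same-colour T₅)))) T₇)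
      hexagon-girth u v w (x₁ ∷ x₂ ∷ x₃ ∷ x₄ ∷ x₅ ∷ []) (T₁ , T₂ , T₃ , T₄ , T₅ , T₆ , T₇ , T₈ , _) =
        ⊥-elim (alternate T₁ (no-quadrangle T₁ T₂ T₃ T₄ T₅ T₆ T₇) (no-quadrangle T₂ T₃ T₄ T₅ T₆ T₇ T₈))
      hexagon-girth u v w (x₁ ∷ x₂ ∷ x₃ ∷ x₄ ∷ x₅ ∷ x₆ ∷ []) (T₁ , T₂ , T₃ , T₄ , T₅ , T₆ , T₇ , T₈ , T₉ , _) =
        ⊥-elim (odd (sym (trans (same-colour T₁) (trans (same-colour T₃) (trans (same-colour T₅) (same-colour T₇))))) T₉)
      hexagon-girth u v w (x₁ ∷ x₂ ∷ x₃ ∷ x₄ ∷ x₅ ∷ x₆ ∷ x₇ ∷ []) (T₁ , T₂ , T₃ , T₄ , T₅ , T₆ , T₇ , T₈ , T₉ , T₁₀ , _) =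
        ⊥-elim (alternate T₁ (no-pentagon T₁ T₂ T₃ T₄ T₅ T₆ T₇ T₈ T₉) (no-pentagon T₂ T₃ T₄ T₅ T₆ T₇ T₈ T₉ T₁₀))
      hexagon-girth u v w (x₁ ∷ x₂ ∷ x₃ ∷ x₄ ∷ x₅ ∷ x₆ ∷ x₇ ∷ x₈ ∷ []) (T₁ , T₂ , T₃ , T₄ , T₅ , T₆ , T₇ , T₈ , T₉ , T₁₀ , T₁₁ , _) =
        ⊥-elim (odd (sym (trans (same-colour T₁) (trans (same-colour T₃) (trans (same-colour T₅) (trans (same-colour T₇) (same-colour T₉)))))) T₁₁)
      hexagon-girth u v w (x₁ ∷ x₂ ∷ x₃ ∷ x₄ ∷ x₅ ∷ x₆ ∷ x₇ ∷ x₈ ∷ x₉ ∷ l) _ = ℕₚ.m≤m+n 12 (length l)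

  module HexagonFormulas {A : Set} (plus times : A → A → A) (minus : A → A) (0# 1# : A) where
    open Arithmetic plus times minus public

    -- Zorn's vector matrices: a ∷ u₁ ∷ u₂ ∷ u₃ ∷ v₁ ∷ v₂ ∷ v₃ ∷ b ∷ [] is the split octonion with
    -- diagonal entries a, b and off-diagonal vectors u, v.
    _⊙_ : Vec A 8 → Vec A 8 → Vec A 8
    (a ∷ u₁ ∷ u₂ ∷ u₃ ∷ v₁ ∷ v₂ ∷ v₃ ∷ b ∷ []) ⊙ (a′ ∷ u₁′ ∷ u₂′ ∷ u₃′ ∷ v₁′ ∷ v₂′ ∷ v₃′ ∷ b′ ∷ []) =
      (a * a′ + (u₁ * v₁′ + u₂ * v₂′ + u₃ * v₃′)) ∷
      (a * u₁′ + b′ * u₁ - (v₂ * v₃′ - v₃ * v₂′)) ∷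
      (a * u₂′ + b′ * u₂ - (v₃ * v₁′ - v₁ * v₃′)) ∷
      (a * u₃′ + b′ * u₃ - (v₁ * v₂′ - v₂ * v₁′)) ∷
      (a′ * v₁ + b * v₁′ + (u₂ * u₃′ - u₃ * u₂′)) ∷
      (a′ * v₂ + b * v₂′ + (u₃ * u₁′ - u₁ * u₃′)) ∷
      (a′ * v₃ + b * v₃′ + (u₁ * u₂′ - u₂ * u₁′)) ∷
      (b * b′ + (v₁ * u₁′ + v₂ * u₂′ + v₃ * u₃′)) ∷ []

    conj : Vec A 8 → Vec A 8
    conj (a ∷ u₁ ∷ u₂ ∷ u₃ ∷ v₁ ∷ v₂ ∷ v₃ ∷ b ∷ []) =
      b ∷ (- u₁) ∷ (- u₂) ∷ (- u₃) ∷ (- v₁) ∷ (- v₂) ∷ (- v₃) ∷ a ∷ []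

    -- Trace zero means that conjugation acts as negation, on which `swap` rests.
    traceless : A → A → A → A → A → A → A → Vec A 8
    traceless a u₁ u₂ u₃ v₁ v₂ v₃ = a ∷ u₁ ∷ u₂ ∷ u₃ ∷ v₁ ∷ v₂ ∷ v₃ ∷ (- a) ∷ []

    -- The points of the split Cayley hexagon as traceless octonions of norm zero, essentially in the coordinates
    -- of De Smet and Van Maldeghem: two points are collinear iff their product is zero.
    p₀ : Vec A 8
    p₀ = traceless 0# 1# 0# 0# 0# 0# 0#

    p₁ : A → Vec A 8
    p₁ a = traceless 0# a 0# 0# 0# 0# 1#

    p₂ : A → A → Vec A 8
    p₂ k b = traceless 0# b 0# 0# 0# 1# k

    p₃ : A → A → A → Vec A 8
    p₃ a l a′ = traceless (- a) (l + a * a′) 1# 0# 0# (- (a * a)) a′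

    p₄ : A → A → A → A → Vec A 8
    p₄ k b k′ b′ = traceless b (k′ + b * b′) (- k) 1# 0# b′ (k * b′ - b * b)

    p₅ : A → A → A → A → A → Vec A 8
    p₅ a l a′ l′ a″ = traceless (a′ - a * a″) (a′ * a′ - a * l′ + a″ * (l + a * a′)) a″ a (- 1#)
      (l + (a * a′ + a * a′) - a * a * a″) (a′ * a″ - l′)

    p₄ᵛ : Vec A 5 → Vec A 8
    p₄ᵛ (k ∷ b ∷ k′ ∷ b′ ∷ _ ∷ []) = p₄ k b k′ b′

    p₅ᵛ : Vec A 5 → Vec A 8
    p₅ᵛ (a ∷ l ∷ a′ ∷ l′ ∷ a″ ∷ []) = p₅ a l a′ l′ a″

    -- Found by solving p₅ (a, l, a′, l′, a″) ∈ ⟨ p₄ (k, b, k′, b′) , q ⟩, where q is the vector with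
    -- parameter k″ that spans the line [k, b, k′, b′, k″] together with p₄.
    cross : Bool → Vec A 5 → A → Vec A 5
    cross true (a ∷ l ∷ a′ ∷ l′ ∷ a″ ∷ []) k = k ∷ b ∷ k′ ∷ b′ ∷ k″ ∷ []
      where
      b b′ k′ k″ : A
      b  = a * k + a″
      b′ = a * b - a′ + a * a″
      k″ = a * b′ - l - (a * a′ + a * a′) + a * a * a″
      k′ = k * k″ - (b * b′ + b * b′) + a * (b * b - k * b′) + (a′ * a″ - l′)
    cross false (k ∷ b ∷ k′ ∷ b′ ∷ k″ ∷ []) a = a ∷ l ∷ a′ ∷ l′ ∷ a″ ∷ []
      where
      l a′ l′ a″ : A
      a″ = b - a * k
      a′ = a * b + a * b - b′ - a * a * k
      l  = a * (b′ + b′ + b′) - a * a * (b + b + b) + a * a * a * k - k″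
      l′ = k * k″ - k′ - (b * b′ + b * b′) + a * b * b - a * k * b′ + a′ * a″

  module Hexagon {q : ℕ} (D : FiniteDomain q) where
    open LinearAlgebra D
    private
      module Φ = HexagonFormulas _+_ _*_ -_ 0# 1#
      module S {n : ℕ} = HexagonFormulas {Polynomial n} _:+_ _:*_ :-_ :0 :1

    hexagon-cross : Cross q 4
    hexagon-cross = record
      { cross      = Φ.cross
      ; cross-head = λ { true (_ ∷ _ ∷ _ ∷ _ ∷ _ ∷ []) s → refl ; false (_ ∷ _ ∷ _ ∷ _ ∷ _ ∷ []) s → refl }
      ; cross-back = cross-back
      }
      where
      cross-back : ∀ b w s → Φ.cross (not b) (Φ.cross b w s) (head w) ≡ w
      cross-back true  w@(a ∷ l ∷ a′ ∷ l′ ∷ a″ ∷ []) k = solveVec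
        (λ a l a′ l′ a″ k → S.cross false (S.cross true (a ∷ l ∷ a′ ∷ l′ ∷ a″ ∷ []) k) a , (a ∷ l ∷ a′ ∷ l′ ∷ a″ ∷ []))
        (a ∷ l ∷ a′ ∷ l′ ∷ a″ ∷ k ∷ []) refl
      cross-back false w@(a ∷ l ∷ a′ ∷ l′ ∷ a″ ∷ []) k = solveVec
        (λ a l a′ l′ a″ k → S.cross true (S.cross false (a ∷ l ∷ a′ ∷ l′ ∷ a″ ∷ []) k) a , (a ∷ l ∷ a′ ∷ l′ ∷ a″ ∷ []))
        (a ∷ l ∷ a′ ∷ l′ ∷ a″ ∷ k ∷ []) refl

    open Representation D hexagon-cross
    open Φ using (_⊙_)

    vec : V → Vec F 8
    vec (false , ε)                            = Φ.p₀
    vec (true  , a ▹ ε)                        = Φ.p₁ a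
    vec (false , k ▹ b ▹ ε)                    = Φ.p₂ k b
    vec (true  , a ▹ l ▹ a′ ▹ ε)               = Φ.p₃ a l a′
    vec (false , k ▹ b ▹ k′ ▹ b′ ▹ ε)          = Φ.p₄ k b k′ b′
    vec (true  , a ▹ l ▹ a′ ▹ l′ ▹ a″ ▹ ε)     = Φ.p₅ a l a′ l′ a″
    vec _                                      = 𝟎

    data PointView : V → Set where
      pt₀ : PointView (false , ε)
      pt₁ : ∀ a → PointView (true , a ▹ ε)
      pt₂ : ∀ k b → PointView (false , k ▹ b ▹ ε)
      pt₃ : ∀ a l a′ → PointView (true , a ▹ l ▹ a′ ▹ ε)
      pt₄ : ∀ k b k′ b′ → PointView (false , k ▹ b ▹ k′ ▹ b′ ▹ ε)
      pt₅ : ∀ a l a′ l′ a″ → PointView (true , a ▹ l ▹ a′ ▹ l′ ▹ a″ ▹ ε)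

    data LineView : V → Set where
      ln₀ : LineView (true , ε)
      ln₁ : ∀ k → LineView (false , k ▹ ε)
      ln₂ : ∀ a l → LineView (true , a ▹ l ▹ ε)
      ln₃ : ∀ k b k′ → LineView (false , k ▹ b ▹ k′ ▹ ε)
      ln₄ : ∀ a l a′ l′ → LineView (true , a ▹ l ▹ a′ ▹ l′ ▹ ε)
      ln₅ : ∀ k b k′ b′ k″ → LineView (false , k ▹ b ▹ k′ ▹ b′ ▹ k″ ▹ ε)

    point-view : ∀ v → Point v → PointView v
    point-view (false , ε)                        _ = pt₀
    point-view (true  , _ ▹ ε)                    _ = pt₁ _
    point-view (false , _ ▹ _ ▹ ε)                _ = pt₂ _ _
    point-view (true  , _ ▹ _ ▹ _ ▹ ε)            _ = pt₃ _ _ _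
    point-view (false , _ ▹ _ ▹ _ ▹ _ ▹ ε)        _ = pt₄ _ _ _ _
    point-view (true  , _ ▹ _ ▹ _ ▹ _ ▹ _ ▹ ε)    _ = pt₅ _ _ _ _ _
    point-view (false , _ ▹ _ ▹ _ ▹ _ ▹ _ ▹ ε)    ()

    line-view : ∀ v → Line v → LineView v
    line-view (true  , ε)                         _ = ln₀
    line-view (false , _ ▹ ε)                     _ = ln₁ _
    line-view (true  , _ ▹ _ ▹ ε)                 _ = ln₂ _ _
    line-view (false , _ ▹ _ ▹ _ ▹ ε)             _ = ln₃ _ _ _
    line-view (true  , _ ▹ _ ▹ _ ▹ _ ▹ ε)         _ = ln₄ _ _ _ _
    line-view (false , _ ▹ _ ▹ _ ▹ _ ▹ _ ▹ ε)     _ = ln₅ _ _ _ _ _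
    line-view (true  , _ ▹ _ ▹ _ ▹ _ ▹ _ ▹ ε)     ()

    linear : ∀ ℓ → Line ℓ → ∀ t → vec (nb ℓ (suc t)) ≡ vec (nb ℓ (suc 0#)) ⊞ t · vec (nb ℓ zero)
    linear ℓ ln t with line-view ℓ ln
    ... | ln₀ = solveVec (λ t → S.p₁ t , S.p₁ :0 S.⊞ t S.· S.p₀) (t ∷ []) refl
    ... | ln₁ k = solveVec (λ k t → S.p₂ k t , S.p₂ k :0 S.⊞ t S.· S.p₀) (k ∷ t ∷ []) refl
    ... | ln₂ a l = solveVec (λ a l t → S.p₃ a l t , S.p₃ a l :0 S.⊞ t S.· S.p₁ a) (a ∷ l ∷ t ∷ []) refl
    ... | ln₃ k b k′ = solveVec (λ k b k′ t → S.p₄ k b k′ t , S.p₄ k b k′ :0 S.⊞ t S.· S.p₂ k b)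
            (k ∷ b ∷ k′ ∷ t ∷ []) refl
    ... | ln₄ a l a′ l′ = solveVec
            (λ a l a′ l′ t → S.p₅ a l a′ l′ t , S.p₅ a l a′ l′ :0 S.⊞ t S.· S.p₃ a l a′)
            (a ∷ l ∷ a′ ∷ l′ ∷ t ∷ []) refl
    ... | ln₅ k b k′ b′ k″ = solveVec
            (λ k b k′ b′ k″ t → let w = k ∷ b ∷ k′ ∷ b′ ∷ k″ ∷ [] in
               S.p₅ᵛ (S.cross false w t) , S.p₅ᵛ (S.cross false w :0) S.⊞ t S.· S.p₄ k b k′ b′)
            (k ∷ b ∷ k′ ∷ b′ ∷ k″ ∷ t ∷ []) refl

    null : ∀ p → Point p → vec p ⊙ vec p ≡ 𝟎
    null p pt with point-view p pt
    ... | pt₀ = solveVec (S.p₀ S.⊙ S.p₀ , replicate 8 :0) [] refl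
    ... | pt₁ a = solveVec (λ a → S.p₁ a S.⊙ S.p₁ a , replicate 8 :0) (a ∷ []) refl
    ... | pt₂ k b = solveVec (λ k b → S.p₂ k b S.⊙ S.p₂ k b , replicate 8 :0) (k ∷ b ∷ []) refl
    ... | pt₃ a l a′ = solveVec (λ a l a′ → S.p₃ a l a′ S.⊙ S.p₃ a l a′ , replicate 8 :0)
        (a ∷ l ∷ a′ ∷ []) refl
    ... | pt₄ k b k′ b′ = solveVec
            (λ k b k′ b′ → S.p₄ k b k′ b′ S.⊙ S.p₄ k b k′ b′ , replicate 8 :0) (k ∷ b ∷ k′ ∷ b′ ∷ []) refl
    ... | pt₅ a l a′ l′ a″ = solveVec
            (λ a l a′ l′ a″ → S.p₅ a l a′ l′ a″ S.⊙ S.p₅ a l a′ l′ a″ , replicate 8 :0)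
            (a ∷ l ∷ a′ ∷ l′ ∷ a″ ∷ []) refl

    null₂ : ∀ ℓ → Line ℓ → vec (nb ℓ (suc 0#)) ⊙ vec (nb ℓ zero) ≡ 𝟎 × vec (nb ℓ zero) ⊙ vec (nb ℓ (suc 0#)) ≡ 𝟎
    null₂ ℓ ln with line-view ℓ ln
    ... | ln₀ =
        solveVec ((S.p₁ :0) S.⊙ S.p₀ , replicate 8 :0) [] refl ,
        solveVec (S.p₀ S.⊙ (S.p₁ :0) , replicate 8 :0) [] refl
    ... | ln₁ k =
        solveVec (λ k → (S.p₂ k :0) S.⊙ S.p₀ , replicate 8 :0) (k ∷ []) refl ,
        solveVec (λ k → S.p₀ S.⊙ (S.p₂ k :0) , replicate 8 :0) (k ∷ []) refl
    ... | ln₂ a l =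
        solveVec (λ a l → (S.p₃ a l :0) S.⊙ (S.p₁ a) , replicate 8 :0) (a ∷ l ∷ []) refl ,
        solveVec (λ a l → (S.p₁ a) S.⊙ (S.p₃ a l :0) , replicate 8 :0) (a ∷ l ∷ []) refl
    ... | ln₃ k b k′ =
        solveVec (λ k b k′ → (S.p₄ k b k′ :0) S.⊙ (S.p₂ k b) , replicate 8 :0) (k ∷ b ∷ k′ ∷ []) refl ,
        solveVec (λ k b k′ → (S.p₂ k b) S.⊙ (S.p₄ k b k′ :0) , replicate 8 :0) (k ∷ b ∷ k′ ∷ []) refl
    ... | ln₄ a l a′ l′ =
        solveVec (λ a l a′ l′ → (S.p₅ a l a′ l′ :0) S.⊙ (S.p₃ a l a′) , replicate 8 :0)
            (a ∷ l ∷ a′ ∷ l′ ∷ []) refl ,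
        solveVec (λ a l a′ l′ → (S.p₃ a l a′) S.⊙ (S.p₅ a l a′ l′ :0) , replicate 8 :0)
            (a ∷ l ∷ a′ ∷ l′ ∷ []) refl
    ... | ln₅ k b k′ b′ k″ =
        solveVec (λ k b k′ b′ k″ → (S.p₅ᵛ (S.cross false (k ∷ b ∷ k′ ∷ b′ ∷ k″ ∷ []) :0)) S.⊙ (S.p₄ k b k′ b′) , replicate 8 :0)
            (k ∷ b ∷ k′ ∷ b′ ∷ k″ ∷ []) refl ,
        solveVec (λ k b k′ b′ k″ → (S.p₄ k b k′ b′) S.⊙ (S.p₅ᵛ (S.cross false (k ∷ b ∷ k′ ∷ b′ ∷ k″ ∷ []) :0)) , replicate 8 :0)
            (k ∷ b ∷ k′ ∷ b′ ∷ k″ ∷ []) refl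

    bilinear : Bilinear _⊙_
    bilinear = record
      { linearˡ = λ { s
          (a ∷ b ∷ c ∷ d ∷ e ∷ f ∷ g ∷ h ∷ []) t (i ∷ j ∷ k ∷ l ∷ m ∷ n ∷ o ∷ p ∷ []) (A ∷ B ∷ C ∷ D ∷ E ∷ G ∷ H ∷ I ∷ []) → solveVec
          (λ s t a b c d e f g h i j k l m n o p A B C D E G H I →
            let x = a ∷ b ∷ c ∷ d ∷ e ∷ f ∷ g ∷ h ∷ []
                y = i ∷ j ∷ k ∷ l ∷ m ∷ n ∷ o ∷ p ∷ []
                z = A ∷ B ∷ C ∷ D ∷ E ∷ G ∷ H ∷ I ∷ []
            in (s S.· x S.⊞ t S.· y) S.⊙ z , s S.· (x S.⊙ z) S.⊞ t S.· (y S.⊙ z))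
          (s ∷ t ∷ a ∷ b ∷ c ∷ d ∷ e ∷ f ∷ g ∷ h ∷ i ∷ j ∷ k ∷ l ∷ m ∷ n ∷ o ∷ p ∷ A ∷ B ∷ C ∷ D ∷ E ∷ G ∷ H ∷ I ∷ []) refl }
      ; linearʳ = λ { s
          (a ∷ b ∷ c ∷ d ∷ e ∷ f ∷ g ∷ h ∷ []) t (i ∷ j ∷ k ∷ l ∷ m ∷ n ∷ o ∷ p ∷ []) (A ∷ B ∷ C ∷ D ∷ E ∷ G ∷ H ∷ I ∷ []) → solveVec
          (λ s t a b c d e f g h i j k l m n o p A B C D E G H I →
            let x = a ∷ b ∷ c ∷ d ∷ e ∷ f ∷ g ∷ h ∷ []
                y = i ∷ j ∷ k ∷ l ∷ m ∷ n ∷ o ∷ p ∷ []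
                z = A ∷ B ∷ C ∷ D ∷ E ∷ G ∷ H ∷ I ∷ []
            in z S.⊙ (s S.· x S.⊞ t S.· y) , s S.· (z S.⊙ x) S.⊞ t S.· (z S.⊙ y))
          (s ∷ t ∷ a ∷ b ∷ c ∷ d ∷ e ∷ f ∷ g ∷ h ∷ i ∷ j ∷ k ∷ l ∷ m ∷ n ∷ o ∷ p ∷ A ∷ B ∷ C ∷ D ∷ E ∷ G ∷ H ∷ I ∷ []) refl }
      }

    -- The linearised form of the right alternative law `(x y) y = x (y y)`.
    alternative : ∀ x y z → ((x ⊙ y) ⊙ z) ⊞ ((x ⊙ z) ⊙ y) ≡ x ⊙ ((y ⊙ z) ⊞ (z ⊙ y))
    alternative
        (a ∷ b ∷ c ∷ d ∷ e ∷ f ∷ g ∷ h ∷ []) (i ∷ j ∷ k ∷ l ∷ m ∷ n ∷ o ∷ p ∷ []) (A ∷ B ∷ C ∷ D ∷ E ∷ G ∷ H ∷ I ∷ []) = solveVec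
      (λ a b c d e f g h i j k l m n o p A B C D E G H I →
        let x = a ∷ b ∷ c ∷ d ∷ e ∷ f ∷ g ∷ h ∷ []
            y = i ∷ j ∷ k ∷ l ∷ m ∷ n ∷ o ∷ p ∷ []
            z = A ∷ B ∷ C ∷ D ∷ E ∷ G ∷ H ∷ I ∷ []
        in ((x S.⊙ y) S.⊙ z) S.⊞ ((x S.⊙ z) S.⊙ y) , x S.⊙ ((y S.⊙ z) S.⊞ (z S.⊙ y)))
      (a ∷ b ∷ c ∷ d ∷ e ∷ f ∷ g ∷ h ∷ i ∷ j ∷ k ∷ l ∷ m ∷ n ∷ o ∷ p ∷ A ∷ B ∷ C ∷ D ∷ E ∷ G ∷ H ∷ I ∷ []) refl

    conj-⊙ : ∀ x y → Φ.conj (x ⊙ y) ≡ Φ.conj y ⊙ Φ.conj x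
    conj-⊙ (a ∷ b ∷ c ∷ d ∷ e ∷ f ∷ g ∷ h ∷ []) (i ∷ j ∷ k ∷ l ∷ m ∷ n ∷ o ∷ p ∷ []) = solveVec
      (λ a b c d e f g h i j k l m n o p →
        let x = a ∷ b ∷ c ∷ d ∷ e ∷ f ∷ g ∷ h ∷ [] ; y = i ∷ j ∷ k ∷ l ∷ m ∷ n ∷ o ∷ p ∷ []
        in S.conj (x S.⊙ y) , S.conj y S.⊙ S.conj x)
      (a ∷ b ∷ c ∷ d ∷ e ∷ f ∷ g ∷ h ∷ i ∷ j ∷ k ∷ l ∷ m ∷ n ∷ o ∷ p ∷ []) refl

    conj-point : ∀ p → Point p → Φ.conj (vec p) ≡ - 1# · vec p
    conj-point p pt with point-view p pt
    ... | pt₀ = solveVec (S.conj S.p₀ , (:- :1) S.· S.p₀) [] refl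
    ... | pt₁ a = solveVec (λ a → S.conj (S.p₁ a) , (:- :1) S.· S.p₁ a) (a ∷ []) refl
    ... | pt₂ k b = solveVec (λ k b → S.conj (S.p₂ k b) , (:- :1) S.· S.p₂ k b) (k ∷ b ∷ []) refl
    ... | pt₃ a l a′ = solveVec (λ a l a′ → S.conj (S.p₃ a l a′) , (:- :1) S.· S.p₃ a l a′)
        (a ∷ l ∷ a′ ∷ []) refl
    ... | pt₄ k b k′ b′ = solveVec (λ k b k′ b′ → S.conj (S.p₄ k b k′ b′) , (:- :1) S.· S.p₄ k b k′ b′)
        (k ∷ b ∷ k′ ∷ b′ ∷ []) refl
    ... | pt₅ a l a′ l′ a″ = solveVec (λ a l a′ l′ a″ → S.conj (S.p₅ a l a′ l′ a″) , (:- :1) S.· S.p₅ a l a′ l′ a″)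
        (a ∷ l ∷ a′ ∷ l′ ∷ a″ ∷ []) refl

    conj-· : ∀ s x → Φ.conj (s · x) ≡ s · Φ.conj x
    conj-· s (a ∷ b ∷ c ∷ d ∷ e ∷ f ∷ g ∷ h ∷ []) = solveVec
      (λ s a b c d e f g h → let x = a ∷ b ∷ c ∷ d ∷ e ∷ f ∷ g ∷ h ∷ [] in
        S.conj (s S.· x) , s S.· S.conj x)
      (s ∷ a ∷ b ∷ c ∷ d ∷ e ∷ f ∷ g ∷ h ∷ []) refl

    -- Conjugation reverses products and negates traceless elements.
    swap : ∀ p p′ p″ {μ} → Point p → Point p′ → Point p″ → vec p ⊙ vec p″ ≡ μ · vec p′ → vec p″ ⊙ vec p ≡ (- μ) · vec p′
    swap p p′ p″ {μ} pt pt′ pt″ eq = begin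
      vec p″ ⊙ vec p  ≡⟨ ·-identity _ ⟨
      1# · (vec p″ ⊙ vec p)  ≡⟨ cong (_· (vec p″ ⊙ vec p)) (cong head (solveVec (:1 ∷ [] , (:- :1) :* (:- :1) ∷ []) [] refl)) ⟩
      (- 1# * - 1#) · (vec p″ ⊙ vec p)  ≡⟨ ·-assoc (- 1#) (- 1#) _ ⟨
      - 1# · - 1# · (vec p″ ⊙ vec p)  ≡⟨ cong (- 1# ·_) (homoʳ (- 1#) (vec p) (vec p″)) ⟨
      - 1# · (vec p″ ⊙ (- 1# · vec p))  ≡⟨ homoˡ (- 1#) (vec p″) _ ⟨
      (- 1# · vec p″) ⊙ (- 1# · vec p)  ≡⟨ cong₂ _⊙_ (conj-point p″ pt″) (conj-point p pt) ⟨
      Φ.conj (vec p″) ⊙ Φ.conj (vec p)  ≡⟨ conj-⊙ (vec p) (vec p″) ⟨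
      Φ.conj (vec p ⊙ vec p″)  ≡⟨ cong Φ.conj eq ⟩
      Φ.conj (μ · vec p′)  ≡⟨ conj-· μ (vec p′) ⟩
      μ · Φ.conj (vec p′)  ≡⟨ cong (μ ·_) (conj-point p′ pt′) ⟩
      μ · - 1# · vec p′  ≡⟨ ·-assoc μ (- 1#) _ ⟩
      (μ * - 1#) · vec p′  ≡⟨ cong (_· vec p′) (cong head (solveVec (λ μ → μ :* (:- :1) ∷ [] , :- μ ∷ [])
          (μ ∷ []) refl)) ⟩
      (- μ) · vec p′  ∎
      where
      open ≡-Reasoning
      open Bilinear bilinear using (homoˡ; homoʳ)

    -- The scalars are again 1, -1 or a difference of two parameters. When one label is `zero`, only
    -- one order is computed, as `swap` yields the other.
    across-product : ∀ p → Point p → ∀ s s′ → s ≢ s′ →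
      ∃[ μ ] (μ ≢ 0# × vec (across p s) ⊙ vec (across p s′) ≡ μ · vec p)
    across-product p pt zero zero s≢s′ = contradiction refl s≢s′
    across-product p pt zero (suc m) s≢s′ with point-view p pt
    ... | pt₀ = 1# , 1≢0 , solveVec
        (λ m → (S.p₁ :0) S.⊙ (S.p₂ m :0) , :1 S.· S.p₀) (m ∷ []) refl
    ... | pt₁ a = 1# , 1≢0 , solveVec
        (λ a m → S.p₀ S.⊙ (S.p₃ a m :0) , :1 S.· S.p₁ a) (a ∷ m ∷ []) refl
    ... | pt₂ k b = - 1# , -x≢0 1≢0 , solveVec
        (λ k b m → S.p₀ S.⊙ (S.p₄ k b m :0) , (:- :1) S.· S.p₂ k b) (k ∷ b ∷ m ∷ []) refl
    ... | pt₃ a l a′ = 1# , 1≢0 , solveVec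
        (λ a l a′ m → (S.p₁ a) S.⊙ (S.p₅ a l a′ m :0) , :1 S.· S.p₃ a l a′) (a ∷ l ∷ a′ ∷ m ∷ []) refl
    ... | pt₄ k b k′ b′ = - 1# , -x≢0 1≢0 , solveVec
        (λ k b k′ b′ m → (S.p₂ k b) S.⊙ (S.p₅ᵛ (S.cross false (k ∷ b ∷ k′ ∷ b′ ∷ m ∷ []) :0)) ,
           (:- :1) S.· S.p₄ k b k′ b′)
        (k ∷ b ∷ k′ ∷ b′ ∷ m ∷ []) refl
    ... | pt₅ a l a′ l′ a″ = - 1# , -x≢0 1≢0 , solveVec
        (λ a l a′ l′ a″ m → (S.p₃ a l a′) S.⊙ (S.p₄ᵛ (S.cross true (a ∷ l ∷ a′ ∷ l′ ∷ a″ ∷ []) m)) ,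
           (:- :1) S.· S.p₅ a l a′ l′ a″)
        (a ∷ l ∷ a′ ∷ l′ ∷ a″ ∷ m ∷ []) refl
    across-product p pt (suc m) zero s≢s′ =
      let μ , μ≢0 , eq = across-product p pt zero (suc m) (s≢s′ ∘ sym)
      in - μ , -x≢0 μ≢0 , swap (across p zero) p (across p (suc m))
           (across-point {p} pt zero) pt (across-point {p} pt (suc m)) eq
    across-product p pt (suc m) (suc n) s≢s′ with point-view p pt
    ... | pt₀ = m - n , (λ eq → s≢s′ (cong suc (x-y≡0⇒x≡y eq))) , solveVec
        (λ m n → (S.p₂ m :0) S.⊙ (S.p₂ n :0) , (m :+ :- n) S.· S.p₀) (m ∷ n ∷ []) refl
    ... | pt₁ a = m - n , (λ eq → s≢s′ (cong suc (x-y≡0⇒x≡y eq))) , solveVec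
        (λ a m n → (S.p₃ a m :0) S.⊙ (S.p₃ a n :0) , (m :+ :- n) S.· S.p₁ a) (a ∷ m ∷ n ∷ []) refl
    ... | pt₂ k b = n - m , (λ eq → s≢s′ (sym (cong suc (x-y≡0⇒x≡y eq)))) , solveVec
        (λ k b m n → (S.p₄ k b m :0) S.⊙ (S.p₄ k b n :0) , (n :+ :- m) S.· S.p₂ k b) (k ∷ b ∷ m ∷ n ∷ []) refl
    ... | pt₃ a l a′ = n - m , (λ eq → s≢s′ (sym (cong suc (x-y≡0⇒x≡y eq)))) , solveVec
        (λ a l a′ m n → (S.p₅ a l a′ m :0) S.⊙ (S.p₅ a l a′ n :0) , (n :+ :- m) S.· S.p₃ a l a′)
        (a ∷ l ∷ a′ ∷ m ∷ n ∷ []) refl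
    ... | pt₄ k b k′ b′ = m - n , (λ eq → s≢s′ (cong suc (x-y≡0⇒x≡y eq))) , solveVec
        (λ k b k′ b′ m n → (S.p₅ᵛ (S.cross false (k ∷ b ∷ k′ ∷ b′ ∷ m ∷ []) :0)) S.⊙ (S.p₅ᵛ (S.cross false (k ∷ b ∷ k′ ∷ b′ ∷ n ∷ []) :0)) ,
           (m :+ :- n) S.· S.p₄ k b k′ b′)
        (k ∷ b ∷ k′ ∷ b′ ∷ m ∷ n ∷ []) refl
    ... | pt₅ a l a′ l′ a″ = m - n , (λ eq → s≢s′ (cong suc (x-y≡0⇒x≡y eq))) , solveVec
        (λ a l a′ l′ a″ m n → (S.p₄ᵛ (S.cross true (a ∷ l ∷ a′ ∷ l′ ∷ a″ ∷ []) m)) S.⊙ (S.p₄ᵛ (S.cross true (a ∷ l ∷ a′ ∷ l′ ∷ a″ ∷ []) n)) ,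
           (m :+ :- n) S.· S.p₅ a l a′ l′ a″)
        (a ∷ l ∷ a′ ∷ l′ ∷ a″ ∷ m ∷ n ∷ []) refl

    -- Each kind of point has a coordinate that is constantly 1 or -1, namely the one looked up.
    nonzero : ∀ p → Point p → ∀ {μ} → μ ≢ 0# → μ · vec p ≢ 𝟎
    nonzero p pt {μ} μ≢0 eq with point-view p pt
    ... | pt₀ = x*y≢0 μ≢0 1≢0 (cong (λ x → lookup x (# 1)) eq)
    ... | pt₁ a = x*y≢0 μ≢0 1≢0 (cong (λ x → lookup x (# 6)) eq)
    ... | pt₂ k b = x*y≢0 μ≢0 1≢0 (cong (λ x → lookup x (# 5)) eq)
    ... | pt₃ a l a′ = x*y≢0 μ≢0 1≢0 (cong (λ x → lookup x (# 2)) eq)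
    ... | pt₄ k b k′ b′ = x*y≢0 μ≢0 1≢0 (cong (λ x → lookup x (# 3)) eq)
    ... | pt₅ a l a′ l′ a″ = x*y≢0 μ≢0 (-x≢0 1≢0) (cong (λ x → lookup x (# 4)) eq)

    girth : ∀ u v w l → Turning Turnᵛ (u ∷ v ∷ w ∷ l ++ u ∷ v ∷ []) → 12 ≤ 3 ℕ.+ length l
    girth = HexagonGirth.hexagon-girth D hexagon-cross vec _⊙_ bilinear linear null null₂ nonzero across-product swap alternative

-- Frobenius maps in characteristic p

module FrobeniusMaps where

  open import Data.Nat.Combinatorics using (_C_; nCn≡1; nCk≡n!/k![n-k]!; k![n∸k]!∣n!)
  open import Data.Nat.Base using (_!)
  open import Data.Nat.DivMod using (m/n*n≡m)
  open import Data.Nat.Divisibility using (_∣_; _∤_; divides; m∣m*n; ∣⇒≤)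
  open import Data.Nat.Primality using (Prime; euclidsLemma; prime⇒nonZero; prime⇒nonTrivial)
  open import Data.Nat.Coprimality using (prime⇒coprime; coprime-Bézout)
  open import Data.Nat.GCD using (module Bézout)
  open import Relation.Binary.PropositionalEquality as ≡ using (_≡_; _≢_)

  prime∤! : ∀ {p} → Prime p → ∀ m → m < p → p ∤ m !
  prime∤! pr zero    m<p p∣1 = ℕₚ.<⇒≱ (ℕ.nonTrivial⇒n>1 _ {{prime⇒nonTrivial pr}}) (∣⇒≤ p∣1)
  prime∤! pr (suc m) m<p p∣! with euclidsLemma (suc m) (m !) pr p∣!
  ... | inj₁ p∣m = ℕₚ.<⇒≱ m<p (∣⇒≤ p∣m)
  ... | inj₂ p∣! = prime∤! pr m (ℕₚ.<-trans (ℕₚ.n<1+n m) m<p) p∣!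

  -- The prime `p` divides `p ! = (p C k) * (k ! * (p ∸ k) !)`, but neither of the two factorials,
  -- whose factors are all smaller than `p`.
  prime∣C : ∀ {p} → Prime p → ∀ k → 0 < k → k < p → p ∣ p C k
  prime∣C {p@(suc p′)} pr k 0<k k<p with euclidsLemma (p C k) (k ! ℕ.* (p ℕ.∸ k) !) pr p∣product
    where
    instance
      _ = ℕₚ.m*n≢0 (k !) ((p ℕ.∸ k) !) {{ℕₚ._!≢0 k}} {{ℕₚ._!≢0 (p ℕ.∸ k)}}
    p∣product : p ∣ (p C k) ℕ.* (k ! ℕ.* (p ℕ.∸ k) !)
    p∣product = ≡.subst (p ∣_)
      (≡.sym (≡.trans (≡.cong (ℕ._* (k ! ℕ.* (p ℕ.∸ k) !)) (nCk≡n!/k![n-k]! (ℕₚ.<⇒≤ k<p))) (m/n*n≡m (k![n∸k]!∣n! (ℕₚ.<⇒≤ k<p)))))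
      (m∣m*n (p′ !))
  ... | inj₁ p∣C = p∣C
  ... | inj₂ p∣ with euclidsLemma (k !) ((p ℕ.∸ k) !) pr p∣
  ...   | inj₁ p∣k! = contradiction p∣k! (prime∤! pr k k<p)
  ...   | inj₂ p∣! = contradiction p∣! (prime∤! pr (p ℕ.∸ k) (ℕₚ.∸-monoʳ-< 0<k (ℕₚ.<⇒≤ k<p)))

  module Characteristic (R : CommutativeRing 0ℓ 0ℓ) {p : ℕ} (p-prime : Prime p) where
    open CommutativeRing R hiding (zero)
    open import Algebra.Properties.Semiring.Exp semiring
    open import Algebra.Properties.CommutativeSemiring.Exp commutativeSemiring using (^-distrib-*)
    open import Algebra.Properties.CommutativeSemiring.Binomial commutativeSemiring using (theorem; binomialTerm)
    open import Algebra.Properties.Semiring.Mult semiring renaming (_×_ to _×′_)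
    open import Algebra.Properties.Semiring.Sum semiring using (sum; sum-init-last; sum-cong-≋; sum-replicate-zero)
    open import Relation.Binary.Reasoning.Setoid setoid

    1^ : ∀ n → 1# ^ n ≈ 1#
    1^ zero    = refl
    1^ (suc n) = trans (*-identityˡ _) (1^ n)

    module _ (p≈0 : p ×′ 1# ≈ 0#) where

      p∣⇒×≈0 : ∀ {n} → p ∣ n → ∀ x → n ×′ x ≈ 0#
      p∣⇒×≈0 (divides m ≡.refl) x = begin
        (m ℕ.* p) ×′ x  ≈⟨ ×-assocˡ x m p ⟨
        m ×′ (p ×′ x)  ≈⟨ ×-congʳ m (×-congʳ p (*-identityˡ x)) ⟨
        m ×′ (p ×′ (1# * x))  ≈⟨ ×-congʳ m (×-assoc-* p 1# x) ⟨
        m ×′ (p ×′ 1# * x)  ≈⟨ ×-congʳ m (*-congʳ p≈0) ⟩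
        m ×′ (0# * x)  ≈⟨ ×-assoc-* m 0# x ⟨
        m ×′ 0# * x  ≈⟨ *-congʳ (zero× m) ⟩
        0# * x  ≈⟨ zeroˡ x ⟩
        0#  ∎
        where
        zero× : ∀ m → m ×′ 0# ≈ 0#
        zero× zero    = refl
        zero× (suc m) = trans (+-identityˡ _) (zero× m)

      frobenius-+ : ∀ x y → (x + y) ^ p ≈ x ^ p + y ^ p
      frobenius-+ x y = lemma p ≡.refl
        where
        -- The exponent becomes a variable equal to `p`, so that it can be split as a successor
        -- without disturbing `p-prime`.
        lemma : ∀ n → n ≡ p → (x + y) ^ n ≈ x ^ n + y ^ n
        lemma zero    ≡.refl = contradiction p-prime λ ()
        lemma (suc n) eq = begin
          (x + y) ^ suc n
            ≈⟨ theorem (suc n) x y ⟩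
          t zero + sum (t ∘ suc)
            ≈⟨ +-cong t₀ (sum-init-last (t ∘ suc)) ⟩
          y ^ suc n + (sum (λ i → t (suc (inject₁ i))) + t (suc (fromℕ n)))
            ≈⟨ +-congˡ (+-cong (trans (sum-cong-≋ middle) (sum-replicate-zero n)) tₙ) ⟩
          y ^ suc n + (0# + x ^ suc n)
            ≈⟨ +-congˡ (+-identityˡ _) ⟩
          y ^ suc n + x ^ suc n
            ≈⟨ +-comm _ _ ⟩
          x ^ suc n + y ^ suc n ∎
          where
          t : Fin (suc (suc n)) → Carrier
          t = binomialTerm x y (suc n)
          t₀ : t zero ≈ y ^ suc n
          t₀ = trans (×-homo-1 _) (*-identityˡ _)
          tₙ : t (suc (fromℕ n)) ≈ x ^ suc n
          tₙ = begin
            (suc n C suc (toℕ (fromℕ n))) ×′ (x ^ suc (toℕ (fromℕ n)) * y ^ (n ℕ.∸ toℕ (fromℕ n)))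
              ≡⟨ ≡.cong (λ m → (suc n C suc m) ×′ (x ^ suc m * y ^ (n ℕ.∸ m))) (Finₚ.toℕ-fromℕ n) ⟩
            (suc n C suc n) ×′ (x ^ suc n * y ^ (n ℕ.∸ n))
              ≡⟨ ≡.cong₂ (λ m k → m ×′ (x ^ suc n * y ^ k)) (nCn≡1 (suc n)) (ℕₚ.n∸n≡0 n) ⟩
            1 ×′ (x ^ suc n * 1#)
              ≈⟨ trans (×-homo-1 _) (*-identityʳ _) ⟩
            x ^ suc n ∎
          middle : ∀ i → t (suc (inject₁ i)) ≈ 0#
          middle i = p∣⇒×≈0 (≡.subst (_∣ (suc n C toℕ (suc (inject₁ i)))) eq
            (≡.subst (λ m → m ∣ (m C toℕ (suc (inject₁ i)))) (≡.sym eq)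
              (prime∣C p-prime _ (s≤s z≤n) (≡.subst (toℕ (suc (inject₁ i)) <_) eq (s≤s (≡.subst (_< n) (≡.sym (Finₚ.toℕ-inject₁ i)) (Finₚ.toℕ<n i))))))) _

      frob : ℕ → Carrier → Carrier
      frob j x = x ^ (p ℕ.^ j)

      frob-suc : ∀ j x → frob (suc j) x ≈ frob j x ^ p
      frob-suc j x = sym (trans (^-assocʳ x (p ℕ.^ j) p) (^-congʳ x (ℕₚ.*-comm (p ℕ.^ j) p)))

      frob-cong : ∀ j {x y} → x ≈ y → frob j x ≈ frob j y
      frob-cong j = ^-congˡ (p ℕ.^ j)

      frob-+ : ∀ j x y → frob j (x + y) ≈ frob j x + frob j y
      frob-+ zero    x y = trans (*-identityʳ _) (sym (+-cong (*-identityʳ x) (*-identityʳ y)))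
      frob-+ (suc j) x y = begin
        frob (suc j) (x + y)  ≈⟨ frob-suc j (x + y) ⟩
        frob j (x + y) ^ p  ≈⟨ ^-congˡ p (frob-+ j x y) ⟩
        (frob j x + frob j y) ^ p  ≈⟨ frobenius-+ _ _ ⟩
        frob j x ^ p + frob j y ^ p  ≈⟨ +-cong (frob-suc j x) (frob-suc j y) ⟨
        frob (suc j) x + frob (suc j) y  ∎

      frob-* : ∀ j x y → frob j (x * y) ≈ frob j x * frob j y
      frob-* j x y = ^-distrib-* x y (p ℕ.^ j)

      frob-1 : ∀ j → frob j 1# ≈ 1#
      frob-1 j = 1^ (p ℕ.^ j)

      frob-0 : ∀ j → frob j 0# ≈ 0#
      frob-0 j = lemma (p ℕ.^ j) (ℕ.≢-nonZero⁻¹ _ {{ℕₚ.m^n≢0 p j {{prime⇒nonZero p-prime}}}})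
        where
        lemma : ∀ m → m ≢ 0 → 0# ^ m ≈ 0#
        lemma zero    m≢0 = contradiction ≡.refl m≢0
        lemma (suc m) _   = zeroˡ _

      frob-neg : ∀ j x → frob j (- x) ≈ - frob j x
      frob-neg j x = begin
        frob j (- x)  ≈⟨ +-identityʳ _ ⟨
        frob j (- x) + 0#  ≈⟨ +-congˡ (-‿inverseʳ (frob j x)) ⟨
        frob j (- x) + (frob j x - frob j x)  ≈⟨ +-assoc _ _ _ ⟨
        frob j (- x) + frob j x - frob j x  ≈⟨ +-congʳ (frob-+ j (- x) x) ⟨
        frob j (- x + x) - frob j x  ≈⟨ +-congʳ (trans (frob-cong j (-‿inverseˡ x)) (frob-0 j)) ⟩
        0# - frob j x  ≈⟨ +-identityˡ _ ⟩
        - frob j x  ∎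

      frob-× : ∀ j n → frob j (n ×′ 1#) ≈ n ×′ 1#
      frob-× j zero    = frob-0 j
      frob-× j (suc n) = trans (frob-+ j 1# (n ×′ 1#)) (+-cong (frob-1 j) (frob-× j n))

      frob-frob : ∀ i j x → frob i (frob j x) ≈ frob (i ℕ.+ j) x
      frob-frob i j x = trans (^-assocʳ x (p ℕ.^ j) (p ℕ.^ i))
        (^-congʳ x (≡.trans (≡.sym (ℕₚ.^-distribˡ-+-* p j i)) (≡.cong (p ℕ.^_) (ℕₚ.+-comm j i))))

      bézout⇒1≈0 : ∀ x y {m n} → m ×′ 1# ≈ 0# → n ×′ 1# ≈ 0# → 1 ℕ.+ y ℕ.* n ≡ x ℕ.* m → 1# ≈ 0#
      bézout⇒1≈0 x y {m} {n} m≈0 n≈0 eq = begin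
        1#  ≈⟨ +-identityʳ 1# ⟨
        1# + 0#  ≈⟨ +-congˡ (trans (*-congˡ n≈0) (zeroʳ _)) ⟨
        1# + y ×′ 1# * (n ×′ 1#)  ≈⟨ +-congˡ (×1-homo-* y n) ⟨
        (1 ℕ.+ y ℕ.* n) ×′ 1#  ≡⟨ ≡.cong (_×′ 1#) eq ⟩
        (x ℕ.* m) ×′ 1#  ≈⟨ ×1-homo-* x m ⟩
        x ×′ 1# * (m ×′ 1#)  ≈⟨ trans (*-congˡ m≈0) (zeroʳ _) ⟩
        0#  ∎

      -- Bézout's identity for the coprime numbers `t` and `p`, read in a ring where both vanish.
      ×≈0⇒1≈0 : ∀ {t} .{{_ : NonZero t}} → t < p → t ×′ 1# ≈ 0# → 1# ≈ 0#
      ×≈0⇒1≈0 {t} t<p t≈0 with coprime-Bézout (prime⇒coprime p-prime t<p)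
      ... | Bézout.+- x y eq = bézout⇒1≈0 x y p≈0 t≈0 eq
      ... | Bézout.-+ x y eq = bézout⇒1≈0 y x t≈0 p≈0 eq

      ×-injective : ¬ 1# ≈ 0# → ∀ {m n} → m < p → n < p → m ×′ 1# ≈ n ×′ 1# → m ≡ n
      ×-injective 1≉0 {zero}  {zero}  _ _ _ = ≡.refl
      ×-injective 1≉0 {suc m} {zero}  m<p _ eq = contradiction (×≈0⇒1≈0 m<p eq) 1≉0
      ×-injective 1≉0 {zero}  {suc n} _ n<p eq = contradiction (×≈0⇒1≈0 n<p (sym eq)) 1≉0
      ×-injective 1≉0 {suc m} {suc n} m<p n<p eq = ≡.cong suc
        (×-injective 1≉0 (ℕₚ.<-trans (ℕₚ.n<1+n m) m<p) (ℕₚ.<-trans (ℕₚ.n<1+n n) n<p) (∙-cancelˡ 1# _ _ eq))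
        where open import Algebra.Properties.Group +-group using (∙-cancelˡ)

-- Roots in a domain and the fixed points of a Frobenius power

open import Data.Integer as ℤ using (+_; ℤ)
import Data.Integer.DivMod as ℤDM
open import Data.Integer.Divisibility.Signed using (_∣_; divides; _∣?_; ∣⇒∣ᵤ; ∣m∣n⇒∣m+n; ∣n⇒∣m*n)
import Data.Integer.Properties as ℤₚ
open import Data.List using (List; []; _∷_; _∷ʳ_; map; length; cartesianProductWith; initLast; _∷ʳ′_; replicate; upTo; _++_)
open import Data.List.Membership.Propositional using (lose)
open import Data.List.Membership.Propositional.Properties using (∈-map⁺; ∈-upTo⁺)
import Data.List.Properties as Listₚ
open import Data.List.Relation.Unary.Any as Any using (Any; here; there)
import Data.List.Relation.Unary.Any.Properties as Anyₚ
open import Data.Nat.Divisibility as ℕ∣ using () renaming (_∣_ to _∣ⁿ_; _∣?_ to _∣?ⁿ_)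
open import Data.Nat.Primality using (Prime; prime⇒nonZero; prime⇒nonTrivial)
open import Data.Vec using (Vec; []; _∷_; tabulate)
open import Data.Vec.Relation.Unary.All as All using (All; []; _∷_)
open import Data.Vec.Relation.Unary.All.Properties using (tabulate⁻; tabulate⁺)
open import Function using (mk⇔)
open import Relation.Binary.Definitions using (tri<; tri≈; tri>)
open import Relation.Binary.PropositionalEquality as ≡ using (_≡_; _≢_; _≗_)
open import Relation.Nullary.Decidable using (map′; dec-true; dec-false; does-⇔)
open FrobeniusMaps
open Representations using (FiniteDomain)

funToFin-cong : ∀ {m n} {f g : Fin m → Fin n} → f ≗ g → Fin.funToFin f ≡ Fin.funToFin g
funToFin-cong {zero}  f≗g = ≡.refl
funToFin-cong {suc m} f≗g = ≡.cong₂ Fin.combine (f≗g zero) (funToFin-cong (f≗g ∘ suc))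

Integral : CommutativeRing 0ℓ 0ℓ → Set
Integral R = ∀ x y → x * y ≈ 0# → x ≈ 0# ⊎ y ≈ 0#
  where open CommutativeRing R

module RootCounting (R : CommutativeRing 0ℓ 0ℓ) (integral : Integral R) where
  open CommutativeRing R hiding (zero)
  open import Relation.Binary.Reasoning.Setoid setoid
  open import Algebra.Properties.Semiring.Exp semiring
  open import Algebra.Properties.Group +-group using () renaming (x∙y⁻¹≈ε⇒x≈y to x-y≈0⇒x≈y)
  open import Algebra.Properties.Ring ring using (-0#≈0#)
  open IntegerSolver R using (solve; _:+_; _:*_; :-_; _:=_; con)

  eval : ∀ {n} → Vec Carrier n → Carrier → Carrier
  eval []      r = 0#
  eval (c ∷ f) r = c + r * eval f r

  -- Horner's scheme with the lowest coefficient first: the quotient of `f - eval f r` by `T - r`.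
  quotient : ∀ {n} → Vec Carrier (suc n) → Carrier → Vec Carrier n
  quotient (c ∷ [])        r = []
  quotient (c ∷ f@(_ ∷ _)) r = eval f r ∷ quotient f r

  factor : ∀ {n} (f : Vec Carrier (suc n)) r x → eval f x - eval f r ≈ (x - r) * eval (quotient f r) x
  factor (c ∷ []) r x = begin
    c + x * 0# - (c + r * 0#)  ≈⟨ +-cong (+-congˡ (zeroʳ x)) (-‿cong (+-congˡ (zeroʳ r))) ⟩
    c + 0# - (c + 0#)  ≈⟨ -‿inverseʳ _ ⟩
    0#  ≈⟨ zeroʳ _ ⟨
    (x - r) * 0#  ∎
  factor (c ∷ f@(_ ∷ _)) r x = begin
    c + x * eval f x - (c + r * eval f r)
      ≈⟨ lemma c x r (eval f x) (eval f r) ⟩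
    (x - r) * eval f r + x * (eval f x - eval f r)
      ≈⟨ +-congˡ (*-congˡ (factor f r x)) ⟩
    (x - r) * eval f r + x * ((x - r) * eval (quotient f r) x)
      ≈⟨ lemma′ x r (eval f r) (eval (quotient f r) x) ⟩
    (x - r) * (eval f r + x * eval (quotient f r) x) ∎
    where
    lemma : ∀ c x r a b → c + x * a - (c + r * b) ≈ (x - r) * b + x * (a - b)
    lemma = solve 5 (λ c x r a b → c :+ x :* a :+ :- (c :+ r :* b) := (x :+ :- r) :* b :+ x :* (a :+ :- b)) refl
    lemma′ : ∀ x r a b → (x - r) * a + x * ((x - r) * b) ≈ (x - r) * (a + x * b)
    lemma′ = solve 4 (λ x r a b → (x :+ :- r) :* a :+ x :* ((x :+ :- r) :* b) := (x :+ :- r) :* (a :+ x :* b)) refl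

  quotient-zero : ∀ {n} (f : Vec Carrier (suc n)) r → eval f r ≈ 0# → All (_≈ 0#) (quotient f r) → All (_≈ 0#) f
  quotient-zero (c ∷ []) r root [] = trans (sym (trans (+-congˡ (zeroʳ r)) (+-identityʳ c))) root ∷ []
  quotient-zero (c ∷ f@(_ ∷ _)) r root (fr≈0 ∷ q≈0) =
    trans (sym (trans (+-congˡ (trans (*-congˡ fr≈0) (zeroʳ r))) (+-identityʳ c))) root ∷ quotient-zero f r fr≈0 q≈0

  -- Dividing by `T - r` shortens the polynomial by one coefficient and, in a domain, keeps the
  -- other roots.
  roots⇒zero : ∀ {n} (f : Vec Carrier n) (r : Fin n → Carrier) → (∀ i j → i ≢ j → ¬ r i ≈ r j) →
    (∀ i → eval f (r i) ≈ 0#) → All (_≈ 0#) f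
  roots⇒zero {zero}  []  r distinct root = []
  roots⇒zero {suc n} f   r distinct root = quotient-zero f (r zero) (root zero)
    (roots⇒zero (quotient f (r zero)) (r ∘ suc) (λ i j i≢j → distinct (suc i) (suc j) (i≢j ∘ Finₚ.suc-injective)) root′)
    where
    root′ : ∀ i → eval (quotient f (r zero)) (r (suc i)) ≈ 0#
    root′ i with integral _ _ (trans (sym (factor f (r zero) (r (suc i))))
                   (trans (+-cong (root (suc i)) (trans (-‿cong (root zero)) -0#≈0#)) (+-identityʳ 0#)))
    ... | inj₁ eq = contradiction (x-y≈0⇒x≈y _ _ eq) (distinct (suc i) zero λ ())
    ... | inj₂ eq = eq

  power : ∀ n → Vec Carrier (suc n)
  power zero    = 1# ∷ []
  power (suc n) = 0# ∷ power n

  eval-power : ∀ n r → eval (power n) r ≈ r ^ n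
  eval-power zero    r = trans (+-congˡ (zeroʳ r)) (+-identityʳ 1#)
  eval-power (suc n) r = trans (+-identityˡ _) (*-congˡ (eval-power n r))

  power-zero : ∀ n → All (_≈ 0#) (power n) → 1# ≈ 0#
  power-zero zero    (1≈0 ∷ []) = 1≈0
  power-zero (suc n) (_ ∷ all)  = power-zero n all

  private
    Xq-X : ∀ x y → 0# + x * (- 1# + x * y) ≈ x * (x * y) - x
    Xq-X = solve 2 (λ x y → con (+ 0) :+ x :* (:- con (+ 1) :+ x :* y) := x :* (x :* y) :+ :- x) refl

  few-roots : ¬ 1# ≈ 0# → ∀ q → 2 ≤ q → (r : Fin (suc q) → Carrier) → (∀ i j → i ≢ j → ¬ r i ≈ r j) → ¬ (∀ i → r i ^ q ≈ r i)
  few-roots 1≉0 (suc (suc m)) (s≤s (s≤s z≤n)) r distinct root =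
    -- The coefficient list is that of `T ^ q - T`: with `q = m + 2` it has `q + 1` entries, as many
    -- as there are roots, so all of them would vanish, including the leading 1.
    1≉0 (power-zero m (All.tail (All.tail (roots⇒zero (0# ∷ - 1# ∷ power m) r distinct root′))))
    where
    root′ : ∀ i → eval (0# ∷ - 1# ∷ power m) (r i) ≈ 0#
    root′ i = begin
      0# + r i * (- 1# + r i * eval (power m) (r i))  ≈⟨ Xq-X (r i) (eval (power m) (r i)) ⟩
      r i * (r i * eval (power m) (r i)) - r i  ≈⟨ +-congʳ (*-congˡ (*-congˡ (eval-power m (r i)))) ⟩
      r i ^ suc (suc m) - r i  ≈⟨ +-congʳ (root i) ⟩
      r i - r i  ≈⟨ -‿inverseʳ (r i) ⟩
      0#  ∎

module Subring (R : CommutativeRing 0ℓ 0ℓ) (integral : Integral R)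
  (1≉0 : ¬ CommutativeRing._≈_ R (CommutativeRing.1# R) (CommutativeRing.0# R)) where
  open CommutativeRing R hiding (zero)

  module _ {q : ℕ} (ι : Fin q → Carrier) (ι-injective : ∀ {a b} → ι a ≈ ι b → a ≡ b)
    (+-index : ∀ a b → ∃[ c ] ι c ≈ ι a + ι b) (*-index : ∀ a b → ∃[ c ] ι c ≈ ι a * ι b)
    (neg-index : ∀ a → ∃[ c ] ι c ≈ - ι a) (0-index : ∃[ c ] ι c ≈ 0#) (1-index : ∃[ c ] ι c ≈ 1#) where

    private
      _⊕_ _⊗_ : Fin q → Fin q → Fin q
      a ⊕ b = proj₁ (+-index a b)
      a ⊗ b = proj₁ (*-index a b)
      ⊖_ : Fin q → Fin q
      ⊖ a = proj₁ (neg-index a)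
      𝟘 𝟙 : Fin q
      𝟘 = proj₁ 0-index
      𝟙 = proj₁ 1-index
      ⊕-ι : ∀ a b → ι (a ⊕ b) ≈ ι a + ι b
      ⊕-ι a b = proj₂ (+-index a b)
      ⊗-ι : ∀ a b → ι (a ⊗ b) ≈ ι a * ι b
      ⊗-ι a b = proj₂ (*-index a b)
      ⊖-ι : ∀ a → ι (⊖ a) ≈ - ι a
      ⊖-ι a = proj₂ (neg-index a)
      𝟘-ι : ι 𝟘 ≈ 0#
      𝟘-ι = proj₂ 0-index
      𝟙-ι : ι 𝟙 ≈ 1#
      𝟙-ι = proj₂ 1-index
      integral′ : ∀ a b → a ⊗ b ≡ 𝟘 → a ≡ 𝟘 ⊎ b ≡ 𝟘
      integral′ a b eq with integral (ι a) (ι b) (trans (sym (⊗-ι a b)) (trans (reflexive (≡.cong ι eq)) 𝟘-ι))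
      ... | inj₁ a≈0 = inj₁ (ι-injective (trans a≈0 (sym 𝟘-ι)))
      ... | inj₂ b≈0 = inj₂ (ι-injective (trans b≈0 (sym 𝟘-ι)))

    -- The ring laws are pulled back along `ι`, whose injectivity turns the equality of `R` into
    -- propositional equality on `Fin q`.
    finiteDomain : FiniteDomain q
    finiteDomain = record
      { _+_ = _⊕_
      ; _*_ = _⊗_
      ; -_  = ⊖_
      ; 0#  = 𝟘
      ; 1#  = 𝟙
      ; isCommutativeRing = record
        { isRing = record
          { +-isAbelianGroup = record
            { isGroup = record
              { isMonoid = record
                { isSemigroup = record
                  { isMagma = record { isEquivalence = ≡.isEquivalence ; ∙-cong = ≡.cong₂ _⊕_ }
                  ; assoc   = λ a b c → ι-injective (trans (⊕-ι _ c) (trans (+-congʳ (⊕-ι a b))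
                                (trans (+-assoc _ _ _) (sym (trans (⊕-ι a _) (+-congˡ (⊕-ι b c)))))))
                  }
                ; identity = (λ a → ι-injective (trans (⊕-ι 𝟘 a) (trans (+-congʳ 𝟘-ι) (+-identityˡ _))))
                           , (λ a → ι-injective (trans (⊕-ι a 𝟘) (trans (+-congˡ 𝟘-ι) (+-identityʳ _))))
                }
              ; inverse = (λ a → ι-injective (trans (⊕-ι _ a) (trans (+-congʳ (⊖-ι a)) (trans (-‿inverseˡ _) (sym 𝟘-ι)))))
                        , (λ a → ι-injective (trans (⊕-ι a _) (trans (+-congˡ (⊖-ι a)) (trans (-‿inverseʳ _) (sym 𝟘-ι)))))
              ; ⁻¹-cong = ≡.cong ⊖_
              }
            ; comm = λ a b → ι-injective (trans (⊕-ι a b) (trans (+-comm _ _) (sym (⊕-ι b a))))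
            }
          ; *-cong     = ≡.cong₂ _⊗_
          ; *-assoc    = λ a b c → ι-injective (trans (⊗-ι _ c) (trans (*-congʳ (⊗-ι a b))
                           (trans (*-assoc _ _ _) (sym (trans (⊗-ι a _) (*-congˡ (⊗-ι b c)))))))
          ; *-identity = (λ a → ι-injective (trans (⊗-ι 𝟙 a) (trans (*-congʳ 𝟙-ι) (*-identityˡ _))))
                       , (λ a → ι-injective (trans (⊗-ι a 𝟙) (trans (*-congˡ 𝟙-ι) (*-identityʳ _))))
          ; distrib    = (λ a b c → ι-injective (trans (⊗-ι a _) (trans (*-congˡ (⊕-ι b c)) (trans (distribˡ _ _ _)
                           (sym (trans (⊕-ι _ _) (+-cong (⊗-ι a b) (⊗-ι a c))))))))
                       , (λ a b c → ι-injective (trans (⊗-ι _ a) (trans (*-congʳ (⊕-ι b c)) (trans (distribʳ _ _ _)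
                           (sym (trans (⊕-ι _ _) (+-cong (⊗-ι b a) (⊗-ι c a))))))))
          }
        ; *-comm = λ a b → ι-injective (trans (⊗-ι a b) (trans (*-comm _ _) (sym (⊗-ι b a))))
        }
      ; 1≢0 = λ eq → 1≉0 (trans (sym 𝟙-ι) (trans (reflexive (≡.cong ι eq)) 𝟘-ι))
      ; integral = integral′
      }

module FixedField (R : CommutativeRing 0ℓ 0ℓ) (integral : Integral R)
  (_≈?_ : ∀ x y → Dec (CommutativeRing._≈_ R x y))
  (1≉0 : ¬ CommutativeRing._≈_ R (CommutativeRing.1# R) (CommutativeRing.0# R))
  {p : ℕ} (p-prime : Prime p) where
  open CommutativeRing R hiding (zero)
  open RootCounting R integral
  open Characteristic R p-prime
  open import Relation.Binary.Reasoning.Setoid setoid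
  open import Algebra.Properties.Semiring.Exp semiring using (_^_)
  open import Algebra.Properties.Semiring.Mult semiring using () renaming (_×_ to _×′_)
  open import Algebra.Properties.Group +-group using () renaming (x∙y⁻¹≈ε⇒x≈y to x-y≈0⇒x≈y)
  open IntegerSolver R using (solve; _:+_; _:*_; :-_; _:=_)

  module _ (p≈0 : p ×′ 1# ≈ 0#) (k : ℕ) (1≤k : 1 ≤ k) (x : Carrier) (x-fixed : frob p≈0 k x ≈ x)
    (x-moved : ∀ j → 0 < j → j < k → ¬ frob p≈0 j x ≈ x) where

    private
      φ : ℕ → Carrier → Carrier
      φ = frob p≈0

    q : ℕ
    q = p ℕ.^ k

    Fixed : Carrier → Set
    Fixed r = φ k r ≈ r

    -- Applying `φ (k ∸ i)` to both sides turns the left one into `x` and the right one into the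
    -- conjugate with index `j ∸ i`, which lies strictly between 0 and `k`.
    conjugates-distinct : ∀ i j → i < j → j < k → ¬ φ i x ≈ φ j x
    conjugates-distinct i j i<j j<k eq = x-moved (j ℕ.∸ i) (ℕₚ.m<n⇒0<n∸m i<j) (ℕₚ.≤-<-trans (ℕₚ.m∸n≤m j i) j<k) (begin
      φ (j ℕ.∸ i) x  ≈⟨ frob-cong p≈0 (j ℕ.∸ i) x-fixed ⟨
      φ (j ℕ.∸ i) (φ k x)  ≈⟨ frob-frob p≈0 (j ℕ.∸ i) k x ⟩
      φ (j ℕ.∸ i ℕ.+ k) x  ≡⟨ ≡.cong (λ m → φ m x) index ⟩
      φ (k ℕ.∸ i ℕ.+ j) x  ≈⟨ frob-frob p≈0 (k ℕ.∸ i) j x ⟨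
      φ (k ℕ.∸ i) (φ j x)  ≈⟨ frob-cong p≈0 (k ℕ.∸ i) eq ⟨
      φ (k ℕ.∸ i) (φ i x)  ≈⟨ frob-frob p≈0 (k ℕ.∸ i) i x ⟩
      φ (k ℕ.∸ i ℕ.+ i) x  ≡⟨ ≡.cong (λ m → φ m x) (ℕₚ.m∸n+n≡m (ℕₚ.<⇒≤ (ℕₚ.<-trans i<j j<k))) ⟩
      φ k x  ≈⟨ x-fixed ⟩
      x  ∎)
      where
      index : j ℕ.∸ i ℕ.+ k ≡ k ℕ.∸ i ℕ.+ j
      index = ≡.trans (ℕₚ.+-comm (j ℕ.∸ i) k) (≡.trans (≡.sym (ℕₚ.+-∸-assoc k (ℕₚ.<⇒≤ i<j)))
        (≡.trans (ℕₚ.+-∸-comm j (ℕₚ.<⇒≤ (ℕₚ.<-trans i<j j<k))) ≡.refl))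

    conjugates : Fin k → Carrier
    conjugates i = φ (toℕ i) x

    conjugates-≉ : ∀ i j → i ≢ j → ¬ conjugates i ≈ conjugates j
    conjugates-≉ i j i≢j eq with ℕₚ.<-cmp (toℕ i) (toℕ j)
    ... | tri< i<j _ _ = conjugates-distinct _ _ i<j (Finₚ.toℕ<n j) eq
    ... | tri≈ _ i≡j _ = i≢j (Finₚ.toℕ-injective i≡j)
    ... | tri> _ _ j<i = conjugates-distinct _ _ j<i (Finₚ.toℕ<n i) (sym eq)

    frob-eval : ∀ j {n} (f : Vec Carrier n) r → All (λ c → φ j c ≈ c) f → φ j (eval f r) ≈ eval f (φ j r)
    frob-eval j []      r []       = frob-0 p≈0 j
    frob-eval j (c ∷ f) r (fix ∷ fixes) = trans (frob-+ p≈0 j _ _)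
      (+-cong fix (trans (frob-* p≈0 j _ _) (*-congˡ (frob-eval j f r fixes))))

    digit : Fin q → Fin k → Carrier
    digit a j = toℕ (Fin.finToFun {p} {k} a j) ×′ 1#

    digit-fixed : ∀ i a j → φ i (digit a j) ≈ digit a j
    digit-fixed i a j = frob-× p≈0 i (toℕ (Fin.finToFun {p} {k} a j))

    -- The `k` digits of the index in base `p` serve as the coefficients of a polynomial of degree
    -- below `k` over the prime field.
    ι : Fin q → Carrier
    ι a = eval (tabulate (digit a)) x

    ι-fixed : ∀ a → Fixed (ι a)
    ι-fixed a = trans (frob-eval k (tabulate (digit a)) x (tabulate⁺ (digit-fixed k a))) (eval-cong (tabulate (digit a)) x-fixed)
      where
      eval-cong : ∀ {n} (f : Vec Carrier n) {r s} → r ≈ s → eval f r ≈ eval f s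
      eval-cong []      r≈s = refl
      eval-cong (c ∷ f) r≈s = +-congˡ (*-cong r≈s (eval-cong f r≈s))

    eval-diff : ∀ {n} (f g : Fin n → Carrier) r →
      eval (tabulate (λ j → f j - g j)) r ≈ eval (tabulate f) r - eval (tabulate g) r
    eval-diff {zero}  f g r = sym (-‿inverseʳ 0#)
    eval-diff {suc n} f g r = trans (+-congˡ (*-congˡ (eval-diff (f ∘ suc) (g ∘ suc) r))) (lemma _ _ _ _ _)
      where
      lemma : ∀ a b r c d → a - b + r * (c - d) ≈ a + r * c - (b + r * d)
      lemma = solve 5 (λ a b r c d → a :+ :- b :+ r :* (c :+ :- d) := a :+ r :* c :+ :- (b :+ r :* d)) refl

    -- A polynomial of degree < k over the prime field that vanishes at x vanishes at its k conjugates.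
    ι-injective : ∀ {a b} → ι a ≈ ι b → a ≡ b
    ι-injective {a} {b} eq = ≡.trans (≡.sym (Finₚ.funToFin-finToFin {k} {p} a))
      (≡.trans (funToFin-cong digits≡) (Finₚ.funToFin-finToFin {k} {p} b))
      where
      f : Fin k → Carrier
      f j = digit a j - digit b j
      fix : ∀ i → All (λ c → φ i c ≈ c) (tabulate f)
      fix i = tabulate⁺ λ j → trans (frob-+ p≈0 i _ _)
        (+-cong (digit-fixed i a j) (trans (frob-neg p≈0 i _) (-‿cong (digit-fixed i b j))))
      vanish : eval (tabulate f) x ≈ 0#
      vanish = trans (eval-diff (digit a) (digit b) x) (trans (+-congʳ eq) (-‿inverseʳ _))
      zeros : All (_≈ 0#) (tabulate f)
      zeros = roots⇒zero (tabulate f) conjugates conjugates-≉ λ i →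
        trans (sym (frob-eval (toℕ i) (tabulate f) x (fix (toℕ i)))) (trans (frob-cong p≈0 (toℕ i) vanish) (frob-0 p≈0 (toℕ i)))
      digits≡ : Fin.finToFun {p} {k} a ≗ Fin.finToFun {p} {k} b
      digits≡ j = Finₚ.toℕ-injective (×-injective p≈0 1≉0 (Finₚ.toℕ<n (Fin.finToFun {p} {k} a j)) (Finₚ.toℕ<n (Fin.finToFun {p} {k} b j))
        (x-y≈0⇒x≈y _ _ (tabulate⁻ zeros j)))

    2≤q : 2 ≤ q
    2≤q = ℕₚ.≤-trans (ℕ.nonTrivial⇒n>1 p {{prime⇒nonTrivial p-prime}})
      (≡.subst (_≤ q) (ℕₚ.*-identityʳ p) (ℕₚ.^-monoʳ-≤ p {{prime⇒nonZero p-prime}} 1≤k))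

    -- Otherwise `r` and the `q` values of `ι` would be `q + 1` distinct roots of `T ^ q - T`.
    ι-surjective : ∀ r → Fixed r → ∃[ a ] ι a ≈ r
    ι-surjective r fixed with Finₚ.any? (λ a → ι a ≈? r)
    ... | yes found = found
    ... | no ¬found = ⊥-elim (few-roots 1≉0 q 2≤q roots distinct root)
      where
      roots : Fin (suc q) → Carrier
      roots zero    = r
      roots (suc a) = ι a
      distinct : ∀ i j → i ≢ j → ¬ roots i ≈ roots j
      distinct zero    zero    i≢j _  = i≢j ≡.refl
      distinct zero    (suc b) _   eq = ¬found (b , sym eq)
      distinct (suc a) zero    _   eq = ¬found (a , eq)
      distinct (suc a) (suc b) i≢j eq = i≢j (≡.cong suc (ι-injective eq))
      root : ∀ i → roots i ^ q ≈ roots i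
      root zero    = fixed
      root (suc a) = ι-fixed a

    -- As `φ k` is a ring homomorphism, its fixed points form a subring, and `ι-surjective` supplies
    -- the indices of sums, products and negatives.
    finiteDomain : FiniteDomain q
    finiteDomain = Subring.finiteDomain R integral 1≉0 ι ι-injective
      (λ a b → ι-surjective _ (trans (frob-+ p≈0 k _ _) (+-cong (ι-fixed a) (ι-fixed b))))
      (λ a b → ι-surjective _ (trans (frob-* p≈0 k _ _) (*-cong (ι-fixed a) (ι-fixed b))))
      (λ a → ι-surjective _ (trans (frob-neg p≈0 k _) (-‿cong (ι-fixed a))))
      (ι-surjective _ (frob-0 p≈0 k)) (ι-surjective _ (frob-1 p≈0 k))

-- Ideals, quotients, and a prime ideal of a finite ring

module IdealTheory (R : CommutativeRing 0ℓ 0ℓ) where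
  open CommutativeRing R hiding (zero)
  open import Relation.Binary.Reasoning.Setoid setoid
  open import Algebra.Properties.Ring ring using (-0#≈0#; -1*x≈-x)
  open IntegerSolver R using (solve; _:+_; _:*_; :-_; _:=_)

  record Ideal : Set₁ where
    field
      Member : Carrier → Set
      resp   : ∀ {a b} → a ≈ b → Member a → Member b
      zero∈  : Member 0#
      +∈     : ∀ {a b} → Member a → Member b → Member (a + b)
      *∈     : ∀ a {b} → Member b → Member (a * b)

    neg∈ : ∀ {a} → Member a → Member (- a)
    neg∈ {a} a∈ = resp (-1*x≈-x a) (*∈ (- 1#) a∈)

  module Quotient (I : Ideal) where
    open Ideal I

    _≈ᴵ_ : Carrier → Carrier → Set
    a ≈ᴵ b = Member (a - b)

    ≈⇒≈ᴵ : ∀ {a b} → a ≈ b → a ≈ᴵ b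
    ≈⇒≈ᴵ a≈b = resp (sym (trans (+-congʳ a≈b) (-‿inverseʳ _))) zero∈

    ≈ᴵ0⇒∈ : ∀ {a} → a ≈ᴵ 0# → Member a
    ≈ᴵ0⇒∈ = resp (trans (+-congˡ -0#≈0#) (+-identityʳ _))

    private
      trans-diff : ∀ a b c → (a - b) + (b - c) ≈ a - c
      trans-diff = solve 3 (λ a b c → (a :+ :- b) :+ (b :+ :- c) := a :+ :- c) refl
      sym-diff : ∀ a b → - (a - b) ≈ b - a
      sym-diff = solve 2 (λ a b → :- (a :+ :- b) := b :+ :- a) refl
      +-diff : ∀ a b c d → (a - b) + (c - d) ≈ (a + c) - (b + d)
      +-diff = solve 4 (λ a b c d → (a :+ :- b) :+ (c :+ :- d) := (a :+ c) :+ :- (b :+ d)) refl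
      *-diff : ∀ a b c d → c * (a - b) + b * (c - d) ≈ a * c - b * d
      *-diff = solve 4 (λ a b c d → c :* (a :+ :- b) :+ b :* (c :+ :- d) := a :* c :+ :- (b :* d)) refl
      neg-diff : ∀ a b → - (a - b) ≈ - a - - b
      neg-diff = solve 2 (λ a b → :- (a :+ :- b) := :- a :+ :- (:- b)) refl

    quotientRing : CommutativeRing 0ℓ 0ℓ
    quotientRing = record
      { Carrier = Carrier ; _≈_ = _≈ᴵ_ ; _+_ = _+_ ; _*_ = _*_ ; -_ = -_ ; 0# = 0# ; 1# = 1#
      ; isCommutativeRing = record
        { isRing = record
          { +-isAbelianGroup = record
            { isGroup = record
              { isMonoid = record
                { isSemigroup = record
                  { isMagma = record
                    { isEquivalence = record
                      { refl  = ≈⇒≈ᴵ refl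
                      ; sym   = λ {a} {b} a≈b → resp (sym-diff a b) (neg∈ a≈b)
                      ; trans = λ {a} {b} {c} a≈b b≈c → resp (trans-diff a b c) (+∈ a≈b b≈c)
                      }
                    ; ∙-cong = λ {a} {b} {c} {d} a≈b c≈d → resp (+-diff a b c d) (+∈ a≈b c≈d)
                    }
                  ; assoc = λ a b c → ≈⇒≈ᴵ (+-assoc a b c)
                  }
                ; identity = (λ a → ≈⇒≈ᴵ (+-identityˡ a)) , (λ a → ≈⇒≈ᴵ (+-identityʳ a))
                }
              ; inverse = (λ a → ≈⇒≈ᴵ (-‿inverseˡ a)) , (λ a → ≈⇒≈ᴵ (-‿inverseʳ a))
              ; ⁻¹-cong = λ {a} {b} a≈b → resp (neg-diff a b) (neg∈ a≈b)
              }
            ; comm = λ a b → ≈⇒≈ᴵ (+-comm a b)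
            }
          ; *-cong     = λ {a} {b} {c} {d} a≈b c≈d → resp (*-diff a b c d) (+∈ (*∈ c a≈b) (*∈ b c≈d))
          ; *-assoc    = λ a b c → ≈⇒≈ᴵ (*-assoc a b c)
          ; *-identity = (λ a → ≈⇒≈ᴵ (*-identityˡ a)) , (λ a → ≈⇒≈ᴵ (*-identityʳ a))
          ; distrib    = (λ a b c → ≈⇒≈ᴵ (distribˡ a b c)) , (λ a b c → ≈⇒≈ᴵ (distribʳ a b c))
          }
        ; *-comm = λ a b → ≈⇒≈ᴵ (*-comm a b)
        }
      }

  zeroIdeal : Ideal
  zeroIdeal = record
    { Member = _≈ 0#
    ; resp   = λ a≈b a≈0 → trans (sym a≈b) a≈0
    ; zero∈  = refl
    ; +∈     = λ a≈0 b≈0 → trans (+-cong a≈0 b≈0) (+-identityˡ 0#)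
    ; *∈     = λ a b≈0 → trans (*-congˡ b≈0) (zeroʳ a)
    }

  open Ideal using (Member; resp; zero∈; +∈; *∈)

  -- The ideal `I + (r)`. Membership has a single cofactor `s` as witness, so in a finite ring it is
  -- decided by a search over `s`.
  adjoin : Ideal → Carrier → Ideal
  adjoin I r = record
    { Member = λ a → ∃[ s ] Member I (a - s * r)
    ; resp   = λ a≈b (s , m) → s , resp I (+-congʳ a≈b) m
    ; zero∈  = 0# , resp I (sym (trans (+-congˡ (trans (-‿cong (zeroˡ r)) -0#≈0#)) (+-identityʳ 0#))) (zero∈ I)
    ; +∈     = λ {a} {b} (s , m) (t , n) → s + t , resp I (plus a b s t r) (+∈ I m n)
    ; *∈     = λ c {b} (s , m) → c * s , resp I (times c b s r) (*∈ I c m)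
    }
    where
    plus : ∀ a b s t r → (a - s * r) + (b - t * r) ≈ (a + b) - (s + t) * r
    plus = solve 5 (λ a b s t r → (a :+ :- (s :* r)) :+ (b :+ :- (t :* r)) := (a :+ b) :+ :- ((s :+ t) :* r)) refl
    times : ∀ c b s r → c * (b - s * r) ≈ c * b - c * s * r
    times = solve 4 (λ c b s r → c :* (b :+ :- (s :* r)) := c :* b :+ :- (c :* s :* r)) refl

  _⊆_ : Ideal → Ideal → Set
  I ⊆ J = ∀ {a} → Member I a → Member J a

  ⊆-adjoin : ∀ I r → I ⊆ adjoin I r
  ⊆-adjoin I r {a} a∈ = 0# , resp I (sym (trans (+-congˡ (trans (-‿cong (zeroˡ r)) -0#≈0#)) (+-identityʳ a))) a∈

  ∈-adjoin : ∀ I r → Member (adjoin I r) r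
  ∈-adjoin I r = 1# , resp I (sym (trans (+-congˡ (-‿cong (*-identityˡ r))) (-‿inverseʳ r))) (zero∈ I)

  adjoin-mono : ∀ {I J} r → I ⊆ J → adjoin I r ⊆ adjoin J r
  adjoin-mono r I⊆J (s , m) = s , I⊆J m

  adjoin-resp : ∀ {I r r′} → r ≈ r′ → adjoin I r ⊆ adjoin I r′
  adjoin-resp {I} r≈r′ (s , m) = s , resp I (+-congˡ (-‿cong (*-congˡ r≈r′))) m

  module Finite (elements : List Carrier) (complete : ∀ a → Any (a ≈_) elements) where

    Decidableᴵ : Ideal → Set
    Decidableᴵ I = ∀ a → Dec (Member I a)

    adjoin? : ∀ {I} → Decidableᴵ I → ∀ r → Decidableᴵ (adjoin I r)
    adjoin? {I} I? r a = map′ Any.satisfied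
      (λ (s , m) → Any.map (λ s≈t → resp I (+-congˡ (-‿cong (*-congʳ s≈t))) m) (complete s))
      (Any.any? (λ s → I? (a - s * r)) elements)

    module PrimeAvoiding {e : Carrier} (idempotent : e * e ≈ e) (e≉0 : ¬ e ≈ 0#) (_≈?_ : ∀ a b → Dec (a ≈ b)) where

      record Saturated (rs : List Carrier) (I : Ideal) : Set₁ where
        field
          ideal    : Ideal
          ideal?   : Decidableᴵ ideal
          above    : I ⊆ ideal
          avoids   : ¬ Member ideal e
          maximal  : ∀ a → Any (a ≈_) rs → Member ideal a ⊎ Member (adjoin ideal a) e

      -- A single pass suffices: the ideal only grows, and an element whose adjunction brings in `e`
      -- keeps doing so for every larger ideal.
      saturate : ∀ rs I → Decidableᴵ I → ¬ Member I e → Saturated rs I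
      saturate [] I I? e∉I = record
        { ideal = I ; ideal? = I? ; above = λ m → m ; avoids = e∉I ; maximal = λ a () }
      saturate (r ∷ rs) I I? e∉I with adjoin? {I} I? r e
      ... | yes e∈ = record { ideal = ideal ; ideal? = ideal? ; above = above ; avoids = avoids ; maximal = maximal′ }
        where
        open Saturated (saturate rs I I? e∉I)
        maximal′ : ∀ a → Any (a ≈_) (r ∷ rs) → Member ideal a ⊎ Member (adjoin ideal a) e
        maximal′ a (here a≈r)  = inj₂ (adjoin-resp {ideal} (sym a≈r) (adjoin-mono {I} {ideal} r above e∈))
        maximal′ a (there any) = maximal a any
      ... | no e∉ = record { ideal = ideal ; ideal? = ideal? ; above = above ∘ ⊆-adjoin I r ; avoids = avoids ; maximal = maximal′ }
        where
        open Saturated (saturate rs (adjoin I r) (adjoin? {I} I? r) e∉)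
        maximal′ : ∀ a → Any (a ≈_) (r ∷ rs) → Member ideal a ⊎ Member (adjoin ideal a) e
        maximal′ a (here a≈r)  = inj₁ (resp ideal (sym a≈r) (above (∈-adjoin I r)))
        maximal′ a (there any) = maximal a any

      open Saturated (saturate elements zeroIdeal (_≈? 0#) e≉0) public using () renaming
        (ideal to M; ideal? to M?; avoids to e∉M; maximal to M-maximal)

      -- If e lies in M + (a) and in M + (b) then e = e · e lies in M + (a b).
      M-prime : ∀ a b → Member M (a * b) → Member M a ⊎ Member M b
      M-prime a b ab∈ with M-maximal a (complete a) | M-maximal b (complete b)
      ... | inj₁ a∈ | _       = inj₁ a∈
      ... | inj₂ _  | inj₁ b∈ = inj₂ b∈
      ... | inj₂ (s , m) | inj₂ (t , n) = ⊥-elim (e∉M (resp M (trans (combine e s t a b) idempotent)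
              (+∈ M (+∈ M (*∈ M e n) (*∈ M (t * b) m)) (*∈ M (s * t) ab∈))))
        where
        combine : ∀ e s t a b → e * (e - t * b) + t * b * (e - s * a) + s * t * (a * b) ≈ e * e
        combine = solve 5 (λ e s t a b →
          e :* (e :+ :- (t :* b)) :+ t :* b :* (e :+ :- (s :* a)) :+ s :* t :* (a :* b) := e :* e) refl

-- Polynomials as operators on sequences

module Shifts (K : CommutativeRing 0ℓ 0ℓ) where
  open CommutativeRing K hiding (zero)
  open import Relation.Binary.Reasoning.Setoid setoid
  open import Algebra.Properties.Ring ring using (-0#≈0#)
  open IntegerSolver K using (solve; _:+_; _:*_; :-_; _:=_)

  Seq : Set
  Seq = ℕ → Carrier

  Poly : Set
  Poly = List Carrier

  -- The action of a polynomial in the shift operator, lowest coefficient first.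
  act : Poly → Seq → Seq
  act []      φ i = 0#
  act (a ∷ f) φ i = a * φ i + act f φ (suc i)

  infixl 6 _⊕_
  infixl 7 _⊗_

  _⊕_ : Poly → Poly → Poly
  []      ⊕ g       = g
  (a ∷ f) ⊕ []      = a ∷ f
  (a ∷ f) ⊕ (b ∷ g) = (a + b) ∷ (f ⊕ g)

  _⊗_ : Poly → Poly → Poly
  []      ⊗ g = []
  (a ∷ f) ⊗ g = map (a *_) g ⊕ (0# ∷ (f ⊗ g))

  ⊖_ : Poly → Poly
  ⊖ f = map (-_) f

  act-cong : ∀ f {φ ψ : Seq} → (∀ i → φ i ≈ ψ i) → ∀ i → act f φ i ≈ act f ψ i
  act-cong []      eq i = refl
  act-cong (a ∷ f) eq i = +-cong (*-congˡ (eq i)) (act-cong f eq (suc i))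

  act-⊕ : ∀ f g φ i → act (f ⊕ g) φ i ≈ act f φ i + act g φ i
  act-⊕ []      g       φ i = sym (+-identityˡ _)
  act-⊕ (a ∷ f) []      φ i = sym (+-identityʳ _)
  act-⊕ (a ∷ f) (b ∷ g) φ i = trans (+-congˡ (act-⊕ f g φ (suc i))) (lemma a b (φ i) _ _)
    where
    lemma : ∀ a b x u v → (a + b) * x + (u + v) ≈ (a * x + u) + (b * x + v)
    lemma = solve 5 (λ a b x u v → (a :+ b) :* x :+ (u :+ v) := (a :* x :+ u) :+ (b :* x :+ v)) refl

  act-scale : ∀ c g φ i → act (map (c *_) g) φ i ≈ c * act g φ i
  act-scale c []      φ i = sym (zeroʳ c)
  act-scale c (b ∷ g) φ i = trans (+-cong (*-assoc c b _) (act-scale c g φ (suc i))) (sym (distribˡ c _ _))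

  act-⊖ : ∀ g φ i → act (⊖ g) φ i ≈ - act g φ i
  act-⊖ []      φ i = sym -0#≈0#
  act-⊖ (b ∷ g) φ i = trans (+-congˡ (act-⊖ g φ (suc i))) (lemma b (φ i) _)
    where
    lemma : ∀ b x u → - b * x + - u ≈ - (b * x + u)
    lemma = solve 3 (λ b x u → (:- b) :* x :+ :- u := :- (b :* x :+ u)) refl

  act-⊗ : ∀ f g φ i → act (f ⊗ g) φ i ≈ act f (act g φ) i
  act-⊗ []      g φ i = refl
  act-⊗ (a ∷ f) g φ i = begin
    act (map (a *_) g ⊕ (0# ∷ (f ⊗ g))) φ i  ≈⟨ act-⊕ (map (a *_) g) (0# ∷ (f ⊗ g)) φ i ⟩
    act (map (a *_) g) φ i + (0# * φ i + act (f ⊗ g) φ (suc i))  ≈⟨ +-cong (act-scale a g φ i) (trans (+-congʳ (zeroˡ _)) (+-identityˡ _)) ⟩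
    a * act g φ i + act (f ⊗ g) φ (suc i)  ≈⟨ +-congˡ (act-⊗ f g φ (suc i)) ⟩
    a * act g φ i + act f (act g φ) (suc i)  ∎

  act-suc : ∀ f φ i → act f (φ ∘ suc) i ≈ act f φ (suc i)
  act-suc []      φ i = refl
  act-suc (a ∷ f) φ i = +-congˡ (act-suc f φ (suc i))

  act-linear : ∀ f c φ ψ i → act f (λ j → c * φ j + ψ j) i ≈ c * act f φ i + act f ψ i
  act-linear []      c φ ψ i = sym (trans (+-identityʳ _) (zeroʳ c))
  act-linear (a ∷ f) c φ ψ i = trans (+-congˡ (act-linear f c φ ψ (suc i))) (lemma a c (φ i) (ψ i) _ _)
    where
    lemma : ∀ a c x y u v → a * (c * x + y) + (c * u + v) ≈ c * (a * x + u) + (a * y + v)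
    lemma = solve 6 (λ a c x y u v → a :* (c :* x :+ y) :+ (c :* u :+ v) := c :* (a :* x :+ u) :+ (a :* y :+ v)) refl

  act-zero : ∀ f {φ} → (∀ i → φ i ≈ 0#) → ∀ i → act f φ i ≈ 0#
  act-zero []      φ≈0 i = refl
  act-zero (a ∷ f) φ≈0 i = trans (+-cong (trans (*-congˡ (φ≈0 i)) (zeroʳ a)) (act-zero f φ≈0 (suc i))) (+-identityˡ 0#)

  act-comm : ∀ f g φ i → act f (act g φ) i ≈ act g (act f φ) i
  act-comm []      g φ i = sym (act-zero g (λ _ → refl) i)
  act-comm (a ∷ f) g φ i = begin
    a * act g φ i + act f (act g φ) (suc i)  ≈⟨ +-congˡ (act-comm f g φ (suc i)) ⟩
    a * act g φ i + act g (act f φ) (suc i)  ≈⟨ +-congˡ (act-suc g (act f φ) i) ⟨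
    a * act g φ i + act g (act f φ ∘ suc) i  ≈⟨ act-linear g a φ (act f φ ∘ suc) i ⟨
    act g (λ j → a * φ j + act f φ (suc j)) i  ∎

  module OperatorRing (δ : Seq) where

    -- Polynomials modulo the annihilator of δ; the ring laws hold because operators compose and commute.
    record _≋_ (f g : Poly) : Set where
      constructor ≋-intro
      field
        ≋-elim : ∀ i → act f δ i ≈ act g δ i
    open _≋_ public

    infix 4 _≋_

    private
      distˡ : ∀ f g h → f ⊗ (g ⊕ h) ≋ f ⊗ g ⊕ f ⊗ h
      distˡ f g h = ≋-intro λ i → begin
        act (f ⊗ (g ⊕ h)) δ i  ≈⟨ act-⊗ f (g ⊕ h) δ i ⟩
        act f (act (g ⊕ h) δ) i  ≈⟨ act-cong f (λ j → trans (act-⊕ g h δ j) (+-congʳ (sym (*-identityˡ _)))) i ⟩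
        act f (λ j → 1# * act g δ j + act h δ j) i  ≈⟨ act-linear f 1# (act g δ) (act h δ) i ⟩
        1# * act f (act g δ) i + act f (act h δ) i  ≈⟨ +-cong (trans (*-identityˡ _) (sym (act-⊗ f g δ i))) (sym (act-⊗ f h δ i)) ⟩
        act (f ⊗ g) δ i + act (f ⊗ h) δ i  ≈⟨ act-⊕ (f ⊗ g) (f ⊗ h) δ i ⟨
        act (f ⊗ g ⊕ f ⊗ h) δ i  ∎
      comm : ∀ f g → f ⊗ g ≋ g ⊗ f
      comm f g = ≋-intro λ i → trans (act-⊗ f g δ i) (trans (act-comm f g δ i) (sym (act-⊗ g f δ i)))
      idˡ : ∀ f → (1# ∷ []) ⊗ f ≋ f
      idˡ f = ≋-intro λ i → trans (act-⊗ (1# ∷ []) f δ i) (trans (+-identityʳ _) (*-identityˡ _))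
      ⊕-cong : ∀ {f g h k} → f ≋ g → h ≋ k → f ⊕ h ≋ g ⊕ k
      ⊕-cong {f} {g} {h} {k} (≋-intro eq) (≋-intro eq′) = ≋-intro λ i →
        trans (act-⊕ f h δ i) (trans (+-cong (eq i) (eq′ i)) (sym (act-⊕ g k δ i)))
      ⊗-congˡ : ∀ f {g h} → g ≋ h → f ⊗ g ≋ f ⊗ h
      ⊗-congˡ f {g} {h} (≋-intro eq) = ≋-intro λ i → trans (act-⊗ f g δ i) (trans (act-cong f eq i) (sym (act-⊗ f h δ i)))
      ≋-trans : ∀ {f g h} → f ≋ g → g ≋ h → f ≋ h
      ≋-trans (≋-intro eq) (≋-intro eq′) = ≋-intro λ i → trans (eq i) (eq′ i)

    operatorRing : CommutativeRing 0ℓ 0ℓ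
    operatorRing = record
      { Carrier = Poly ; _≈_ = _≋_ ; _+_ = _⊕_ ; _*_ = _⊗_ ; -_ = ⊖_ ; 0# = [] ; 1# = 1# ∷ []
      ; isCommutativeRing = record
        { isRing = record
          { +-isAbelianGroup = record
            { isGroup = record
              { isMonoid = record
                { isSemigroup = record
                  { isMagma = record
                    { isEquivalence = record
                      { refl  = ≋-intro λ i → refl
                      ; sym   = λ (≋-intro eq) → ≋-intro λ i → sym (eq i)
                      ; trans = ≋-trans
                      }
                    ; ∙-cong = ⊕-cong
                    }
                  ; assoc = λ f g h → ≋-intro λ i → trans (act-⊕ (f ⊕ g) h δ i) (trans (+-congʳ (act-⊕ f g δ i))
                      (trans (+-assoc _ _ _) (sym (trans (act-⊕ f (g ⊕ h) δ i) (+-congˡ (act-⊕ g h δ i))))))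
                  }
                ; identity = (λ f → ≋-intro λ i → refl) , (λ f → ≋-intro λ i → trans (act-⊕ f [] δ i) (+-identityʳ _))
                }
              ; inverse = (λ f → ≋-intro λ i → trans (act-⊕ (⊖ f) f δ i) (trans (+-congʳ (act-⊖ f δ i)) (-‿inverseˡ _)))
                        , (λ f → ≋-intro λ i → trans (act-⊕ f (⊖ f) δ i) (trans (+-congˡ (act-⊖ f δ i)) (-‿inverseʳ _)))
              ; ⁻¹-cong = λ {f} {g} (≋-intro eq) → ≋-intro λ i → trans (act-⊖ f δ i) (trans (-‿cong (eq i)) (sym (act-⊖ g δ i)))
              }
            ; comm = λ f g → ≋-intro λ i → trans (act-⊕ f g δ i) (trans (+-comm _ _) (sym (act-⊕ g f δ i)))
            }
          ; *-cong     = λ {f} {g} {h} {k} eq eq′ → ≋-trans (⊗-congˡ f eq′) (≋-trans (comm f k) (≋-trans (⊗-congˡ k eq) (comm k g)))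
          ; *-assoc    = λ f g h → ≋-intro λ i → trans (act-⊗ (f ⊗ g) h δ i) (trans (act-⊗ f g (act h δ) i)
                           (sym (trans (act-⊗ f (g ⊗ h) δ i) (act-cong f (act-⊗ g h δ) i))))
          ; *-identity = idˡ , (λ f → ≋-trans (comm f (1# ∷ [])) (idˡ f))
          ; distrib    = distˡ , (λ f g h → ≋-trans (comm (g ⊕ h) f) (≋-trans (distˡ f g h) (⊕-cong (comm f g) (comm f h))))
          }
        ; *-comm = comm
        }
      }

    module A = CommutativeRing operatorRing
    open import Algebra.Properties.Semiring.Exp A.semiring using (_^_)
    open import Algebra.Properties.Semiring.Mult A.semiring using () renaming (_×_ to _×ᴬ_)
    open import Algebra.Properties.Semiring.Mult semiring using () renaming (_×_ to _×ᴷ_)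

    X : Poly
    X = 0# ∷ 1# ∷ []

    act-X : ∀ φ i → act X φ i ≈ φ (suc i)
    act-X φ i = trans (+-cong (zeroˡ _) (trans (+-identityʳ _) (*-identityˡ _))) (+-identityˡ _)

    act-X^ : ∀ n φ i → act (X ^ n) φ i ≈ φ (n ℕ.+ i)
    act-X^ zero    φ i = trans (+-identityʳ _) (*-identityˡ _)
    act-X^ (suc n) φ i = begin
      act (X ⊗ X ^ n) φ i  ≈⟨ act-⊗ X (X ^ n) φ i ⟩
      act X (act (X ^ n) φ) i  ≈⟨ act-X (act (X ^ n) φ) i ⟩
      act (X ^ n) φ (suc i)  ≈⟨ act-X^ n φ (suc i) ⟩
      φ (n ℕ.+ suc i)  ≡⟨ ≡.cong φ (ℕₚ.+-suc n i) ⟩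
      φ (suc n ℕ.+ i)  ∎

    act-× : ∀ n φ i → act (n ×ᴬ (1# ∷ [])) φ i ≈ n ×ᴷ 1# * φ i
    act-× zero    φ i = sym (zeroˡ _)
    act-× (suc n) φ i = begin
      act ((1# ∷ []) ⊕ n ×ᴬ (1# ∷ [])) φ i  ≈⟨ act-⊕ (1# ∷ []) (n ×ᴬ (1# ∷ [])) φ i ⟩
      (1# * φ i + 0#) + act (n ×ᴬ (1# ∷ [])) φ i  ≈⟨ +-cong (+-identityʳ _) (act-× n φ i) ⟩
      1# * φ i + n ×ᴷ 1# * φ i  ≈⟨ distribʳ _ _ _ ⟨
      (1# + n ×ᴷ 1#) * φ i  ∎

    ×≋0 : ∀ n → n ×ᴷ 1# ≈ 0# → n ×ᴬ A.1# ≋ A.0#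
    ×≋0 n n≈0 = ≋-intro λ i → trans (act-× n δ i) (trans (*-congʳ n≈0) (zeroˡ _))

    Leading : Seq → ℕ → Set
    Leading φ c = φ c ≈ 1# × (∀ i → i < c → φ i ≈ 0#)

    -- The term `X ^ s` moves the first nonzero value from `s + c` to `c`; the term `X` moves it
    -- only to `s + c - 1`, which is still beyond `c` since `s` is at least 2.
    leading-step : ∀ φ s c → 2 ≤ s → Leading φ (s ℕ.+ c) → Leading (act (X ^ s A.- X) φ) c
    leading-step φ s c 2≤s (one , zeros) = main , λ i i<c → trans (formula i) (trans
        (+-cong (zeros (s ℕ.+ i) (ℕₚ.+-monoʳ-< s i<c)) (-‿cong (zeros (suc i) (ℕₚ.+-mono-≤-< {1} (ℕₚ.<⇒≤ 2≤s) i<c)))) (-‿inverseʳ 0#))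
      where
      formula : ∀ i → act (X ^ s A.- X) φ i ≈ φ (s ℕ.+ i) - φ (suc i)
      formula i = trans (act-⊕ (X ^ s) (⊖ X) φ i) (+-cong (act-X^ s φ i) (trans (act-⊖ X φ i) (-‿cong (act-X φ i))))
      main : act (X ^ s A.- X) φ c ≈ 1#
      main = begin
        act (X ^ s A.- X) φ c  ≈⟨ formula c ⟩
        φ (s ℕ.+ c) - φ (suc c)  ≈⟨ +-cong one (-‿cong (zeros (suc c) (ℕₚ.+-monoˡ-< c 2≤s))) ⟩
        1# - 0#  ≈⟨ trans (+-congˡ -0#≈0#) (+-identityʳ 1#) ⟩
        1#  ∎

    module Periodic (n : ℕ) (periodic : ∀ i → δ (suc n ℕ.+ i) ≈ δ i) where

      X^period : X ^ suc n ≋ A.1#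
      X^period = ≋-intro λ i → trans (act-X^ (suc n) δ i) (trans (periodic i) (sym (trans (+-identityʳ _) (*-identityˡ _))))

      act-∷ʳ : ∀ g b i → act (g ∷ʳ b) δ i ≈ act g δ i + b * δ (length g ℕ.+ i)
      act-∷ʳ []      b i = trans (+-identityʳ _) (sym (+-identityˡ _))
      act-∷ʳ (a ∷ g) b i = trans (+-congˡ (trans (act-∷ʳ g b (suc i)) (+-congˡ (*-congˡ (reflexive (≡.cong δ (ℕₚ.+-suc (length g) i)))))))
        (sym (+-assoc _ _ _))

      normal-form : ∀ f → ∃[ g ] (length g ≡ suc n × f ≋ g)
      normal-form [] = replicate (suc n) 0# , Listₚ.length-replicate (suc n) , ≋-intro (λ i → sym (zeros (suc n) i))
        where
        zeros : ∀ m i → act (replicate m 0#) δ i ≈ 0#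
        zeros zero    i = refl
        zeros (suc m) i = trans (+-cong (zeroˡ _) (zeros m (suc i))) (+-identityˡ 0#)
      normal-form (a ∷ f) with normal-form f
      ... | g , len , ≋-intro eq with initLast g
      -- Prepending a coefficient moves `b` to exponent `n + 1`, where the period returns it to the
      -- constant term.
      ...   | g′ ∷ʳ′ b = (a + b) ∷ g′ , ≡.trans (≡.sym (≡.trans (Listₚ.length-++ g′) (ℕₚ.+-comm _ 1))) len , ≋-intro λ i → begin
        a * δ i + act f δ (suc i)  ≈⟨ +-congˡ (trans (eq (suc i)) (act-∷ʳ g′ b (suc i))) ⟩
        a * δ i + (act g′ δ (suc i) + b * δ (length g′ ℕ.+ suc i))  ≈⟨ +-congˡ (+-congˡ (*-congˡ (wrap i))) ⟩
        a * δ i + (act g′ δ (suc i) + b * δ i)  ≈⟨ lemma a b (δ i) _ ⟩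
        (a + b) * δ i + act g′ δ (suc i)  ∎
        where
        length≡ : length g′ ≡ n
        length≡ = ℕₚ.suc-injective (≡.trans (≡.sym (≡.trans (Listₚ.length-++ g′) (ℕₚ.+-comm _ 1))) len)
        wrap : ∀ i → δ (length g′ ℕ.+ suc i) ≈ δ i
        wrap i = trans (reflexive (≡.cong δ (≡.trans (ℕₚ.+-suc (length g′) i) (≡.cong (λ m → suc m ℕ.+ i) length≡)))) (periodic i)
        lemma : ∀ a b x u → a * x + (u + b * x) ≈ (a + b) * x + u
        lemma = solve 4 (λ a b x u → a :* x :+ (u :+ b :* x) := (a :+ b) :* x :+ u) refl

      act-periodic : ∀ f i → act f δ (suc n ℕ.+ i) ≈ act f δ i
      act-periodic []      i = refl
      act-periodic (a ∷ f) i = +-cong (*-congˡ (periodic i))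
        (trans (reflexive (≡.cong (act f δ) (≡.sym (ℕₚ.+-suc (suc n) i)))) (act-periodic f (suc i)))

      module FiniteCoefficients (_≈?_ : ∀ a b → Dec (a ≈ b)) (scalars : List Carrier) (complete : ∀ a → Any (a ≈_) scalars) where

        words : ℕ → List Poly
        words zero    = [] ∷ []
        words (suc m) = cartesianProductWith _∷_ scalars (words m)

        words-complete : ∀ m g → length g ≡ m → Any (g ≋_) (words m)
        words-complete m g len = Any.map (λ eq → ≋-intro (eq δ)) (go m g len)
          where
          go : ∀ m g → length g ≡ m → Any (λ h → ∀ φ i → act g φ i ≈ act h φ i) (words m)
          go zero    []      _   = here λ φ i → refl
          go (suc m) (a ∷ g) len = Anyₚ.cartesianProductWith⁺ _∷_
            (λ a≈b eq φ i → +-cong (*-congʳ a≈b) (eq φ (suc i))) (complete a) (go m g (ℕₚ.suc-injective len))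

        elements : List Poly
        elements = words (suc n)

        elements-complete : ∀ f → Any (f ≋_) elements
        elements-complete f with normal-form f
        ... | g , len , ≋-intro eq = Any.map (λ (≋-intro eq′) → ≋-intro λ i → trans (eq i) (eq′ i)) (words-complete (suc n) g len)

        -- Both sides are periodic, so it is enough to compare them on one period.
        _≋?_ : ∀ f g → Dec (f ≋ g)
        f ≋? g with ℕₚ.allUpTo? (λ i → act f δ i ≈? act g δ i) (suc n)
        ... | no ¬below = no λ (≋-intro eq) → ¬below λ {i} _ → eq i
        ... | yes below = yes (≋-intro extend)
          where
          extend : ∀ i → act f δ i ≈ act g δ i
          extend i = wrap i (i ℕ./ suc n) (i ℕ.% suc n) (m≡m%n+[m/n]*n i (suc n)) (m%n<n i (suc n))
            where
            open import Data.Nat.DivMod using (m≡m%n+[m/n]*n; m%n<n)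
            wrap : ∀ i t r → i ≡ r ℕ.+ t ℕ.* suc n → r < suc n → act f δ i ≈ act g δ i
            wrap i zero    r eq r< = ≡.subst (λ j → act f δ j ≈ act g δ j) (≡.sym (≡.trans eq (ℕₚ.+-identityʳ r))) (below r<)
            wrap i (suc t) r eq r< = ≡.subst (λ j → act f δ j ≈ act g δ j) (≡.sym eq′)
              (trans (act-periodic f _) (trans (wrap _ t r ≡.refl r<) (sym (act-periodic g _))))
              where
              eq′ : i ≡ suc n ℕ.+ (r ℕ.+ t ℕ.* suc n)
              eq′ = ≡.trans eq (≡.trans (≡.sym (ℕₚ.+-assoc r (suc n) _))
                (≡.trans (≡.cong (ℕ._+ t ℕ.* suc n) (ℕₚ.+-comm r (suc n))) (ℕₚ.+-assoc (suc n) r _)))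

-- Existence of a field of order p^k

module _ {R : CommutativeRing 0ℓ 0ℓ} (I : IdealTheory.Ideal R) where
  open CommutativeRing R
  private
    module Q = CommutativeRing (IdealTheory.Quotient.quotientRing R I)
  open import Algebra.Properties.Semiring.Exp semiring using (_^_)
  open import Algebra.Properties.Semiring.Mult semiring using () renaming (_×_ to _×′_)
  open import Algebra.Properties.Semiring.Exp Q.semiring using () renaming (_^_ to _^ᴵ_)
  open import Algebra.Properties.Semiring.Mult Q.semiring using () renaming (_×_ to _×ᴵ_)

  -- Passing to the quotient changes the equality but not the operations, so the powers agree
  -- propositionally, not merely modulo `I`.
  quotient-^ : ∀ x n → x ^ n ≡ x ^ᴵ n
  quotient-^ x ℕ.zero  = ≡.refl
  quotient-^ x (suc n) = ≡.cong (x *_) (quotient-^ x n)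

  quotient-× : ∀ n x → n ×′ x ≡ n ×ᴵ x
  quotient-× ℕ.zero  x = ≡.refl
  quotient-× (suc n) x = ≡.cong (λ y → x + y) (quotient-× n x)

module IntegersMod (p : ℕ) .{{_ : NonZero p}} where
  open IdealTheory ℤₚ.+-*-commutativeRing

  multiples : Ideal
  multiples = record
    { Member = + p ∣_
    ; resp   = λ { ≡.refl p∣a → p∣a }
    ; zero∈  = divides (+ 0) ≡.refl
    ; +∈     = ∣m∣n⇒∣m+n
    ; *∈     = λ a p∣b → ∣n⇒∣m*n a p∣b
    }

  open Quotient multiples using (quotientRing) public

  open CommutativeRing quotientRing using (_≈_; 0#; 1#; semiring)
  open import Algebra.Properties.Semiring.Mult semiring using () renaming (_×_ to _×′_)

  _≈?_ : ∀ a b → Dec (a ≈ b)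
  a ≈? b = (+ p) ∣? (a ℤ.- b)

  residues : List ℤ
  residues = map +_ (upTo p)

  residues-complete : ∀ a → Any (a ≈_) residues
  residues-complete a = lose (∈-map⁺ +_ (∈-upTo⁺ (ℤDM.n%ℕd<d a p)))
    (divides (a ℤDM./ℕ p) (begin
      a ℤ.- + r  ≡⟨ ≡.cong (ℤ._- + r) (ℤDM.a≡a%ℕn+[a/ℕn]*n a p) ⟩
      + r ℤ.+ (a ℤDM./ℕ p) ℤ.* + p ℤ.- + r  ≡⟨ lemma (+ r) ((a ℤDM./ℕ p) ℤ.* + p) ⟩
      (a ℤDM./ℕ p) ℤ.* + p  ∎))
    where
    open ≡.≡-Reasoning
    open import Data.Integer.Tactic.RingSolver using (solve-∀)
    r : ℕ
    r = a ℤDM.%ℕ p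
    lemma : ∀ x y → x ℤ.+ y ℤ.- x ≡ y
    lemma = solve-∀

  ×1≡ : ∀ n → n ×′ 1# ≡ + n
  ×1≡ zero    = ≡.refl
  ×1≡ (suc n) = ≡.cong (ℤ._+_ (+ 1)) (×1≡ n)

  p×1≈0 : p ×′ 1# ≈ 0#
  p×1≈0 = ≡.subst (λ a → + p ∣ a ℤ.- + 0) (≡.sym (×1≡ p)) (divides (+ 1) (≡.trans (ℤₚ.+-identityʳ (+ p)) (≡.sym (ℤₚ.*-identityˡ (+ p)))))

  1≉0 : 1 < p → ¬ 1# ≈ 0#
  1≉0 1<p p∣1 = ℕₚ.<⇒≱ 1<p (ℕ∣.∣⇒≤ (∣⇒∣ᵤ p∣1))

module Factors (R : CommutativeRing 0ℓ 0ℓ) (p : ℕ) (X : CommutativeRing.Carrier R) where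
  open CommutativeRing R
  open import Algebra.Properties.Semiring.Exp semiring using (_^_)

  -- Y m is nonzero in a domain iff X is in none of the subfields of order p ^ j, 0 < j ≤ m.
  Y : ℕ → Carrier
  Y ℕ.zero  = 1#
  Y (suc m) = (X ^ (p ℕ.^ suc m) - X) * Y m

module Residue (R : CommutativeRing 0ℓ 0ℓ) (_≈?_ : ∀ a b → Dec (CommutativeRing._≈_ R a b))
  (elements : List (CommutativeRing.Carrier R)) (complete : ∀ a → Any (CommutativeRing._≈_ R a) elements)
  {p : ℕ} (p-prime : Prime p) (k′ n : ℕ) (q≡ : p ℕ.^ suc k′ ≡ suc (suc n)) where
  open CommutativeRing R hiding (zero)
  open Characteristic R p-prime
  open import Algebra.Properties.Semiring.Exp semiring using (_^_)
  open import Algebra.Properties.Ring ring using (-0#≈0#)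
  open import Algebra.Properties.Semiring.Mult semiring using () renaming (_×_ to _×′_)

  module _ (p≈0 : p ×′ 1# ≈ 0#) (X : Carrier) (X-fixed : X ^ (p ℕ.^ suc k′) ≈ X) (y≉0 : ¬ Factors.Y R p X k′ ≈ 0#) where
    open Factors R p X

    φ : ℕ → Carrier → Carrier
    φ = frob p≈0

    y : Carrier
    y = Y k′

    -- The map `φ (suc k′)` is a ring homomorphism that fixes `X`, and `Y m` is a polynomial in `X`
    -- with integer coefficients.
    Y-fixed : ∀ m → φ (suc k′) (Y m) ≈ Y m
    Y-fixed zero    = frob-1 p≈0 (suc k′)
    Y-fixed (suc m) = trans (frob-* p≈0 (suc k′) _ (Y m)) (*-cong
      (trans (frob-+ p≈0 (suc k′) _ _) (+-cong
        (trans (frob-frob p≈0 (suc k′) (suc m) X) (trans (reflexive (≡.cong (λ j → φ j X) (ℕₚ.+-comm (suc k′) (suc m))))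
          (trans (sym (frob-frob p≈0 (suc m) (suc k′) X)) (frob-cong p≈0 (suc m) X-fixed))))
        (trans (frob-neg p≈0 (suc k′) X) (-‿cong X-fixed)))) (Y-fixed m))

    -- Since `y ^ q = y` with `q = n + 2`, the power `y ^ (q - 1)` is idempotent and generates the
    -- same ideal as `y`, so avoiding the one means avoiding the other.
    e : Carrier
    e = y ^ suc n

    y*e≈y : y * e ≈ y
    y*e≈y = trans (reflexive (≡.cong (y ^_) (≡.sym q≡))) (Y-fixed k′)

    e≉0 : ¬ e ≈ 0#
    e≉0 e≈0 = y≉0 (trans (sym y*e≈y) (trans (*-congˡ e≈0) (zeroʳ y)))

    e-idempotent : e * e ≈ e
    e-idempotent = trans (*-congʳ (*-comm y (y ^ n))) (trans (*-assoc (y ^ n) y e)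
      (trans (*-congˡ y*e≈y) (*-comm (y ^ n) y)))

    open IdealTheory R
    open Finite elements complete
    open PrimeAvoiding e-idempotent e≉0 _≈?_
    open Ideal M
    open Quotient M

    module L = CommutativeRing quotientRing

    L-integral : Integral quotientRing
    L-integral a b ab≈0 = Sum.map ∈⇒≈0 ∈⇒≈0 (M-prime a b (≈ᴵ0⇒∈ ab≈0))
      where
      ∈⇒≈0 : ∀ {a} → Member a → a L.≈ L.0#
      ∈⇒≈0 = resp (sym (trans (+-congˡ -0#≈0#) (+-identityʳ _)))

    L-1≉0 : ¬ L.1# L.≈ L.0#
    L-1≉0 1≈0 = e∉M (resp (*-identityʳ e) (*∈ e (≈ᴵ0⇒∈ 1≈0)))

    factor∈⇒Y∈ : ∀ m j → 0 < j → j ≤ m → Member (φ j X - X) → Member (Y m)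
    factor∈⇒Y∈ zero    zero    () _ _
    factor∈⇒Y∈ (suc m) j 0<j j≤m f∈ with ℕₚ.m≤n⇒m<n∨m≡n j≤m
    ... | inj₂ ≡.refl = resp (*-comm (Y m) _) (*∈ (Y m) f∈)
    ... | inj₁ (s≤s j≤m′) = *∈ (φ (suc m) X - X) (factor∈⇒Y∈ m j 0<j j≤m′ f∈)

    open FixedField quotientRing L-integral (λ a b → M? (a - b)) L-1≉0 p-prime using () renaming (finiteDomain to fixed)
    open import Algebra.Properties.Semiring.Mult L.semiring using () renaming (_×_ to _×ᴸ_)

    finiteDomain : FiniteDomain (p ℕ.^ suc k′)
    finiteDomain = fixed p≈0′ (suc k′) (s≤s z≤n) X
      (≡.subst (λ z → z L.≈ X) (quotient-^ M X (p ℕ.^ suc k′)) (≈⇒≈ᴵ X-fixed))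
      -- If `X` were equal in the quotient to a conjugate with index between 0 and `k`, then `y` and
      -- with it `e` would lie in `M`.
      (λ j 0<j j<k eq → e∉M (resp (*-comm (y ^ n) y) (*∈ (y ^ n)
        (factor∈⇒Y∈ k′ j 0<j (ℕₚ.≤-pred j<k) (≡.subst (λ z → Member (z - X)) (≡.sym (quotient-^ M X (p ℕ.^ j))) eq)))))
      where
      p≈0′ : p ×ᴸ L.1# L.≈ L.0#
      p≈0′ = ≡.subst (λ z → z L.≈ L.0#) (quotient-× M p 1#) (≈⇒≈ᴵ p≈0)

module Existence (K : CommutativeRing 0ℓ 0ℓ) (_≈?_ : ∀ a b → Dec (CommutativeRing._≈_ K a b))
  (scalars : List (CommutativeRing.Carrier K)) (complete : ∀ a → Any (CommutativeRing._≈_ K a) scalars)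
  (1≉0 : ¬ CommutativeRing._≈_ K (CommutativeRing.1# K) (CommutativeRing.0# K))
  {p : ℕ} (p-prime : Prime p) (k′ n : ℕ) (q≡ : p ℕ.^ suc k′ ≡ suc (suc n)) where

  private instance
    p≢0 : NonZero p
    p≢0 = prime⇒nonZero p-prime

  1<p : 1 < p
  1<p = ℕ.nonTrivial⇒n>1 p {{prime⇒nonTrivial p-prime}}

  private module K = CommutativeRing K
  open import Algebra.Properties.Semiring.Mult K.semiring using () renaming (_×_ to _×ᴷ_)

  -- The periodic impulse of period `n + 1 = q - 1`, with its first 1 at index `n`. It is
  -- annihilated exactly by the multiples of `X ^ (q - 1) - 1`, so `operatorRing` is the residue
  -- ring modulo this polynomial.
  δ : ℕ → K.Carrier
  δ i = if does (suc n ∣?ⁿ suc i) then K.1# else K.0#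

  δ-periodic : ∀ i → δ (suc n ℕ.+ i) K.≈ δ i
  δ-periodic i = K.reflexive (≡.cong (if_then K.1# else K.0#) (does-⇔ (mk⇔ down up) (suc n ∣?ⁿ _) (suc n ∣?ⁿ suc i)))
    where
    down : suc n ∣ⁿ suc (suc n ℕ.+ i) → suc n ∣ⁿ suc i
    down d = ℕ∣.∣m+n∣m⇒∣n (≡.subst (suc n ∣ⁿ_) (≡.sym (ℕₚ.+-suc (suc n) i)) d) ℕ∣.∣-refl
    up : suc n ∣ⁿ suc i → suc n ∣ⁿ suc (suc n ℕ.+ i)
    up d = ≡.subst (suc n ∣ⁿ_) (ℕₚ.+-suc (suc n) i) (ℕ∣.∣m∣n⇒∣m+n ℕ∣.∣-refl d)

  open Shifts K
  open OperatorRing δ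
  open Periodic n δ-periodic
  open FiniteCoefficients _≈?_ scalars complete

  δ-leading : Leading δ n
  δ-leading = K.reflexive (≡.cong (if_then K.1# else K.0#) (dec-true (suc n ∣?ⁿ suc n) ℕ∣.∣-refl))
            , λ i i<n → K.reflexive (≡.cong (if_then K.1# else K.0#) (dec-false (suc n ∣?ⁿ suc i) (ℕ∣.>⇒∤ (s≤s i<n))))

  open import Algebra.Properties.Semiring.Exp A.semiring using (_^_)
  open Factors operatorRing p X

  X-fixed : X ^ (p ℕ.^ suc k′) A.≈ X
  X-fixed = A.trans (A.reflexive (≡.cong (X ^_) q≡)) (A.trans (A.*-congˡ {X} X^period) (A.*-identityʳ X))

  Y-degree : ℕ → ℕ
  Y-degree zero    = 0
  Y-degree (suc m) = p ℕ.^ suc m ℕ.+ Y-degree m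

  leading-resp : ∀ {φ ψ c} → (∀ i → φ i K.≈ ψ i) → Leading φ c → Leading ψ c
  leading-resp eq (one , zeros) = K.trans (K.sym (eq _)) one , λ i i<c → K.trans (K.sym (eq i)) (zeros i i<c)

  -- Y m has degree below the period of δ, so it cannot annihilate δ.
  Y-leading : ∀ m c → c ℕ.+ Y-degree m ≡ n → Leading (act (Y m) δ) c
  Y-leading zero c eq = leading-resp (λ i → K.sym (act-X^ 0 δ i))
    (≡.subst (Leading δ) (≡.trans (≡.sym eq) (ℕₚ.+-identityʳ c)) δ-leading)
  Y-leading (suc m) c eq = leading-resp (λ i → K.sym (act-⊗ (X ^ (p ℕ.^ suc m) A.- X) (Y m) δ i))
    (leading-step (act (Y m) δ) (p ℕ.^ suc m) c 2≤p^ (Y-leading m (p ℕ.^ suc m ℕ.+ c)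
      (≡.trans (≡.cong (ℕ._+ Y-degree m) (ℕₚ.+-comm (p ℕ.^ suc m) c)) (≡.trans (ℕₚ.+-assoc c _ _) eq))))
    where
    2≤p^ : 2 ≤ p ℕ.^ suc m
    2≤p^ = ℕₚ.≤-trans 1<p (≡.subst (_≤ p ℕ.^ suc m) (ℕₚ.*-identityʳ p) (ℕₚ.^-monoʳ-≤ p {1} {suc m} (s≤s z≤n)))

  -- The summand 2 matches `q = n + 2`, so that for `m = k′` the degree is at most `n`. The
  -- induction step compares doubling with multiplication by `p`.
  Y-degree-bound : ∀ m → Y-degree m ℕ.+ 2 ≤ p ℕ.^ suc m
  Y-degree-bound zero    = ≡.subst (2 ≤_) (≡.sym (ℕₚ.*-identityʳ p)) 1<p
  Y-degree-bound (suc m) = begin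
    p ℕ.^ suc m ℕ.+ Y-degree m ℕ.+ 2  ≡⟨ ℕₚ.+-assoc (p ℕ.^ suc m) _ 2 ⟩
    p ℕ.^ suc m ℕ.+ (Y-degree m ℕ.+ 2)  ≤⟨ ℕₚ.+-monoʳ-≤ (p ℕ.^ suc m) (Y-degree-bound m) ⟩
    p ℕ.^ suc m ℕ.+ p ℕ.^ suc m  ≡⟨ ≡.cong (p ℕ.^ suc m ℕ.+_) (ℕₚ.+-identityʳ _) ⟨
    2 ℕ.* p ℕ.^ suc m  ≤⟨ ℕₚ.*-monoˡ-≤ (p ℕ.^ suc m) 1<p ⟩
    p ℕ.* p ℕ.^ suc m  ∎
    where open ℕₚ.≤-Reasoning

  y≉0 : ¬ Y k′ A.≈ A.0#
  y≉0 (≋-intro eq) = 1≉0 (K.trans (K.sym (proj₁ (Y-leading k′ (n ℕ.∸ Y-degree k′) (ℕₚ.m∸n+n≡m degree≤n)))) (eq _))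
    where
    degree≤n : Y-degree k′ ≤ n
    degree≤n = ℕₚ.+-cancelʳ-≤ 2 (Y-degree k′) n (≡.subst (Y-degree k′ ℕ.+ 2 ≤_) (≡.trans q≡ (ℕₚ.+-comm 2 n)) (Y-degree-bound k′))

  finiteDomain : p ×ᴷ K.1# K.≈ K.0# → FiniteDomain (p ℕ.^ suc k′)
  finiteDomain p≈0 = Residue.finiteDomain operatorRing _≋?_ elements elements-complete p-prime k′ n q≡ (×≋0 p p≈0) X X-fixed y≉0

prime-power-domain : ∀ {p} → Prime p → ∀ k → 1 ≤ k → FiniteDomain (p ℕ.^ k)
prime-power-domain {p} p-prime (suc k′) _ = lemma (p ℕ.^ suc k′) ≡.refl
  where
  open IntegersMod p {{prime⇒nonZero p-prime}}
  2≤p^ : 2 ≤ p ℕ.^ suc k′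
  2≤p^ = ℕₚ.≤-trans (ℕ.nonTrivial⇒n>1 p {{prime⇒nonTrivial p-prime}})
    (≡.subst (_≤ p ℕ.^ suc k′) (ℕₚ.*-identityʳ p) (ℕₚ.^-monoʳ-≤ p {{prime⇒nonZero p-prime}} {1} {suc k′} (s≤s z≤n)))
  -- The order is made a variable so that it can be written as `n + 2`, which provides the period
  -- `n + 1`.
  lemma : ∀ q → p ℕ.^ suc k′ ≡ q → FiniteDomain (p ℕ.^ suc k′)
  lemma zero          eq = contradiction (≡.subst (2 ≤_) eq 2≤p^) λ ()
  lemma (suc zero)    eq = contradiction (≡.subst (2 ≤_) eq 2≤p^) λ { (s≤s ()) }
  lemma (suc (suc n)) eq = Existence.finiteDomain quotientRing _≈?_ residues residues-complete
    (1≉0 (ℕ.nonTrivial⇒n>1 p {{prime⇒nonTrivial p-prime}})) p-prime k′ n eq p×1≈0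

-- The radius bounds

open import Data.Nat using (_+_; _*_; _∸_; _^_)
open import Data.Nat.Tactic.RingSolver using (solve-∀)
open import Relation.Binary.PropositionalEquality
open DoubleTrees
open Graphs
open CyclicCovers
open Representations
open SplitCayleyHexagon
open PlaneAndQuadrangle

infinitely-many : ∀ {q d g} (X : Cross q d) → FiniteDomain q →
  (∀ u v w l → Turning (Turn (DoubleTree.nb X)) (u ∷ v ∷ w ∷ l ++ u ∷ v ∷ []) → g ≤ 3 + length l) →
  {B : ℕ → ℕ → Set} →
  (∀ h r → 2 * suc (suc d) * h ≤ r → B (2 * size q (suc d) * (h + h)) r) →
  InfinitelyMany (λ n → MaxRadiusSatisfies n (suc q) g (B n))
infinitely-many {q} {d} X D girth bound N =
  let G , admissible , r , isRadius , far≤r = antipodal-radius (FiniteDomain.0# D) (cover-girth girth)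
  in order , N≤order , G , admissible , r , isRadius , bound half r far≤r
  where
  -- This choice makes `half` equal to `N + 1`, so that the order exceeds `N`.
  open Antipodal X N
  N≤order : N ≤ order
  N≤order = begin
    N  ≤⟨ ℕₚ.n≤1+n N ⟩
    half  ≤⟨ ℕₚ.m≤m+n half half ⟩
    half + half  ≤⟨ ℕₚ.m≤n*m (half + half) (2 * size q (suc d)) ⟩
    2 * size q (suc d) * (half + half)  ∎
    where open ℕₚ.≤-Reasoning

size₂ : ∀ q → suc q * suc q ∸ suc q + 1 ≡ size q 2
size₂ q = trans (cong (_+ 1) (ℕₚ.m+n∸m≡n (suc q) (q * suc q))) (lemma q)
  where
  lemma : ∀ q → q * (1 + q) + 1 ≡ 1 + q * (1 + q * 1)
  lemma = solve-∀

size₃ : ∀ q → suc q ^ 3 + 2 * suc q ∸ 2 * suc q ^ 2 ≡ size q 3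
-- The minuend is rewritten as `size q 3` plus the subtrahend, so that the truncated subtraction is
-- exact.
size₃ q = trans (cong (_∸ 2 * suc q ^ 2) (lemma q)) (ℕₚ.m+n∸n≡m (size q 3) (2 * suc q ^ 2))
  where
  lemma : ∀ q → (1 + q) * ((1 + q) * ((1 + q) * 1)) + 2 * (1 + q) ≡ 1 + q * (1 + q * (1 + q * 1)) + 2 * ((1 + q) * ((1 + q) * 1))
  lemma = solve-∀

size₅ : ∀ q → (q ^ 3 + 1) * (suc q * suc q ∸ suc q + 1) ≡ size q 5
size₅ q = trans (cong ((q ^ 3 + 1) *_) (size₂ q)) (lemma q)
  where
  lemma : ∀ q → (q * (q * (q * 1)) + 1) * (1 + q * (1 + q * 1)) ≡ 1 + q * (1 + q * (1 + q * (1 + q * (1 + q * 1))))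
  lemma = solve-∀

theorem1p3 : (δ : ℕ) → 2 ≤ δ → IsPrimePower (δ ∸ 1) →
    InfinitelyMany (λ n → MaxRadiusSatisfies n δ 6
    (λ r → 3 * n ≤ (2 * (δ * δ ∸ δ + 1)) * (r + 3)))
    × InfinitelyMany (λ n → MaxRadiusSatisfies n δ 8
    (λ r → 2 * n ≤ (δ ^ 3 + 2 * δ ∸ 2 * δ ^ 2) * (r + 4)))
    × InfinitelyMany (λ n → MaxRadiusSatisfies n δ 12
    (λ r → 3 * n ≤ (((δ ∸ 1) ^ 3 + 1) * (δ * δ ∸ δ + 1)) * (r + 6)))
theorem1p3 (suc q) _ (p , k , p-prime , 1≤k , q≡) =
    infinitely-many (Plane.plane-cross D) D (Plane.girth D) plane
  , infinitely-many (Quadrangle.quadrangle-cross D) D (Quadrangle.girth D) quadrangle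
  , infinitely-many (Hexagon.hexagon-cross D) D (Hexagon.girth D) hexagon
  where
  open ℕₚ.≤-Reasoning
  D : FiniteDomain q
  D = subst FiniteDomain (sym q≡) (prime-power-domain p-prime k 1≤k)
  -- With `S = size q 2` the order is `n = 4 S h`, and `3 n = 12 S h = 2 S (6 h)`, where `6 h` is
  -- half the length of the cycle onto which the cover maps.
  plane : ∀ h r → 6 * h ≤ r → 3 * (2 * size q 2 * (h + h)) ≤ 2 * (suc q * suc q ∸ suc q + 1) * (r + 3)
  plane h r 6h≤r = begin
    3 * (2 * size q 2 * (h + h))  ≡⟨ lemma (size q 2) h ⟩
    2 * size q 2 * (6 * h)  ≤⟨ ℕₚ.*-monoʳ-≤ (2 * size q 2) (ℕₚ.m≤n⇒m≤n+o 3 6h≤r) ⟩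
    2 * size q 2 * (r + 3)  ≡⟨ cong (λ S → 2 * S * (r + 3)) (size₂ q) ⟨
    2 * (suc q * suc q ∸ suc q + 1) * (r + 3)  ∎
    where
    lemma : ∀ S h → 3 * (2 * S * (h + h)) ≡ 2 * S * (6 * h)
    lemma = solve-∀
  quadrangle : ∀ h r → 8 * h ≤ r → 2 * (2 * size q 3 * (h + h)) ≤ (suc q ^ 3 + 2 * suc q ∸ 2 * suc q ^ 2) * (r + 4)
  quadrangle h r 8h≤r = begin
    2 * (2 * size q 3 * (h + h))  ≡⟨ lemma (size q 3) h ⟩
    size q 3 * (8 * h)  ≤⟨ ℕₚ.*-monoʳ-≤ (size q 3) (ℕₚ.m≤n⇒m≤n+o 4 8h≤r) ⟩
    size q 3 * (r + 4)  ≡⟨ cong (_* (r + 4)) (size₃ q) ⟨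
    (suc q ^ 3 + 2 * suc q ∸ 2 * suc q ^ 2) * (r + 4)  ∎
    where
    lemma : ∀ S h → 2 * (2 * S * (h + h)) ≡ S * (8 * h)
    lemma = solve-∀
  hexagon : ∀ h r → 12 * h ≤ r → 3 * (2 * size q 5 * (h + h)) ≤ (q ^ 3 + 1) * (suc q * suc q ∸ suc q + 1) * (r + 6)
  hexagon h r 12h≤r = begin
    3 * (2 * size q 5 * (h + h))  ≡⟨ lemma (size q 5) h ⟩
    size q 5 * (12 * h)  ≤⟨ ℕₚ.*-monoʳ-≤ (size q 5) (ℕₚ.m≤n⇒m≤n+o 6 12h≤r) ⟩
    size q 5 * (r + 6)  ≡⟨ cong (_* (r + 6)) (size₅ q) ⟨
    (q ^ 3 + 1) * (suc q * suc q ∸ suc q + 1) * (r + 6)  ∎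
    where
    lemma : ∀ S h → 3 * (2 * S * (h + h)) ≡ S * (12 * h)
    lemma = solve-∀
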